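{- Let $a:\mathbb{N}\to\mathbb{C}$ be a multiplicative and automatic sequence. Then $a$ is $p$-automatic for some prime $p$ and takes the form \[ a(n)=f_1(\nu_p(n))\cdot f_2\big(n/p^{\nu_p(n)}\big)\qquad (n\in\mathbb{N}),\] where $f_1:\mathbb{N}_0\to\mathbb{C}$ is eventually periodic with $f_1(0)=1$, and $f_2:\mathbb{N}\to\mathbb{C}$ is multiplicative, eventually periodic and vanishes at all multiples of $p$. Furthermore, for any prime $p$, any sequence given by this formula with $f_1,f_2$ satisfying these conditions is multiplicative and $p$-automatic, and this decomposition (i.e. the pair $f_1,f_2$) is unique unless $a$ is eventually periodic.
   Context: $\mathbb{N}=\{1,2,\dots\}$, $\mathbb{N}_0=\{0,1,2,\dots\}$. A sequence $u:\mathbb{N}\to\mathbb{C}$ is multiplicative if $u(mn)=u(m)u(n)$ for all coprime $m,n\in\mathbb{N}$. For an integer $\lambda\ge 2$, a sequence $f$ is $\lambda$-automatic if its $\lambda$-kernel $\{(f(n\lambda^k+r))_{n\ge0}: k\ge0,\ 0\le r<\lambda^k\}$ is finite (equivalently, it is generated by a finite automaton reading base-$\lambda$ digits); a sequence is $1$-automatic iff it is eventually periodic; a sequence is automatic if it is $\lambda$-automatic for some $\lambda\ge2$. For a prime $p$, $\nu_p(n)$ is the $p$-adic valuation of $n$ (the largest $k$ with $p^k\mid n$). -}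

module Defs where

open import Level using (Level; suc; _⊔_)
open import Data.Nat as ℕ using (ℕ; zero; _<_; _≤_)
open import Data.Nat.Divisibility using (_∣_)
open import Data.Nat.Coprimality using (Coprime)
open import Data.List using (List)
open import Data.List.Relation.Unary.Any using (Any)
open import Data.Product using (Σ; ∃; _×_; _,_)
open import Relation.Nullary using (¬_; yes; no)
open import Relation.Binary.PropositionalEquality using (_≡_)
open import Algebra.Bundles using (CommutativeRing)

-- Stand-in for ℂ: a field of characteristic zero

ringFromℕ : ∀ {c ℓ} (R : CommutativeRing c ℓ) → ℕ → CommutativeRing.Carrier R
ringFromℕ R zero = CommutativeRing.0# R
ringFromℕ R (ℕ.suc n) = CommutativeRing._+_ R (CommutativeRing.1# R) (ringFromℕ R n)

record CharZeroField (c ℓ : Level) : Set (suc (c ⊔ ℓ)) where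
  field
    commRing : CommutativeRing c ℓ
  open CommutativeRing commRing
  field
    0≉1      : ¬ (0# ≈ 1#)
    inverse  : ∀ x → ¬ (x ≈ 0#) → Σ Carrier (λ y → x * y ≈ 1#)
    charZero : ∀ n → ringFromℕ commRing n ≈ 0# → n ≡ 0
  open CommutativeRing commRing public

-- fuel-bounded stripping of factors p; with fuel n it is exact for n ≥ 1, p ≥ 2
νAux : ℕ → ℕ → ℕ → ℕ
νAux zero p n = 0
νAux (ℕ.suc f) zero n = 0
νAux (ℕ.suc f) (ℕ.suc zero) n = 0
νAux (ℕ.suc f) (ℕ.suc (ℕ.suc q)) n with n ℕ.% ℕ.suc (ℕ.suc q) ℕ.≟ 0
... | yes _ = ℕ.suc (νAux f (ℕ.suc (ℕ.suc q)) (n ℕ./ ℕ.suc (ℕ.suc q)))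
... | no _ = 0

freeAux : ℕ → ℕ → ℕ → ℕ
freeAux zero p n = n
freeAux (ℕ.suc f) zero n = n
freeAux (ℕ.suc f) (ℕ.suc zero) n = n
freeAux (ℕ.suc f) (ℕ.suc (ℕ.suc q)) n with n ℕ.% ℕ.suc (ℕ.suc q) ℕ.≟ 0
... | yes _ = freeAux f (ℕ.suc (ℕ.suc q)) (n ℕ./ ℕ.suc (ℕ.suc q))
... | no _ = n

ν : ℕ → ℕ → ℕ
ν p n = νAux n p n

pFree : ℕ → ℕ → ℕ
pFree p n = freeAux n p n

-- Notions for sequences with values in a carrier with equality _≈_.
-- A sequence ℕ → ℂ (on ℕ = {1,2,...}) is modelled as ℕ → A whose value at 0
-- is irrelevant for all notions below involving n ≥ 1.

module Sequences {a ℓ} {A : Set a} (_≈_ : A → A → Set ℓ) where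

  EventuallyPeriodic : (ℕ → A) → Set ℓ
  EventuallyPeriodic f =
    ∃ λ N → ∃ λ P → 1 ≤ P × (∀ n → N ≤ n → f (n ℕ.+ P) ≈ f n)

  -- λ-automatic via finiteness of the λ-kernel: all kernel sequences
  -- n ↦ f (n λ^k + r) (k ≥ 0, 0 ≤ r < λ^k) are pointwise equal to one of
  -- finitely many sequences
  Automatic[_] : ℕ → (ℕ → A) → Set (a ⊔ ℓ)
  Automatic[ b ] f = 2 ≤ b ×
    Σ (List (ℕ → A)) λ L →
      ∀ k r → r < b ℕ.^ k → Any (λ g → ∀ n → f (n ℕ.* b ℕ.^ k ℕ.+ r) ≈ g n) L

  Automatic : (ℕ → A) → Set (a ⊔ ℓ)
  Automatic f = ∃ λ b → Automatic[ b ] f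

module _ {c ℓ} (F : CharZeroField c ℓ) where
  open CharZeroField F
  open Sequences _≈_ public

  Multiplicative : (ℕ → Carrier) → Set ℓ
  Multiplicative u = ∀ m n → 1 ≤ m → 1 ≤ n → Coprime m n → u (m ℕ.* n) ≈ (u m * u n)

  formula : ℕ → (ℕ → Carrier) → (ℕ → Carrier) → ℕ → Carrier
  formula p f₁ f₂ n = f₁ (ν p n) * f₂ (pFree p n)

  Admissible : ℕ → (ℕ → Carrier) → (ℕ → Carrier) → Set ℓ
  Admissible p f₁ f₂ =
    f₁ 0 ≈ 1# × EventuallyPeriodic f₁ ×
    Multiplicative f₂ × EventuallyPeriodic f₂ ×
    (∀ n → 1 ≤ n → p ∣ n → f₂ n ≈ 0#)

  Decomposition : ℕ → (ℕ → Carrier) → (ℕ → Carrier) → (ℕ → Carrier) → Set ℓ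
  Decomposition p u f₁ f₂ =
    Admissible p f₁ f₂ × (∀ n → 1 ≤ n → u n ≈ formula p f₁ f₂ n)

{-# OPTIONS --safe #-}
module Submission where

-- Let u be multiplicative and computed by an automaton reading base-b digits, least significant
-- digit first, and let p be a prime divisor of b.  The main point is that u is eventually
-- periodic on the integers prime to p.
--
-- (1) Two states whose sequences agree on one residue class modulo M, with M prime to b and to a
-- constant, agree on all arguments containing a certain word w: w leads every pair of states
-- to a pair with two return words of equal length, and with those every residue modulo M is hit.
--
-- (2) By pigeonhole u(r + bᵏx) = u(r + h + bᵏx) for all x.  Multiplying by Q and applying (1)
-- modulo Q² transports this relation to every residue class prime to p, with shift Q h.  The
-- shifts Q h and Q′h with Q ≡ Q′ combine to a period H for the numbers containing w.
--
-- (3) The value v of u at the numbers ρ ≡ 1 mod H in suitable cells is idempotent; comparing x ρ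
-- with (x + H) ρ′ gives u(x) v = u(x + H) v, and u(Q) is a multiple of v if Q contains w.
--
-- (4) For large z prime to p, u(z) is a multiple of v.  Pumping z yields zᵢ and an exact
-- factorisation z_{i+j} = zᵢ (1 + bᵏW); pumping 1 + bᵏW to V = 1 + T W and factoring
-- 1 + T tᵏ W = V m yields m = 1 - T W + T²W² - …, which has so many long blocks of zeros
-- that it can be pumped to be ≡ Q mod Q² with Q as in (3).
--
-- Hence u(z) = u(z) v = u(z + H) v = u(z + H).  All of this takes place in the multiplicative
-- monoid, so that neither decidability of equality nor cancellation is needed.

-- Multiplicativity speaks about coprime factors, an automaton about digits; the modulus Q² joins
-- the two. A number ≡ Q modulo Q² is Q times a number ≡ 1 modulo Q, so u splits there. Such
-- splittings happen only on one progression, while two states may differ off it; return words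
-- adjust the residue without changing the states, which is why arguments must contain a universal
-- word.
--
-- The series of 1/(1 + T W) alternates and so is not a sum of digit blocks. Pairing its terms, T²
-- W² - T W = T W D with D = T W - 1, makes every block nonnegative.
--
-- The overview ends with periodicity off one prime p of b. From there, `f₂` is u off p and 0 on
-- multiples of p, and `f₁` records u on the powers of p. If b is a power of p, pumping zero digits
-- makes `f₁` eventually periodic. Otherwise b has another prime divisor p′, the powers of p are
-- prime to p′, and the periodicity off p′ applies to them. That u is p-automatic is then read off
-- from the formula, so any prime divisor of b serves as p, even if b is not a prime power.

open import Defs
open import Level using (_⊔_)
open import Algebra.Bundles using (CommutativeMonoid)
open import Data.Nat using (ℕ; zero; suc; _+_; _*_; _∸_; _^_; _≤_; _<_; z≤n; s≤s; s≤s⁻¹; NonZero; >-nonZero; _!; _%_; _/_; ∣_-_∣)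
open import Data.Nat.Properties
open import Data.Nat.DivMod using (m≡m%n+[m/n]*n; m%n<n; m<n*o⇒m/o<n; m∣n⇒o%n%m≡o%m; m≥n⇒m/n>0; m*n/n≡m; /-congˡ)
open import Data.Nat.Divisibility
open import Data.Nat.GCD using (gcd; gcd[m,n]∣m; gcd[m,n]∣n; gcd-greatest)
open import Data.Nat.Coprimality as Cop using (Coprime; coprime-divisor)
open import Data.Nat.ListAction using (product)
open import Data.Nat.Primality using (Prime; euclidsLemma; prime⇒irreducible; prime⇒nonZero; prime⇒nonTrivial)
open import Data.Nat.Primality.Factorisation using (factorise)
open import Data.Nat.Tactic.RingSolver using (solve-∀)
open import Data.Fin using (Fin; zero; suc; toℕ; fromℕ<; combine)
open import Data.Fin.Properties as Fin using (pigeonhole; toℕ-fromℕ<; toℕ<n; injective⇒≤; all?; any?; ¬∀⟶∃¬; combine-injective)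
open import Data.List using (List; []; _∷_; _++_; map; length; lookup; upTo; allFin; cartesianProduct)
open import Data.List.Relation.Unary.All as All using (All; []; _∷_)
open import Data.List.Relation.Unary.Any as Any using (Any)
open import Data.List.Relation.Unary.Any.Properties using (lookup-index; map⁺; ++⁺ˡ; ++⁺ʳ)
open import Data.List.Membership.Propositional using (lose)
open import Data.List.Membership.Propositional.Properties using (∈-upTo⁺; ∈-allFin; ∈-cartesianProduct⁺)
open import Data.Product using (Σ; ∃; ∃₂; _×_; _,_; proj₁; proj₂)
open import Data.Sum using (_⊎_; inj₁; inj₂)
open import Data.Empty using (⊥-elim)
open import Function.Definitions using (Injective)
open import Relation.Binary.Structures using (IsEquivalence)
open import Relation.Nullary using (¬_; yes; no)
open import Relation.Binary.PropositionalEquality using (_≡_; refl; sym; trans; cong; cong₂; subst; subst₂; module ≡-Reasoning)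

-- Congruences

infix 4 _≡_[mod_]

-- Shifts on both sides avoid subtraction, so that closure rules become ring identities; for `M = 0`
-- the relation is equality.
record _≡_[mod_] (a b M : ℕ) : Set where
  constructor shifts
  field
    up₁ up₂ : ℕ
    balance : a + up₁ * M ≡ b + up₂ * M

cg-≡ : ∀ {a b M} → a ≡ b → a ≡ b [mod M ]
cg-≡ refl = shifts 0 0 refl

cg-refl : ∀ {a M} → a ≡ a [mod M ]
cg-refl = cg-≡ refl

cg-sym : ∀ {a b M} → a ≡ b [mod M ] → b ≡ a [mod M ]
cg-sym (shifts x y e) = shifts y x (sym e)

cg-trans : ∀ {a b c M} → a ≡ b [mod M ] → b ≡ c [mod M ] → a ≡ c [mod M ]
cg-trans {a} {b} {c} {M} (shifts x y e) (shifts x′ y′ e′) = shifts (x + x′) (y + y′) (begin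
  a + (x + x′) * M      ≡⟨ lem a x x′ M ⟩
  (a + x * M) + x′ * M  ≡⟨ cong (_+ x′ * M) e ⟩
  (b + y * M) + x′ * M  ≡⟨ lem₂ b y x′ M ⟩
  (b + x′ * M) + y * M  ≡⟨ cong (_+ y * M) e′ ⟩
  (c + y′ * M) + y * M  ≡⟨ lem₃ c y′ y M ⟩
  c + (y + y′) * M      ∎)
  where
  open ≡-Reasoning
  lem : ∀ a x x′ M → a + (x + x′) * M ≡ (a + x * M) + x′ * M
  lem = solve-∀
  lem₂ : ∀ b y x′ M → (b + y * M) + x′ * M ≡ (b + x′ * M) + y * M
  lem₂ = solve-∀
  lem₃ : ∀ c y′ y M → (c + y′ * M) + y * M ≡ c + (y + y′) * M
  lem₃ = solve-∀

cg-+ : ∀ {a b c d M} → a ≡ b [mod M ] → c ≡ d [mod M ] → a + c ≡ b + d [mod M ]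
cg-+ {a} {b} {c} {d} {M} (shifts x y e) (shifts x′ y′ e′) = shifts (x + x′) (y + y′)
  (trans (lem a c x x′ M) (trans (cong₂ _+_ e e′) (sym (lem b d y y′ M))))
  where
  lem : ∀ a c x x′ M → a + c + (x + x′) * M ≡ (a + x * M) + (c + x′ * M)
  lem = solve-∀

cg-+ˡ : ∀ {a b M} k → a ≡ b [mod M ] → k + a ≡ k + b [mod M ]
cg-+ˡ k = cg-+ {k} {k} cg-refl

cg-+ʳ : ∀ {a b M} k → a ≡ b [mod M ] → a + k ≡ b + k [mod M ]
cg-+ʳ k p = cg-+ {c = k} p cg-refl

cg-*ˡ : ∀ {a b M} k → a ≡ b [mod M ] → k * a ≡ k * b [mod M ]
cg-*ˡ {a} {b} {M} k (shifts x y e) = shifts (k * x) (k * y)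
  (trans (lem k a x M) (trans (cong (k *_) e) (sym (lem k b y M))))
  where
  lem : ∀ k a x M → k * a + k * x * M ≡ k * (a + x * M)
  lem = solve-∀

cg-* : ∀ {a b c d M} → a ≡ b [mod M ] → c ≡ d [mod M ] → a * c ≡ b * d [mod M ]
cg-* {a} {b} {c} {d} p q = cg-trans (cg-*ˡ a q)
  (cg-trans (cg-≡ (*-comm a d)) (cg-trans (cg-*ˡ d p) (cg-≡ (*-comm d b))))

cg-^ : ∀ {a b M} k → a ≡ b [mod M ] → a ^ k ≡ b ^ k [mod M ]
cg-^ zero    p = cg-refl
cg-^ (suc k) p = cg-* p (cg-^ k p)

cg-1^ : ∀ {a M} k → a ≡ 1 [mod M ] → a ^ k ≡ 1 [mod M ]
cg-1^ k p = cg-trans (cg-^ k p) (cg-≡ (^-zeroˡ k))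

cg-+multiple : ∀ {M} a k → a + M * k ≡ a [mod M ]
cg-+multiple {M} a k = shifts 0 k (trans (+-identityʳ _) (cong (a +_) (*-comm M k)))

cg-weaken : ∀ {a b d M} → d ∣ M → a ≡ b [mod M ] → a ≡ b [mod d ]
cg-weaken {a} {b} {d} (divides q refl) (shifts x y e) = shifts (x * q) (y * q)
  (trans (cong (a +_) (*-assoc x q d)) (trans e (cong (b +_) (sym (*-assoc y q d)))))

cg-∣ : ∀ {a b d M} → d ∣ M → a ≡ b [mod M ] → d ∣ a → d ∣ b
cg-∣ {a} {b} {d} {M} d∣M (shifts x y e) d∣a = ∣m+n∣m⇒∣n
  (subst (d ∣_) (trans e (+-comm b (y * M))) (∣m∣n⇒∣m+n d∣a (∣n⇒∣m*n x d∣M))) (∣n⇒∣m*n y d∣M)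

cg-0⇒∣ : ∀ {a M} → a ≡ 0 [mod M ] → M ∣ a
cg-0⇒∣ p = cg-∣ ∣-refl (cg-sym p) (_ ∣0)

∣⇒cg-0 : ∀ {a M} → M ∣ a → a ≡ 0 [mod M ]
∣⇒cg-0 (divides q e) = shifts 0 q (trans (+-identityʳ _) e)

cg-coprime : ∀ {a b M} → a ≡ b [mod M ] → Coprime M a → Coprime M b
cg-coprime p c (d∣M , d∣b) = c (d∣M , cg-∣ d∣M (cg-sym p) d∣b)

cg-1⇒coprime : ∀ {a M} → a ≡ 1 [mod M ] → Coprime M a
cg-1⇒coprime p = cg-coprime (cg-sym p) (Cop.sym (Cop.1-coprimeTo _))

cg-+-cancelˡ : ∀ {a b M} k → k + a ≡ k + b [mod M ] → a ≡ b [mod M ]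
cg-+-cancelˡ {a} {b} {M} k (shifts x y e) = shifts x y
  (+-cancelˡ-≡ k _ _ (trans (sym (+-assoc k a _)) (trans e (+-assoc k b _))))

opaque
  cg-split : ∀ {a b M} → a ≡ b [mod M ] → b ≤ a → ∃ λ z → a ≡ b + M * z
  cg-split {a} {b} {M} p b≤a = from (cg-0⇒∣ (cg-+-cancelˡ b
    (cg-trans (cg-≡ (m+[n∸m]≡n b≤a)) (cg-trans p (cg-≡ (sym (+-identityʳ b)))))))
    where
    from : M ∣ a ∸ b → ∃ λ z → a ≡ b + M * z
    from (divides q e) = q , trans (sym (m+[n∸m]≡n b≤a)) (cong (b +_) (trans e (*-comm q M)))

cg-% : ∀ a M .{{_ : NonZero M}} → a ≡ a % M [mod M ]
cg-% a M = shifts 0 (a / M) (trans (+-identityʳ a) (m≡m%n+[m/n]*n a M))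

%≡⇒cg : ∀ a b M .{{_ : NonZero M}} → a % M ≡ b % M → a ≡ b [mod M ]
%≡⇒cg a b M e = cg-trans (cg-% a M) (cg-trans (cg-≡ e) (cg-sym (cg-% b M)))

cg⇒∣∸ : ∀ {a b d} → a ≡ b [mod d ] → a ≤ b → d ∣ b ∸ a
cg⇒∣∸ {a} {b} {d} p a≤b = cg-0⇒∣ (cg-+-cancelˡ a
  (cg-trans (cg-≡ (m+[n∸m]≡n a≤b)) (cg-trans (cg-sym p) (cg-≡ (sym (+-identityʳ a))))))

-- Coprimality and primes

coprime-*ʳ : ∀ {k m n} → Coprime k m → Coprime k n → Coprime k (m * n)
coprime-*ʳ {k} {m} {n} cm cn {d} (d∣k , d∣mn) = cn (d∣k , coprime-divisor {m = d} {n = m} (λ (x , y) → cm (∣-trans x d∣k , y)) d∣mn)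

coprime-^ʳ : ∀ {k m} j → Coprime k m → Coprime k (m ^ j)
coprime-^ʳ zero    c = Cop.sym (Cop.1-coprimeTo _)
coprime-^ʳ (suc j) c = coprime-*ʳ c (coprime-^ʳ j c)

coprime-∣ʳ : ∀ {k m n} → m ∣ n → Coprime k n → Coprime k m
coprime-∣ʳ m∣n c (x , y) = c (x , ∣-trans y m∣n)

coprime-∣ˡ : ∀ {k m n} → k ∣ n → Coprime n m → Coprime k m
coprime-∣ˡ k∣n c (x , y) = c (∣-trans x k∣n , y)

prime∤⇒coprime : ∀ {p a} → Prime p → ¬ p ∣ a → Coprime p a
prime∤⇒coprime pp p∤a (d∣p , d∣a) with prime⇒irreducible pp d∣p
... | inj₁ d≡1  = d≡1
... | inj₂ refl = ⊥-elim (p∤a d∣a)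

prime≥2 : ∀ {p} → Prime p → 2 ≤ p
prime≥2 {zero} pp with () ← prime⇒nonZero pp
prime≥2 {suc zero} pp with () ← prime⇒nonTrivial pp
prime≥2 {suc (suc p)} pp = s≤s (s≤s z≤n)

prime∤1 : ∀ {p} → Prime p → ¬ p ∣ 1
prime∤1 pp p∣1 with prime≥2 pp
... | 2≤p = <-irrefl refl (subst (2 ≤_) (∣1⇒≡1 p∣1) 2≤p)

-- Pigeonhole principle, powers modulo M, linear congruences

opaque
  pigeonhole-ℕ : ∀ {n N} → n < N → (f : ℕ → Fin n) → ∃₂ λ i j → i < j × j < N × f i ≡ f j
  pigeonhole-ℕ n<N f = let i , j , i<j , e = pigeonhole n<N (λ k → f (toℕ k)) in
    toℕ i , toℕ j , i<j , toℕ<n j , e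

  power-repeats : ∀ a M → 1 ≤ M → ∃₂ λ i j → i < j × a ^ i ≡ a ^ j [mod M ]
  power-repeats a M@(suc _) 1≤M =
    let i , j , i<j , _ , e = pigeonhole-ℕ (n<1+n M) (λ k → fromℕ< (m%n<n (a ^ k) M)) in
    i , j , i<j , %≡⇒cg _ _ M (trans (sym (toℕ-fromℕ< _)) (trans (cong toℕ e) (toℕ-fromℕ< _)))

opaque
  powers-periodic : ∀ a M → 1 ≤ M → ∃₂ λ i P → 1 ≤ P × (∀ m → i ≤ m → a ^ (m + P) ≡ a ^ m [mod M ])
  powers-periodic a M 1≤M with i , j , i<j , rep ← power-repeats a M 1≤M
    with P , refl ← m≤n⇒∃[o]m+o≡n i<j = i , suc P , s≤s z≤n , periodic
    where
    lem : ∀ i x P → i + x + suc P ≡ x + (suc i + P)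
    lem = solve-∀
    periodic : ∀ m → i ≤ m → a ^ (m + suc P) ≡ a ^ m [mod M ]
    periodic m i≤m with x , refl ← m≤n⇒∃[o]m+o≡n i≤m = cg-trans
      (cg-≡ (trans (cong (a ^_) (lem i x P)) (^-distribˡ-+-* a x (suc i + P))))
      (cg-trans (cg-*ˡ (a ^ x) (cg-sym rep))
        (cg-≡ (trans (sym (^-distribˡ-+-* a x i)) (cong (a ^_) (+-comm x i)))))

opaque
  cg-*-cancelˡ : ∀ {a b M} k → Coprime M k → k * a ≡ k * b [mod M ] → a ≡ b [mod M ]
  cg-*-cancelˡ {a} {b} {M} k c p with ≤-total a b
  ... | inj₁ a≤b = cg-sym (cancel a≤b (cg-sym p))
    where
    cancel : ∀ {a b} → a ≤ b → k * b ≡ k * a [mod M ] → b ≡ a [mod M ]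
    cancel {a} a≤b p with w , refl ← m≤n⇒∃[o]m+o≡n a≤b =
      cg-trans (cg-+ cg-refl (∣⇒cg-0 (coprime-divisor c (cg-0⇒∣ kw≡0)))) (cg-≡ (+-identityʳ a))
      where
      kw≡0 : k * w ≡ 0 [mod M ]
      kw≡0 = cg-+-cancelˡ (k * a) (cg-trans (cg-≡ (sym (*-distribˡ-+ k a w)))
               (cg-trans p (cg-≡ (sym (+-identityʳ _)))))
  ... | inj₂ b≤a with w , refl ← m≤n⇒∃[o]m+o≡n b≤a =
    cg-trans (cg-+ cg-refl (∣⇒cg-0 (coprime-divisor c (cg-0⇒∣ kw≡0)))) (cg-≡ (+-identityʳ b))
    where
    kw≡0 : k * w ≡ 0 [mod M ]
    kw≡0 = cg-+-cancelˡ (k * b) (cg-trans (cg-≡ (sym (*-distribˡ-+ k b w)))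
             (cg-trans p (cg-≡ (sym (+-identityʳ _)))))

opaque
  -- Cancelling `a ^ i`, which is prime to M, turns eventual periodicity of the powers into pure
  -- periodicity.
  order : ∀ a M → 1 ≤ M → Coprime M a → ∃ λ N → 1 ≤ N × a ^ N ≡ 1 [mod M ]
  order a M 1≤M c with i , P , 1≤P , per ← powers-periodic a M 1≤M =
    P , 1≤P , cg-*-cancelˡ (a ^ i) (coprime-^ʳ i c)
      (cg-trans (cg-≡ (sym (^-distribˡ-+-* a i P))) (cg-trans (per i ≤-refl) (cg-≡ (sym (*-identityʳ _)))))

opaque
  linear-congruence : ∀ a M → 1 ≤ M → Coprime M a → ∀ s t → ∃ λ x → x < M × s + a * x ≡ t [mod M ]
  linear-congruence a M@(suc M-1) 1≤M c s t with suc N , _ , ord ← order a M 1≤M c =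
    x % M , m%n<n x M , cg-trans (cg-+ cg-refl (cg-*ˡ a (cg-sym (cg-% x M)))) solves
    where
    x : ℕ
    -- `a ^ N` is inverse to a modulo M, and `M-1 * s` stands for -s.
    x = a ^ N * (t + M-1 * s)
    lem : ∀ s M-1 t → s + (t + M-1 * s) ≡ t + suc M-1 * s
    lem = solve-∀
    solves : s + a * x ≡ t [mod M ]
    solves = cg-trans (cg-+ cg-refl (cg-trans (cg-≡ (sym (*-assoc a (a ^ N) _)))
               (cg-trans (cg-* ord cg-refl) (cg-≡ (*-identityˡ _)))))
             (cg-trans (cg-≡ (lem s M-1 t)) (cg-+multiple t s))

opaque
  arithmetic-progression-hits : ∀ a d lo → 1 ≤ d → a ≤ lo →
    ∃ λ g → lo ≤ a + d * g × a + d * g ≤ lo + d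
  arithmetic-progression-hits a d lo 1≤d a≤lo = suc q , lower , upper
    where
    instance
      d≢0 : NonZero d
      d≢0 = >-nonZero 1≤d
    e q : ℕ
    e = lo ∸ a
    q = e / d
    open ≤-Reasoning
    eq : a + e ≡ lo
    eq = m+[n∸m]≡n a≤lo
    lower : lo ≤ a + d * suc q
    lower = begin
      lo                    ≡⟨ sym eq ⟩
      a + e                 ≡⟨ cong (a +_) (m≡m%n+[m/n]*n e d) ⟩
      a + (e % d + q * d)   ≤⟨ +-monoʳ-≤ a (+-monoˡ-≤ (q * d) (<⇒≤ (m%n<n e d))) ⟩
      a + (d + q * d)       ≡⟨ cong (λ z → a + z) (*-comm (suc q) d) ⟩
      a + d * suc q         ∎
    lem : ∀ a d q → a + d * suc q ≡ a + q * d + d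
    lem = solve-∀
    upper : a + d * suc q ≤ lo + d
    upper = begin
      a + d * suc q           ≡⟨ lem a d q ⟩
      a + q * d + d           ≤⟨ +-monoˡ-≤ d (+-monoʳ-≤ a (m≤n+m (q * d) (e % d))) ⟩
      a + (e % d + q * d) + d ≡⟨ cong (λ z → a + z + d) (sym (m≡m%n+[m/n]*n e d)) ⟩
      a + e + d               ≡⟨ cong (_+ d) eq ⟩
      lo + d                  ∎

1≤b^ : ∀ {b} k → 1 ≤ b → 1 ≤ b ^ k
1≤b^ {b} k 1≤b = m^n>0 b {{>-nonZero 1≤b}} k

base∣power : ∀ b {k} → 1 ≤ k → b ∣ b ^ k
base∣power b {suc k} _ = m∣m*n (b ^ k)

n<b^n : ∀ {b} n → 2 ≤ b → n < b ^ n
n<b^n zero    2≤b = s≤s z≤n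
n<b^n {b} (suc n) 2≤b = begin-strict
  suc n           <⟨ s≤s (n<b^n n 2≤b) ⟩
  suc (b ^ n)     ≤⟨ +-monoˡ-≤ (b ^ n) (1≤b^ n (≤-trans (s≤s z≤n) 2≤b)) ⟩
  b ^ n + b ^ n   ≡⟨ cong (b ^ n +_) (sym (+-identityʳ _)) ⟩
  2 * b ^ n       ≤⟨ *-monoˡ-≤ (b ^ n) 2≤b ⟩
  b * b ^ n       ∎
  where open ≤-Reasoning

∣! : ∀ {m n} → 1 ≤ m → m ≤ n → m ∣ n !
∣! {suc m} 1≤m m≤n = ∣-trans (m∣m*n (m !)) (m≤n⇒m!∣n! m≤n)

opaque
  p-part : ∀ p → Prime p → ∀ n → 1 ≤ n → ∃₂ λ x n′ → n ≡ p ^ x * n′ × ¬ p ∣ n′ × 1 ≤ n′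
  p-part p pp n 1≤n = go n n ≤-refl 1≤n
    where
    go : ∀ fuel n → n ≤ fuel → 1 ≤ n → ∃₂ λ x n′ → n ≡ p ^ x * n′ × ¬ p ∣ n′ × 1 ≤ n′
    go zero    n n≤0 1≤n = ⊥-elim (<-irrefl refl (≤-trans 1≤n n≤0))
    go (suc f) n n≤f 1≤n with p ∣? n
    ... | no p∤n = 0 , n , sym (+-identityʳ n) , p∤n , 1≤n
    ... | yes (divides zero refl) = ⊥-elim (<-irrefl refl 1≤n)
    ... | yes (divides q@(suc q′) refl)
      with x , n′ , e , p∤n′ , 1≤n′ ← go f q (s≤s⁻¹ (≤-trans (m<m*n q p (prime≥2 pp)) n≤f)) (s≤s z≤n)
      = suc x , n′ , trans (cong (_* p) e) (lem (p ^ x) n′ p) , p∤n′ , 1≤n′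
      where
      lem : ∀ a n p → a * n * p ≡ p * a * n
      lem = solve-∀

-- From a finite kernel to an automaton

-- A finite automaton reading base-b digits, least significant first; G q is the
-- sequence computed from the state q.
record Machine {a ℓ} {A : Set a} (_≈_ : A → A → Set ℓ) (b : ℕ) (u : ℕ → A) : Set (a ⊔ ℓ) where
  field
    size   : ℕ
    start  : Fin size
    δ      : Fin size → ℕ → Fin size
    G      : Fin size → ℕ → A
    G-step : ∀ q d m → d < b → G q (d + b * m) ≈ G (δ q d) m
    G-start : ∀ m → u m ≈ G start m

module _ {a ℓ} {A : Set a} {_≈_ : A → A → Set ℓ} (isEq : IsEquivalence _≈_)
  {b : ℕ} {u : ℕ → A} (L : List (ℕ → A))
  (kernel : ∀ k r → r < b ^ k → Any (λ g → ∀ n → u (n * b ^ k + r) ≈ g n) L) where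

  open IsEquivalence isEq renaming (refl to ≈-refl; sym to ≈-sym; trans to ≈-trans; reflexive to ≈-reflexive)

  private
    Rep : Set
    Rep = ∃₂ λ k r → r < b ^ k

    seq : Rep → ℕ → A
    seq (k , r , _) n = u (n * b ^ k + r)

    -- Equality of sequences need not be decidable, so residues are identified when `kernel` matches
    -- them with the same entry of L.
    class : Rep → Fin (length L)
    class (k , r , r<) = Any.index (kernel k r r<)

    class-seq : ∀ R R′ → class R ≡ class R′ → ∀ n → seq R n ≈ seq R′ n
    class-seq (k , r , r<) (k′ , r′ , r′<) e n = ≈-trans (lookup-index (kernel k r r<) n)
      (≈-trans (≈-reflexive (cong (λ i → lookup L i n) e)) (≈-sym (lookup-index (kernel k′ r′ r′<) n)))

    child : Rep → Fin b → Rep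
    child (k , r , r<) d = suc k , r + toℕ d * b ^ k , (begin-strict
      r + toℕ d * b ^ k      <⟨ +-monoˡ-< (toℕ d * b ^ k) r< ⟩
      suc (toℕ d) * b ^ k    ≤⟨ *-monoˡ-≤ (b ^ k) (toℕ<n d) ⟩
      b * b ^ k              ∎)
      where open ≤-Reasoning

    child-seq : ∀ R d m → seq R (toℕ d + b * m) ≈ seq (child R d) m
    child-seq (k , r , _) d m = ≈-reflexive (cong u (lem (toℕ d) b m (b ^ k) r))
      where
      lem : ∀ d b m B r → (d + b * m) * B + r ≡ m * (b * B) + (r + d * B)
      lem = solve-∀

    Closed : ∀ {N} → (Fin N → Rep) → Set
    Closed reps = ∀ i d → ∃ λ j → class (child (reps i) d) ≡ class (reps j)

    root : Rep
    root = 0 , 0 , s≤s z≤n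

    -- A child of a new class is added as long as there is one. The classes stay distinct, so there
    -- are never more than `length L` representatives and the fuel cannot run out first.
    closure : ∀ fuel {N} (reps : Fin N → Rep) (i₀ : Fin N) → reps i₀ ≡ root →
      Injective _≡_ _≡_ (λ i → class (reps i)) → length L < N + fuel →
      ∃ λ N′ → Σ (Fin N′ → Rep) λ reps′ → Closed reps′ × ∃ λ i → reps′ i ≡ root
    closure zero {N} reps i₀ e inj lt =
      ⊥-elim (<-irrefl refl (≤-trans (subst (length L <_) (+-identityʳ N) lt) (injective⇒≤ inj)))
    closure (suc fuel) {N} reps i₀ e inj lt
      with all? (λ i → all? (λ d → any? (λ j → class (child (reps i) d) Fin.≟ class (reps j))))
    ... | yes closed = N , reps , closed , i₀ , e
    ... | no ¬closed with i , ¬all ← ¬∀⟶∃¬ N _ (λ i → all? (λ d → any? (λ j → class (child (reps i) d) Fin.≟ class (reps j)))) ¬closed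
      with d , new ← ¬∀⟶∃¬ b _ (λ d → any? (λ j → class (child (reps i) d) Fin.≟ class (reps j))) ¬all
      = closure fuel reps′ (suc i₀) e inj′ (subst (length L <_) (+-suc N fuel) lt)
      where
      reps′ : Fin (suc N) → Rep
      reps′ zero    = child (reps i) d
      reps′ (suc j) = reps j
      inj′ : Injective _≡_ _≡_ (λ i → class (reps′ i))
      inj′ {zero}  {zero}  _ = refl
      inj′ {zero}  {suc j} h = ⊥-elim (new (j , h))
      inj′ {suc j} {zero}  h = ⊥-elim (new (j , sym h))
      inj′ {suc j} {suc k} h = cong suc (inj h)

    closed-reps : ∃ λ N → Σ (Fin N → Rep) λ reps → Closed reps × ∃ λ i → reps i ≡ root
    closed-reps = closure (length L) (λ (_ : Fin 1) → root) zero refl unique (n<1+n _)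
      where
      unique : Injective _≡_ _≡_ (λ (i : Fin 1) → class root)
      unique {zero} {zero} _ = refl

  kernel⇒machine : Machine _≈_ b u
  kernel⇒machine with N , reps , closed , i₀ , e ← closed-reps = record
    { size = N ; start = i₀ ; δ = δ ; G = λ i → seq (reps i) ; G-step = step
    ; G-start = λ m → ≈-trans (≈-reflexive (cong u (lem m))) (≈-reflexive (cong (λ R → seq R m) (sym e))) }
    where
    lem : ∀ m → m ≡ m * 1 + 0
    lem = solve-∀
    δ : Fin N → ℕ → Fin N
    δ i d with d <? b
    ... | yes d<b = proj₁ (closed i (fromℕ< d<b))
    -- A default value: `G-step` concerns only digits below b.
    ... | no _    = i
    step : ∀ i d m → d < b → seq (reps i) (d + b * m) ≈ seq (reps (δ i d)) m
    step i d m d<b with d <? b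
    ... | no d≮b = ⊥-elim (d≮b d<b)
    ... | yes d<b′ = ≈-trans (≈-reflexive (cong (λ z → seq (reps i) (z + b * m)) (sym (toℕ-fromℕ< d<b′))))
      (≈-trans (child-seq (reps i) (fromℕ< d<b′) m)
        (class-seq (child (reps i) (fromℕ< d<b′)) (reps (proj₁ (closed i (fromℕ< d<b′)))) (proj₂ (closed i (fromℕ< d<b′))) m))

-- Universal words

module Digits {a ℓ} {A : Set a} {_≈_ : A → A → Set ℓ} (isEq : IsEquivalence _≈_)
  {b : ℕ} {u : ℕ → A} (2≤b : 2 ≤ b) (machine : Machine _≈_ b u) where

  open IsEquivalence isEq renaming (refl to ≈-refl; sym to ≈-sym; trans to ≈-trans; reflexive to ≈-reflexive)
  open Machine machine

  1≤b : 1 ≤ b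
  1≤b = ≤-trans (s≤s z≤n) 2≤b

  private instance
    b≢0 : NonZero b
    b≢0 = >-nonZero 1≤b

  read : Fin size → ℕ → ℕ → Fin size
  read q zero    r = q
  read q (suc k) r = read (δ q (r % b)) k (r / b)

  -- A word is given by its length k and its value r.
  Read : Fin size → ℕ → ℕ → Fin size → Set ℓ
  Read q k r q′ = ∀ n → G q (r + b ^ k * n) ≈ G q′ n

  read-correct : ∀ q k r → r < b ^ k → Read q k r (read q k r)
  read-correct q zero zero r<1 n = ≈-reflexive (cong (G q) (+-identityʳ n))
  read-correct q zero (suc r) (s≤s ()) n
  read-correct q (suc k) r r<b^k n = ≈-trans (≈-reflexive (cong (G q) eq))
    (≈-trans (G-step q (r % b) (r / b + b ^ k * n) (m%n<n r b))
      (read-correct (δ q (r % b)) k (r / b) (m<n*o⇒m/o<n (subst (r <_) (*-comm b (b ^ k)) r<b^k)) n))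
    where
    lem : ∀ r′ q b B n → (r′ + q * b) + b * B * n ≡ r′ + b * (q + B * n)
    lem = solve-∀
    eq : r + b * b ^ k * n ≡ r % b + b * (r / b + b ^ k * n)
    eq = trans (cong (_+ b * b ^ k * n) (m≡m%n+[m/n]*n r b)) (lem (r % b) (r / b) b (b ^ k) n)

  start-correct : ∀ k r → r < b ^ k → ∀ n → u (r + b ^ k * n) ≈ G (read start k r) n
  start-correct k r r< n = ≈-trans (G-start _) (read-correct start k r r< n)

  ^-+-* : ∀ k l n → b ^ (k + l) * n ≡ b ^ k * (b ^ l * n)
  ^-+-* k l n = trans (cong (_* n) (^-distribˡ-+-* b k l)) (*-assoc (b ^ k) (b ^ l) n)

  zeros-loop : ∀ q → ∃₂ λ i d → 1 ≤ d × i ≤ size × d ≤ size × (∀ n → G q (b ^ (i + d) * n) ≈ G q (b ^ i * n))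
  zeros-loop q with i , j , i<j , j<s , e ← pigeonhole-ℕ (n<1+n size) (λ k → read q k 0)
    with d , refl ← m≤n⇒∃[o]m+o≡n i<j =
    i , suc d , s≤s z≤n , ≤-trans (m≤m+n i d) (≤-trans (n≤1+n _) (s≤s⁻¹ j<s)) ,
    ≤-trans (s≤s (m≤n+m d i)) (s≤s⁻¹ j<s) ,
    λ n → ≈-trans (≈-reflexive (cong (λ z → G q (b ^ z * n)) (+-suc i d)))
      (≈-trans (read-correct q (suc i + d) 0 (1≤b^ (suc i + d) 1≤b) n)
        (≈-trans (≈-reflexive (cong (λ z → G z n) (sym e))) (≈-sym (read-correct q i 0 (1≤b^ i 1≤b) n))))

  -- `size !` is a common multiple of all loop lengths, so one pumping length serves every state;
  -- each loop is entered after at most `size` zeros.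
  zeros-pump : ∀ q k j n → size ≤ k → G q (b ^ (k + size ! * j) * n) ≈ G q (b ^ k * n)
  zeros-pump q k j n s≤k with i , d , 1≤d , i≤s , d≤s , loop ← zeros-loop q
    with divides c e ← ∣! 1≤d d≤s
    = ≈-trans (≈-reflexive (cong (λ z → G q (b ^ (k + z) * n)) (trans (cong (_* j) e) (lem c d j))))
        (iterate k (c * j) n (≤-trans i≤s s≤k))
    where
    lem : ∀ c d j → c * d * j ≡ d * (c * j)
    lem = solve-∀
    once : ∀ m n → i ≤ m → G q (b ^ (m + d) * n) ≈ G q (b ^ m * n)
    once m n i≤m with x , refl ← m≤n⇒∃[o]m+o≡n i≤m = ≈-trans
      (≈-reflexive (cong (G q) (trans (cong (λ z → b ^ z * n) (lem₂ i x d)) (^-+-* (i + d) x n))))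
      (≈-trans (loop (b ^ x * n)) (≈-reflexive (cong (G q) (sym (^-+-* i x n)))))
      where
      lem₂ : ∀ i x d → i + x + d ≡ i + d + x
      lem₂ = solve-∀
    iterate : ∀ m c n → i ≤ m → G q (b ^ (m + d * c) * n) ≈ G q (b ^ m * n)
    iterate m zero    n i≤m = ≈-reflexive (cong (λ z → G q (b ^ z * n)) (trans (cong (m +_) (*-zeroʳ d)) (+-identityʳ m)))
    iterate m (suc c) n i≤m = ≈-trans
      (≈-reflexive (cong (λ z → G q (b ^ z * n)) (lem₃ m d c)))
      (≈-trans (once (m + d * c) n (≤-trans i≤m (m≤m+n m (d * c)))) (iterate m c n i≤m))
      where
      lem₃ : ∀ m d c → m + d * suc c ≡ m + d * c + d
      lem₃ = solve-∀

  Pair : Set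
  Pair = Fin size × Fin size

  record Step (x y : Pair) (k r : ℕ) : Set ℓ where
    constructor step
    field
      left  : Read (proj₁ x) k r (proj₁ y)
      right : Read (proj₂ x) k r (proj₂ y)

  Read-trans : ∀ {q q′ q″} k k′ r r′ → Read q k r q′ → Read q′ k′ r′ q″ → Read q (k + k′) (r + b ^ k * r′) q″
  Read-trans {q} k k′ r r′ f g n = ≈-trans (≈-reflexive (cong (G q) eq)) (≈-trans (f _) (g n))
    where
    lem : ∀ r B r′ B′ n → r + B * r′ + B * B′ * n ≡ r + B * (r′ + B′ * n)
    lem = solve-∀
    eq : r + b ^ k * r′ + b ^ (k + k′) * n ≡ r + b ^ k * (r′ + b ^ k′ * n)
    eq = trans (cong (λ z → r + b ^ k * r′ + z * n) (^-distribˡ-+-* b k k′)) (lem r (b ^ k) r′ (b ^ k′) n)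

  Step-trans : ∀ {x y z k k′ r r′} → Step x y k r → Step y z k′ r′ → Step x z (k + k′) (r + b ^ k * r′)
  Step-trans {k = k} {k′} {r} {r′} (step f g) (step f′ g′) =
    step (Read-trans k k′ r r′ f f′) (Read-trans k k′ r r′ g g′)

  Step-refl : ∀ {x} → Step x x 0 0
  Step-refl {i , j} = step (λ n → ≈-reflexive (cong (G i) (+-identityʳ n))) (λ n → ≈-reflexive (cong (G j) (+-identityʳ n)))

  readPair : Pair → ℕ → ℕ → Pair
  readPair (i , j) k r = read i k r , read j k r

  readPair-correct : ∀ x k r → r < b ^ k → Step x (readPair x k r) k r
  readPair-correct (i , j) k r r< = step (read-correct i k r r<) (read-correct j k r r<)

  code : Pair → Fin (size * size)
  code (i , j) = combine i j

  code-injective : ∀ x y → code x ≡ code y → x ≡ y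
  code-injective (i , j) (i′ , j′) e with refl , refl ← combine-injective i j i′ j′ e = refl

  <-append : ∀ k k′ {r r′} → r < b ^ k → r′ < b ^ k′ → r + b ^ k * r′ < b ^ (k + k′)
  <-append k k′ {r} {r′} r< r′< = begin-strict
    r + b ^ k * r′         <⟨ +-monoˡ-< (b ^ k * r′) r< ⟩
    b ^ k + b ^ k * r′     ≡⟨ sym (*-suc (b ^ k) r′) ⟩
    b ^ k * suc r′         ≤⟨ *-monoʳ-≤ (b ^ k) r′< ⟩
    b ^ k * b ^ k′         ≡⟨ sym (^-distribˡ-+-* b k k′) ⟩
    b ^ (k + k′)           ∎
    where open ≤-Reasoning

  -- The two loops have equal length and values that differ by d; C will be one number divisible by
  -- all such d.
  Branching : Pair → ℕ → Set ℓ
  Branching y C = ∃ λ L → ∃₂ λ a d → d ∣ C × Step y y L a × Step y y L (a + d)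

  opaque
    -- There are more words of length `size * size` than pairs of states, so two of them lead to the
    -- same pair.
    diamond : ∀ x → Σ Pair λ y → ∃ λ k → ∃₂ λ r d → 1 ≤ d × r < b ^ k × Step x y k r × Step x y k (r + d)
    diamond x with r , r′ , r<r′ , r′< , e ← pigeonhole-ℕ (n<b^n (size * size) 2≤b) (λ r → code (readPair x (size * size) r))
      with d , refl ← m≤n⇒∃[o]m+o≡n r<r′
      = readPair x k r , k , r , suc d , s≤s z≤n , <-trans r<r′ r′< , readPair-correct x k r (<-trans r<r′ r′<) ,
        subst₂ (λ y v → Step x y k v) (sym (code-injective _ _ e)) (sym (+-suc r d)) (readPair-correct x k (suc r + d) r′<)
      where
      k : ℕ
      k = size * size

  next : Pair → Pair
  next x = proj₁ (diamond x)

  orbit : Pair → ℕ → Pair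
  orbit x zero    = x
  orbit x (suc k) = next (orbit x k)

  orbit-path : ∀ x i m → ∃₂ λ K r → r < b ^ K × Step (orbit x i) (orbit x (m + i)) K r
  orbit-path x i zero    = 0 , 0 , s≤s z≤n , Step-refl
  orbit-path x i (suc m) with K , r , r< , s ← orbit-path x i m
    with k , r′ , _ , _ , r′< , s′ , _ ← proj₂ (diamond (orbit x (m + i))) =
    K + k , r + b ^ K * r′ , <-append K k r< r′< , Step-trans s s′

  opaque
    -- The path through successive diamonds revisits a pair y. Either branch of the diamond at y,
    -- followed by the rest of the cycle, is a return word.
    reach-branching : ∀ x → Σ Pair λ y → ∃ λ C → ∃₂ λ k r → 1 ≤ C × r < b ^ k × Step x y k r × Branching y C
    reach-branching x with i , j , i<j , _ , e ← pigeonhole-ℕ (n<1+n (size * size)) (λ k → code (orbit x k))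
      with m , refl ← m≤n⇒∃[o]m+o≡n i<j
      with k , r , r< , s ← orbit-path x 0 i
      with K , r′ , _ , s′ ← orbit-path x (suc i) m
      with L , a , d , 1≤d , _ , s₁ , s₂ ← proj₂ (diamond (orbit x i))
      = y , d , k , r , 1≤d , r< , subst (λ z → Step x (orbit x z) k r) (+-identityʳ i) s ,
        L + K , a + b ^ L * r′ , d , ∣-refl , Step-trans s₁ s″ ,
        subst (Step y y (L + K)) (lem a d (b ^ L * r′)) (Step-trans s₂ s″)
      where
      y : Pair
      y = orbit x i
      lem : ∀ a d z → a + d + z ≡ a + z + d
      lem = solve-∀
      s″ : Step (orbit x (suc i)) y K r′
      s″ = subst (λ z → Step (orbit x (suc i)) z K r′)
             (trans (cong (orbit x) (+-comm m (suc i))) (code-injective _ _ (sym e))) s′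

  -- Only the low digits of the word have to reach the branching pair, so the property survives
  -- appending digits.
  record Passes (x : Pair) (l w C : ℕ) : Set ℓ where
    constructor passes
    field
      {mid}       : Pair
      {k r k′ r′} : ℕ
      to-mid      : Step x mid k r
      branching   : Branching mid C
      length-eq   : l ≡ k + k′
      value-eq    : w ≡ r + b ^ k * r′

  Passes-extend : ∀ {x l w C} l′ w′ C′ → Passes x l w C → Passes x (l + l′) (w + b ^ l * w′) (C * C′)
  Passes-extend l′ w′ C′ (passes {k = k} {r = r} {k′ = k′} {r′ = r′} s (L , a , d , d∣C , s₁ , s₂) refl refl) =
    passes {k′ = k′ + l′} {r′ = r′ + b ^ k′ * w′} s (L , a , d , ∣m⇒∣m*n C′ d∣C , s₁ , s₂) (+-assoc k k′ l′)
      (trans (cong (λ z → r + b ^ k * r′ + z * w′) (^-distribˡ-+-* b k k′)) (lem r (b ^ k) r′ (b ^ k′) w′))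
    where
    lem : ∀ r B r′ B′ w → r + B * r′ + B * B′ * w ≡ r + B * (r′ + B′ * w)
    lem = solve-∀

  opaque
    -- The pairs are served in turn: after the word found so far, digits are appended that lead the
    -- image of the next pair to a branching one.
    common-word : (xs : List Pair) → ∃ λ l → ∃₂ λ w C → w < b ^ l × 1 ≤ C × All (λ x → Passes x l w C) xs
    common-word [] = 0 , 0 , 1 , s≤s z≤n , s≤s z≤n , []
    common-word (x ∷ xs) with l , w , C , w< , 1≤C , all ← common-word xs
      with y , C′ , k , r , 1≤C′ , r< , s , L , a , d , d∣C′ , s₁ , s₂ ← reach-branching (readPair x l w)
      = l + k , w + b ^ l * r , C * C′ , <-append l k w< r< , *-mono-≤ 1≤C 1≤C′ ,
        passes {k′ = 0} {r′ = 0} (Step-trans (readPair-correct x l w w<) s) (L , a , d , ∣n⇒∣m*n C d∣C′ , s₁ , s₂)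
          (sym (+-identityʳ (l + k))) (sym (trans (cong (w + b ^ l * r +_) (*-zeroʳ (b ^ (l + k)))) (+-identityʳ _))) ∷
        All.map (Passes-extend k r C′) all

    universal-word : ∃ λ l → ∃₂ λ w C → 1 ≤ w × w < b ^ l × 1 ≤ C × (∀ x → Passes x l w C)
    universal-word with l , w , C , w< , 1≤C , all ← common-word (cartesianProduct (allFin size) (allFin size))
      -- The appended digit 1 makes the value of the word positive.
      = l + 1 , w + b ^ l * 1 , C * 1 , ≤-trans (subst (1 ≤_) (sym (*-identityʳ _)) (1≤b^ l 1≤b)) (m≤n+m _ w) ,
        <-append l 1 w< (subst (1 <_) (sym (*-identityʳ b)) 2≤b) ,
        subst (1 ≤_) (sym (*-identityʳ C)) 1≤C ,
        λ (i , j) → Passes-extend 1 1 1 (All.lookup all (∈-cartesianProduct⁺ (∈-allFin i) (∈-allFin j)))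

  -- As `b ^ K` ≡ 1, concatenation adds the values modulo M.
  repeat-loop : ∀ {y K v M} → Step y y K v → b ^ K ≡ 1 [mod M ] → ∀ t →
    ∃₂ λ K′ v′ → Step y y K′ v′ × b ^ K′ ≡ 1 [mod M ] × v′ ≡ t * v [mod M ]
  repeat-loop s one zero = 0 , 0 , Step-refl , cg-refl , cg-refl
  repeat-loop {K = K} {v = v} s one (suc t) with K′ , v′ , s′ , one′ , c ← repeat-loop s one t
    = K + K′ , v + b ^ K * v′ , Step-trans s s′ ,
      cg-trans (cg-≡ (^-distribˡ-+-* b K K′)) (cg-* one one′) ,
      cg-+ cg-refl (cg-trans (cg-* one c) (cg-≡ (*-identityˡ _)))

  copies : ∀ {y L a} → Step y y L a → ∀ t → ∃ λ v → Step y y (L * t) v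
  copies {y} {L} s zero = 0 , subst (λ z → Step y y z 0) (sym (*-zeroʳ L)) Step-refl
  copies {y} {L} {a} s (suc t) with v , s′ ← copies s t =
    a + b ^ L * v , subst (λ z → Step y y z (a + b ^ L * v)) (sym (*-suc L t)) (Step-trans s s′)

  -- X copies of the loop of value α + d and (M - 1) X copies of the loop of value α
  -- add up to X d modulo M.
  return-words : ∀ {y C} M → 1 ≤ M → Coprime M b → Coprime M C → Branching y C → ∀ τ →
    ∃₂ λ K v → Step y y K v × b ^ K ≡ 1 [mod M ] × v ≡ τ [mod M ]
  return-words {y} M@(suc M-1) 1≤M M⊥b M⊥C (L , a , d , d∣C , s₁ , s₂) τ =
    with-order (order (b ^ L) M 1≤M (coprime-^ʳ L M⊥b)) (linear-congruence d M 1≤M (coprime-∣ʳ d∣C M⊥C) 0 τ)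
    where
    lem : ∀ X a d z M-1 → X * (a + d + z) + M-1 * X * (a + z) ≡ d * X + suc M-1 * (X * (a + z))
    lem = solve-∀
    Loop : ℕ → Set ℓ
    Loop τ = ∃₂ λ K v → Step y y K v × b ^ K ≡ 1 [mod M ] × v ≡ τ [mod M ]
    -- N further copies of the plain loop bring both lengths to `L * suc N`, where the power of b is
    -- ≡ 1; the values still differ by d.
    with-order : (∃ λ N → 1 ≤ N × (b ^ L) ^ N ≡ 1 [mod M ]) → (∃ λ X → X < M × d * X ≡ τ [mod M ]) → Loop τ
    with-order (suc N , _ , one) (X , _ , solved) = with-copies (copies s₁ N)
      where
      one′ : b ^ (L + L * N) ≡ 1 [mod M ]
      one′ = cg-trans (cg-≡ (trans (cong (b ^_) (sym (*-suc L N))) (sym (^-*-assoc b L (suc N))))) one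
      with-copies : (∃ λ v → Step y y (L * N) v) → Loop τ
      with-copies (v₀ , s₀) = join (repeat-loop (Step-trans s₂ s₀) one′ X) (repeat-loop (Step-trans s₁ s₀) one′ (M-1 * X))
        where
        join : Loop (X * (a + d + b ^ L * v₀)) → Loop (M-1 * X * (a + b ^ L * v₀)) → Loop τ
        join (K₁ , v₁ , t₁ , one₁ , c₁) (K₂ , v₂ , t₂ , one₂ , c₂) = K₁ + K₂ , v₁ + b ^ K₁ * v₂ , Step-trans t₁ t₂ ,
          cg-trans (cg-≡ (^-distribˡ-+-* b K₁ K₂)) (cg-* one₁ one₂) ,
          cg-trans (cg-+ c₁ (cg-trans (cg-* one₁ c₂) (cg-≡ (*-identityˡ _))))
            (cg-trans (cg-≡ (lem X a d (b ^ L * v₀) M-1)) (cg-trans (cg-+multiple (d * X) _) solved))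

  module _ {l w C : ℕ} (pass : ∀ x → Passes x l w C) where

    -- The word leads (i , j) to a branching pair. A return word inserted there changes neither
    -- sequence but moves the argument into the class of n₀, where the two agree; hence the states
    -- of that pair agree everywhere.
    progression⇒all : ∀ M n₀ → 1 ≤ M → Coprime M b → Coprime M C → ∀ i j →
      (∀ n → n ≡ n₀ [mod M ] → G i n ≈ G j n) → ∀ n → G i (w + b ^ l * n) ≈ G j (w + b ^ l * n)
    progression⇒all M n₀ 1≤M M⊥b M⊥C i j agree n
      with passes {mid = y₁ , y₂} {k = k} {r = r} {k′ = k′} {r′ = r′} (step left right) br refl refl ← pass (i , j) =
      ≈-trans (≈-reflexive (cong (G i) eq)) (≈-trans (left _) (≈-trans (equal _)
        (≈-trans (≈-sym (right _)) (≈-reflexive (cong (G j) (sym eq))))))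
      where
      lem : ∀ r B r′ B′ n → r + B * r′ + B * B′ * n ≡ r + B * (r′ + B′ * n)
      lem = solve-∀
      eq : r + b ^ k * r′ + b ^ (k + k′) * n ≡ r + b ^ k * (r′ + b ^ k′ * n)
      eq = trans (cong (λ z → r + b ^ k * r′ + z * n) (^-distribˡ-+-* b k k′)) (lem r (b ^ k) r′ (b ^ k′) n)
      lem₂ : ∀ r B x n → r + B * n + B * x ≡ r + B * (x + n)
      lem₂ = solve-∀
      equal : ∀ n → G y₁ n ≈ G y₂ n
      -- τ is the value the return word must have for the whole argument to become ≡ n₀; `b ^ K` ≡ 1
      -- leaves the contribution of n in place.
      equal n with τ , _ , solved ← linear-congruence (b ^ k) M 1≤M (coprime-^ʳ k M⊥b) (r + b ^ k * n) n₀
        with K , v , step l₁ l₂ , one , c ← return-words M 1≤M M⊥b M⊥C br τ =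
        ≈-trans (≈-sym (l₁ n)) (≈-trans (≈-sym (left _)) (≈-trans (agree _ hit) (≈-trans (right _) (l₂ n))))
        where
        hit : r + b ^ k * (v + b ^ K * n) ≡ n₀ [mod M ]
        hit = cg-trans (cg-+ cg-refl (cg-*ˡ (b ^ k) (cg-+ c (cg-trans (cg-* one cg-refl) (cg-≡ (*-identityˡ n))))))
                (cg-trans (cg-≡ (sym (lem₂ r (b ^ k) τ n))) solved)

-- Periodicity on cells

cg-*-cancel-modulus : ∀ {a b M} k → 1 ≤ k → k * a ≡ k * b [mod k * M ] → a ≡ b [mod M ]
cg-*-cancel-modulus {a} {b} {M} k@(suc _) _ (shifts x y e) = shifts x y
  (*-cancelˡ-≡ (a + x * M) (b + y * M) k (trans (sym (lem k a x M)) (trans e (lem k b y M))))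
  where
  lem : ∀ k a x M → k * a + x * (k * M) ≡ k * (a + x * M)
  lem = solve-∀

opaque
  cg-crt : ∀ {a b m n} → Coprime m n → a ≡ b [mod m ] → a ≡ b [mod n ] → a ≡ b [mod m * n ]
  cg-crt {a} {b} {m} {n} c p q with ≤-total a b
  ... | inj₁ a≤b = cg-sym (combine-≤ a≤b (cg-sym p) (cg-sym q))
    where
    combine-≤ : ∀ {a b} → a ≤ b → b ≡ a [mod m ] → b ≡ a [mod n ] → b ≡ a [mod m * n ]
    combine-≤ {a} a≤b p q with z , refl ← cg-split p a≤b
      with divides y refl ← coprime-divisor {o = z} (Cop.sym c) (cg-0⇒∣ (cg-+-cancelˡ a (cg-trans q (cg-≡ (sym (+-identityʳ a))))))
      = cg-trans (cg-≡ (cong (a +_) (lem m y n))) (cg-+multiple a y)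
      where
      lem : ∀ m y n → m * (y * n) ≡ m * n * y
      lem = solve-∀
  ... | inj₂ b≤a with z , refl ← cg-split p b≤a
      with divides y refl ← coprime-divisor {o = z} (Cop.sym c) (cg-0⇒∣ (cg-+-cancelˡ b (cg-trans q (cg-≡ (sym (+-identityʳ b))))))
      = cg-trans (cg-≡ (cong (b +_) (lem m y n))) (cg-+multiple b y)
      where
      lem : ∀ m y n → m * (y * n) ≡ m * n * y
      lem = solve-∀

prime-power-∣ : ∀ {p k x R} → Prime p → ¬ p ∣ R → p ^ k ∣ p ^ x * R → k ≤ x
prime-power-∣ {k = zero} pp p∤R d = z≤n
prime-power-∣ {p} {suc k} {zero} {R} pp p∤R d =
  ⊥-elim (p∤R (∣-trans (m∣m*n (p ^ k)) (subst (p ^ suc k ∣_) (*-identityˡ R) d)))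
prime-power-∣ {p} {suc k} {suc x} {R} pp p∤R d = s≤s (prime-power-∣ pp p∤R
  (*-cancelˡ-∣ p {{>-nonZero (≤-trans (s≤s z≤n) (prime≥2 pp))}} (subst (p * p ^ k ∣_) (*-assoc p (p ^ x) R) d)))

^-cancelʳ-< : ∀ {b k m} → 1 ≤ b → b ^ k < b ^ m → k < m
^-cancelʳ-< {b} {k} {m} 1≤b lt with k <? m
... | yes k<m = k<m
... | no k≮m = ⊥-elim (<-irrefl refl (≤-trans lt (^-monoʳ-≤ b {{>-nonZero 1≤b}} (≮⇒≥ k≮m))))

prime∤* : ∀ {p m n} → Prime p → ¬ p ∣ m → ¬ p ∣ n → ¬ p ∣ m * n
prime∤* {p} {m} {n} pp p∤m p∤n d with euclidsLemma m n pp d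
... | inj₁ x = p∤m x
... | inj₂ y = p∤n y

opaque
  -- `Q = 1 + R * y` is 1 modulo R, where r and Λ agree already, and y is solved for modulo the
  -- power of p. As `Q * r ≡ Λ` is prime to p, so is Q.
  multiplier : ∀ {p} x R r Λ → Prime p → ¬ p ∣ R → ¬ p ∣ r → ¬ p ∣ Λ → 1 ≤ x → r ≡ Λ [mod R ] →
    ∃ λ Q → 1 ≤ Q × Q ≤ 1 + p ^ x * R × Coprime Q (p ^ x * R) × Q * r ≡ Λ [mod p ^ x * R ]
  multiplier {p} (suc x′) R r Λ pp p∤R p∤r p∤Λ 1≤x r≡Λ
    with y , y< , solved ← linear-congruence (R * r) (p ^ suc x′) (1≤b^ (suc x′) (≤-trans (s≤s z≤n) (prime≥2 pp)))
      (Cop.sym (coprime-^ʳ (suc x′) (Cop.sym (prime∤⇒coprime pp (prime∤* pp p∤R p∤r))))) r Λ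
    = 1 + R * y , s≤s z≤n ,
      s≤s (≤-trans (*-monoʳ-≤ R (<⇒≤ y<)) (≤-reflexive (*-comm R (p ^ x)))) ,
      coprime-*ʳ (coprime-^ʳ x (Cop.sym (prime∤⇒coprime pp p∤Q))) (Cop.sym (cg-1⇒coprime Q≡1)) ,
      cg-crt (Cop.sym (coprime-^ʳ x (Cop.sym (prime∤⇒coprime pp p∤R)))) Qr≡Λ
        (cg-trans (cg-* Q≡1 cg-refl) (cg-trans (cg-≡ (*-identityˡ _)) r≡Λ))
    where
    x : ℕ
    x = suc x′
    Q≡1 : 1 + R * y ≡ 1 [mod R ]
    Q≡1 = cg-+multiple 1 y
    lem : ∀ r R y → (1 + R * y) * r ≡ r + R * r * y
    lem = solve-∀
    Qr≡Λ : (1 + R * y) * r ≡ Λ [mod p ^ x ]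
    Qr≡Λ = cg-trans (cg-≡ (lem r R y)) solved
    p∤Q : ¬ p ∣ 1 + R * y
    p∤Q p∣Q = p∤Λ (cg-∣ (m∣m*n (p ^ x′)) Qr≡Λ (∣m⇒∣m*n r p∣Q))

module _ {a ℓ} (CM : CommutativeMonoid a ℓ) (u : ℕ → CommutativeMonoid.Carrier CM) where
  open CommutativeMonoid CM

  CoprimeMultiplicative : Set ℓ
  CoprimeMultiplicative = ∀ m n → 1 ≤ m → 1 ≤ n → Coprime m n → u (m * n) ≈ u m ∙ u n

  -- The cell with parameters m, n consists of the numbers bᵐ (w + bˡ n) + Λ with Λ < bᵐ.
  CellShift : (b p l w H c : ℕ) → Set ℓ
  CellShift b p l w H c = ∀ m Λ n → c ≤ Λ → Λ + H < b ^ m → ¬ p ∣ Λ →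
    u (Λ + b ^ m * (w + b ^ l * n)) ≈ u (Λ + H + b ^ m * (w + b ^ l * n))

  -- Being a multiple of v passes to every product with a further factor; once v is idempotent, it
  -- means that v acts on `u n` as an identity.
  AbsorbedBy : Carrier → ℕ → Set (a ⊔ ℓ)
  AbsorbedBy v n = ∃ λ κ → u n ≈ κ ∙ v

  -- `Q ≡ 1` modulo R makes Q prime to any number that was built into R.
  GenericAbsorbed : ℕ → Carrier → Set (a ⊔ ℓ)
  GenericAbsorbed b v = ∀ R → 1 ≤ R → b ∣ R → ∃ λ Q → 1 ≤ Q × Q ≡ 1 [mod R ] × AbsorbedBy v Q

module Cells {a ℓ} (CM : CommutativeMonoid a ℓ)
  {b : ℕ} {u : ℕ → CommutativeMonoid.Carrier CM} (2≤b : 2 ≤ b) (machine : Machine (CommutativeMonoid._≈_ CM) b u)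
  (mult : CoprimeMultiplicative CM u)
  {l w C : ℕ} (1≤C : 1 ≤ C) (pass : ∀ x → Digits.Passes (CommutativeMonoid.isEquivalence CM) 2≤b machine x l w C)
  {p : ℕ} (pp : Prime p) (p∣b : p ∣ b) where

  open CommutativeMonoid CM renaming (refl to ≈-refl; sym to ≈-sym; trans to ≈-trans; reflexive to ≈-reflexive)
  open Digits isEquivalence 2≤b machine
  open Machine machine

  -- If u(r + bᵏx) = u(r + h + bᵏx) for all x, then multiplying by Q gives the same relation
  -- between the multiples of Q, on a progression modulo Q²; that suffices for arguments
  -- containing the universal word.
  scaled-shift : ∀ k m′ Q r h η → (∀ x → u (r + b ^ k * x) ≈ u (r + h + b ^ k * x)) →
    1 ≤ r → 1 ≤ Q → Coprime Q b → Coprime Q C → Coprime Q h → Coprime Q 2 →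
    Q * (r + h) + b ^ k * η < b ^ (k + m′) → ∀ n →
    u (Q * r + b ^ k * η + b ^ (k + m′) * (w + b ^ l * n)) ≈ u (Q * (r + h) + b ^ k * η + b ^ (k + m′) * (w + b ^ l * n))
  scaled-shift k m′ Q r h η same 1≤r 1≤Q Q⊥b Q⊥C Q⊥h Q⊥2 fits n
    -- x₀ makes both cofactors prime to Q: they become ≡ h and ≡ 2 h modulo Q. The class of n₀
    -- modulo `Q * Q` makes `η + b ^ m′ * Z` a multiple of Q with quotient ≡ x₀.
    with x₀ , _ , x₀-eq ← linear-congruence (b ^ k) Q 1≤Q (coprime-^ʳ k Q⊥b) r h
    with n₀ , _ , n₀-eq ← linear-congruence (b ^ m′) (Q * Q) (*-mono-≤ 1≤Q 1≤Q) (coprime-^ʳ m′ (Cop.sym (coprime-*ʳ (Cop.sym Q⊥b) (Cop.sym Q⊥b)))) η (Q * x₀)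
    = ≈-trans (start-correct (k + m′) A A< _) (≈-trans
        (progression⇒all pass (Q * Q) n₀ (*-mono-≤ 1≤Q 1≤Q) (Cop.sym (coprime-*ʳ (Cop.sym Q⊥b) (Cop.sym Q⊥b)))
          (Cop.sym (coprime-*ʳ (Cop.sym Q⊥C) (Cop.sym Q⊥C))) _ _ agree n)
        (≈-sym (start-correct (k + m′) A′ fits _)))
    where
    A A′ : ℕ
    A = Q * r + b ^ k * η
    A′ = Q * (r + h) + b ^ k * η
    A< : A < b ^ (k + m′)
    A< = ≤-trans (s≤s (+-monoˡ-≤ (b ^ k * η) (*-monoʳ-≤ Q (m≤m+n r h)))) fits
    factor : ∀ r x Z → η + b ^ m′ * Z ≡ x * Q → Q * r + b ^ k * η + b ^ (k + m′) * Z ≡ Q * (r + b ^ k * x)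
    factor r x Z e = begin
      Q * r + b ^ k * η + b ^ (k + m′) * Z      ≡⟨ cong (Q * r + b ^ k * η +_) (^-+-* k m′ Z) ⟩
      Q * r + b ^ k * η + b ^ k * (b ^ m′ * Z)  ≡⟨ lem (Q * r) (b ^ k) η (b ^ m′ * Z) ⟩
      Q * r + b ^ k * (η + b ^ m′ * Z)          ≡⟨ cong (λ z → Q * r + b ^ k * z) e ⟩
      Q * r + b ^ k * (x * Q)                   ≡⟨ lem₂ Q r (b ^ k) x ⟩
      Q * (r + b ^ k * x)                       ∎
      where
      open ≡-Reasoning
      lem : ∀ a B η z → a + B * η + B * z ≡ a + B * (η + z)
      lem = solve-∀
      lem₂ : ∀ Q r B x → Q * r + B * (x * Q) ≡ Q * (r + B * x)
      lem₂ = solve-∀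
    agree : ∀ Z → Z ≡ n₀ [mod Q * Q ] → G (read start (k + m′) A) Z ≈ G (read start (k + m′) A′) Z
    agree Z Z≡n₀ with here ← cg-trans (cg-+ (cg-refl {η}) (cg-*ˡ (b ^ m′) Z≡n₀)) n₀-eq
      with divides x e ← cg-∣ {d = Q} (m∣m*n Q) (cg-sym here) (m∣m*n x₀)
      = ≈-trans (≈-sym (start-correct (k + m′) A A< Z)) (≈-trans (≈-reflexive (cong u (factor r x Z e)))
          (≈-trans (mult Q (r + b ^ k * x) 1≤Q (≤-trans 1≤r (m≤m+n r _)) Q⊥₁)
          (≈-trans (∙-congˡ (same x))
          (≈-trans (≈-sym (mult Q (r + h + b ^ k * x) 1≤Q (≤-trans 1≤r (≤-trans (m≤m+n r h) (m≤m+n (r + h) _))) Q⊥₂))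
          (≈-trans (≈-reflexive (cong u (sym (factor (r + h) x Z e)))) (start-correct (k + m′) A′ fits Z))))))
      where
      x≡x₀ : x ≡ x₀ [mod Q ]
      x≡x₀ = cg-*-cancel-modulus Q 1≤Q (cg-trans (cg-≡ (trans (*-comm Q x) (sym e))) here)
      r-cg : r + b ^ k * x ≡ h [mod Q ]
      r-cg = cg-trans (cg-+ cg-refl (cg-*ˡ (b ^ k) x≡x₀)) x₀-eq
      Q⊥₁ : Coprime Q (r + b ^ k * x)
      Q⊥₁ = cg-coprime (cg-sym r-cg) Q⊥h
      lem : ∀ r h z → r + h + z ≡ r + z + h
      lem = solve-∀
      lem₂ : ∀ h → h + h ≡ 2 * h
      lem₂ = solve-∀
      Q⊥₂ : Coprime Q (r + h + b ^ k * x)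
      Q⊥₂ = cg-coprime (cg-sym (cg-trans (cg-≡ (lem r h (b ^ k * x))) (cg-trans (cg-+ r-cg cg-refl) (cg-≡ (lem₂ h)))))
              (coprime-*ʳ Q⊥2 Q⊥h)

  -- Both sides equal u at the common point Q r + R (f r + ζ) = (Q + R f) r + R ζ, R = bᵏ C₀.
  double-shift : ∀ k C₀ r h → (∀ x → u (r + b ^ k * x) ≈ u (r + h + b ^ k * x)) → 1 ≤ r →
    (∀ {Q} → Coprime Q (b ^ k * C₀) → Coprime Q b × Coprime Q C × Coprime Q h × Coprime Q 2) →
    ∀ Q f Λ m n → 1 ≤ Q → Coprime Q (b ^ k * C₀) →
    Q * (r + h) + b ^ k * C₀ * (f * r) ≤ Λ → Q * (r + h) ≡ Λ [mod b ^ k * C₀ ] → k ≤ m → Λ + b ^ k * C₀ * (f * h) < b ^ m →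
    u (Λ + b ^ m * (w + b ^ l * n)) ≈ u (Λ + b ^ k * C₀ * (f * h) + b ^ m * (w + b ^ l * n))
  double-shift k C₀ r h same 1≤r split Q f Λ m n 1≤Q Q⊥ bound Qr≡Λ k≤m fits
    with m′ , refl ← m≤n⇒∃[o]m+o≡n k≤m
    with ζ , Λ-eq ← cg-split (cg-trans (cg-sym Qr≡Λ) (cg-sym (cg-+multiple (Q * (r + h)) (f * r)))) bound
    = ≈-trans (at eq₁) (≈-trans (≈-sym (apply Q (C₀ * (f * r + ζ)) 1≤Q Q⊥ (subst (_< b ^ (k + m′)) eq₁ (≤-trans (s≤s (m≤m+n Λ _)) fits))))
        (≈-trans (at eq₂) (≈-trans (apply Q′ (C₀ * ζ) (≤-trans 1≤Q (m≤m+n Q _)) Q′⊥ (subst (_< b ^ (k + m′)) eq₃ fits)) (≈-sym (at eq₃)))))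
    where
    Q′ : ℕ
    Q′ = Q + b ^ k * C₀ * f
    Q′⊥ : Coprime Q′ (b ^ k * C₀)
    Q′⊥ = Cop.sym (cg-coprime (cg-sym (cg-+multiple Q f)) (Cop.sym Q⊥))
    apply : ∀ Q η → 1 ≤ Q → Coprime Q (b ^ k * C₀) → Q * (r + h) + b ^ k * η < b ^ (k + m′) →
      u (Q * r + b ^ k * η + b ^ (k + m′) * (w + b ^ l * n)) ≈ u (Q * (r + h) + b ^ k * η + b ^ (k + m′) * (w + b ^ l * n))
    apply Q η 1≤Q c fits = let c₁ , c₂ , c₃ , c₄ = split c in
      scaled-shift k m′ Q r h η same 1≤r 1≤Q c₁ c₂ c₃ c₄ fits n
    at : ∀ {z z′} → z ≡ z′ → u (z + b ^ (k + m′) * (w + b ^ l * n)) ≈ u (z′ + b ^ (k + m′) * (w + b ^ l * n))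
    at e = ≈-reflexive (cong (λ z → u (z + b ^ (k + m′) * (w + b ^ l * n))) e)
    lem₁ : ∀ q B C f r z → q + B * C * (f * r) + B * C * z ≡ q + B * (C * (f * r + z))
    lem₁ = solve-∀
    eq₁ : Λ ≡ Q * (r + h) + b ^ k * (C₀ * (f * r + ζ))
    eq₁ = trans Λ-eq (lem₁ (Q * (r + h)) (b ^ k) C₀ f r ζ)
    lem₂ : ∀ Q r B C f z → Q * r + B * (C * (f * r + z)) ≡ (Q + B * C * f) * r + B * (C * z)
    lem₂ = solve-∀
    eq₂ : Q * r + b ^ k * (C₀ * (f * r + ζ)) ≡ Q′ * r + b ^ k * (C₀ * ζ)
    eq₂ = lem₂ Q r (b ^ k) C₀ f ζ
    lem₃ : ∀ Q r h B C f z → Q * (r + h) + B * C * (f * r) + B * C * z + B * C * (f * h)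
      ≡ (Q + B * C * f) * (r + h) + B * (C * z)
    lem₃ = solve-∀
    eq₃ : Λ + b ^ k * C₀ * (f * h) ≡ Q′ * (r + h) + b ^ k * (C₀ * ζ)
    eq₃ = trans (cong (_+ b ^ k * C₀ * (f * h)) Λ-eq) (lem₃ Q r h (b ^ k) C₀ f ζ)

  module _ (k C₀ x R : ℕ) (1≤k : 1 ≤ k) (R₀-eq : b ^ k * C₀ ≡ p ^ x * R) (p∤R : ¬ p ∣ R) (1≤x : 1 ≤ x)
    (C∣C₀ : C ∣ C₀) (2∣C₀ : 2 ∣ C₀) (!∣C₀ : size ! ∣ C₀) (1≤R : 1 ≤ R) (small : suc size * (p * R) ≤ b ^ k) where

    -- `size ! * (p * R)` is a multiple of each distance h between two of `suc size` candidates, so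
    -- one shift serves whichever pair the pigeonhole principle returns.
    shift-size : ℕ
    shift-size = b ^ k * C₀ * (size ! * (p * R))

    -- Covers `Q * (r + h)` and `b ^ k * C₀ * (f * r)` for all `Q ≤ 1 + b ^ k * C₀`, `f ≤ size !`
    -- and `r + h < b ^ k`.
    shift-bound : ℕ
    shift-bound = (1 + b ^ k * C₀) * b ^ k + b ^ k * C₀ * (size ! * b ^ k)

    private
      -- Numbers congruent to Λ modulo D agree with Λ modulo R and are prime to p together with it,
      -- as `multiplier` requires.
      D : ℕ
      D = p * R

      instance
        D≢0 : NonZero D
        D≢0 = >-nonZero (*-mono-≤ (≤-trans (s≤s z≤n) (prime≥2 pp)) 1≤R)

      h-coprime : ∀ {e} → suc e ≤ size → ∀ {Q} → Coprime Q (b ^ k * C₀) →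
        Coprime Q b × Coprime Q C × Coprime Q (suc e * D) × Coprime Q 2
      h-coprime e≤s {Q} c = coprime-∣ʳ (∣m⇒∣m*n C₀ (base∣power b 1≤k)) c , coprime-∣ʳ (∣n⇒∣m*n (b ^ k) C∣C₀) c ,
        coprime-*ʳ (coprime-∣ʳ (∣-trans (∣! (s≤s z≤n) e≤s) (∣n⇒∣m*n (b ^ k) !∣C₀)) c)
          (coprime-*ʳ (coprime-∣ʳ (∣m⇒∣m*n R (base∣power p 1≤x)) c′) (coprime-∣ʳ (n∣m*n (p ^ x)) c′)) ,
        coprime-∣ʳ (∣n⇒∣m*n (b ^ k) 2∣C₀) c
        where
        c′ : Coprime Q (p ^ x * R)
        c′ = subst (Coprime Q) R₀-eq c

    -- Two of the numbers `Λ % D + i * D` with `i ≤ size` lead to the same state after k digits,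
    -- which relates some r and r + h. A multiplier Q then carries r + h to Λ modulo `b ^ k * C₀`.
    shift-in-cell-at : ∀ m Λ n → shift-bound ≤ Λ → Λ + shift-size < b ^ m → ¬ p ∣ Λ →
      u (Λ + b ^ m * (w + b ^ l * n)) ≈ u (Λ + shift-size + b ^ m * (w + b ^ l * n))
    shift-in-cell-at m Λ n c≤Λ fits p∤Λ
      with i , j , i<j , j≤s , same-state ← pigeonhole-ℕ (n<1+n size) (λ i → read start k (Λ % D + i * D))
      with e , refl ← m≤n⇒∃[o]m+o≡n i<j
      with divides f f-eq ← ∣! {suc e} (s≤s z≤n) (≤-trans (s≤s (m≤n+m e i)) (s≤s⁻¹ j≤s))
      = finish (multiplier x R (r + h) Λ pp p∤R p∤r′ p∤Λ 1≤x (cg-weaken (n∣m*n p) r′≡Λ))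
      where
      r h : ℕ
      r = Λ % D + i * D
      h = suc e * D
      r′-eq : Λ % D + (suc i + e) * D ≡ r + h
      r′-eq = lem (Λ % D) i e D
        where
        lem : ∀ z i e D → z + (suc i + e) * D ≡ z + i * D + suc e * D
        lem = solve-∀
      r′< : r + h < b ^ k
      r′< = subst (_< b ^ k) r′-eq (≤-trans (+-monoˡ-< ((suc i + e) * D) (m%n<n Λ D)) (≤-trans (*-monoˡ-≤ D j≤s) small))
      same : ∀ x → u (r + b ^ k * x) ≈ u (r + h + b ^ k * x)
      same x = ≈-trans (start-correct k r (≤-trans (s≤s (m≤m+n r h)) r′<) x)
        (≈-trans (≈-reflexive (cong (λ q → G q x) (trans same-state (cong (read start k) r′-eq))))
          (≈-sym (start-correct k (r + h) r′< x)))
      residue : ∀ i → Λ % D + i * D ≡ Λ [mod D ]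
      residue i = cg-trans (cg-trans (cg-≡ (cong (Λ % D +_) (*-comm i D))) (cg-+multiple (Λ % D) i)) (cg-sym (cg-% Λ D))
      r′≡Λ : r + h ≡ Λ [mod D ]
      r′≡Λ = cg-trans (cg-≡ (sym r′-eq)) (residue (suc i + e))
      p∤r : ¬ p ∣ r
      p∤r p∣r = p∤Λ (cg-∣ (m∣m*n R) (residue i) p∣r)
      p∤r′ : ¬ p ∣ r + h
      p∤r′ p∣r′ = p∤Λ (cg-∣ (m∣m*n R) r′≡Λ p∣r′)
      1≤r : 1 ≤ r
      1≤r = n≢0⇒n>0 (λ r≡0 → p∤r (subst (p ∣_) (sym r≡0) (p ∣0)))
      k≤m : k ≤ m
      k≤m = <⇒≤ (^-cancelʳ-< 1≤b (≤-trans (s≤s (≤-trans (≤-trans (≤-trans (≤-reflexive (sym (+-identityʳ (b ^ k))))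
        (*-monoˡ-≤ (b ^ k) (s≤s (z≤n {b ^ k * C₀})))) (m≤m+n _ _)) (≤-trans c≤Λ (m≤m+n Λ shift-size)))) fits))
      f≤ : f ≤ size !
      f≤ = subst (f ≤_) (sym f-eq) (m≤m*n f (suc e))
      fh-eq : f * h ≡ size ! * D
      fh-eq = trans (sym (*-assoc f (suc e) D)) (cong (_* D) (sym f-eq))
      finish : (∃ λ Q → 1 ≤ Q × Q ≤ 1 + p ^ x * R × Coprime Q (p ^ x * R) × Q * (r + h) ≡ Λ [mod p ^ x * R ]) →
        u (Λ + b ^ m * (w + b ^ l * n)) ≈ u (Λ + shift-size + b ^ m * (w + b ^ l * n))
      finish (Q , 1≤Q , Q≤ , Q⊥ , Qr) =
        subst (λ z → u (Λ + b ^ m * (w + b ^ l * n)) ≈ u (Λ + b ^ k * C₀ * z + b ^ m * (w + b ^ l * n))) fh-eq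
          (double-shift k C₀ r h same 1≤r (h-coprime (≤-trans (s≤s (m≤n+m e i)) (s≤s⁻¹ j≤s))) Q f Λ m n 1≤Q
            (subst (Coprime Q) (sym R₀-eq) Q⊥)
            (≤-trans (+-mono-≤ (*-mono-≤ (subst (λ z → Q ≤ 1 + z) (sym R₀-eq) Q≤) (<⇒≤ r′<))
              (*-monoʳ-≤ (b ^ k * C₀) (*-mono-≤ f≤ (≤-trans (m≤m+n r h) (<⇒≤ r′<))))) c≤Λ)
            (subst (λ z → Q * (r + h) ≡ Λ [mod z ]) (sym R₀-eq) Qr) k≤m
            (subst (λ z → Λ + b ^ k * C₀ * z < b ^ m) (sym fh-eq) fits))

  opaque
    shift-in-cell : ∃₂ λ H c → 1 ≤ H × 1 ≤ c × p ∣ H × CellShift CM u b p l w H c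
    -- `C₀` collects what the multipliers must be prime to besides b. Since `p ^ k` divides `b ^ k`,
    -- R is at most `b ^ k * C₀ / p ^ k`, and k is chosen so that `suc size` candidates at distance
    -- `p * R` fit below `b ^ k`.
    shift-in-cell = construct (2 * size ! * C) (suc size * p * (2 * size ! * C)) refl
      (∣n⇒∣m*n (2 * size !) ∣-refl) (∣m⇒∣m*n C (m∣m*n (size !))) (∣m⇒∣m*n C (n∣m*n 2))
      (*-mono-≤ (*-mono-≤ {1} {2} (s≤s z≤n) (1≤n! size)) 1≤C)
      where
      1≤p : 1 ≤ p
      1≤p = ≤-trans (s≤s z≤n) (prime≥2 pp)
      p^∣b^ : ∀ k → p ^ k ∣ b ^ k
      p^∣b^ zero    = ∣-refl
      p^∣b^ (suc k) = *-pres-∣ p∣b (p^∣b^ k)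
      construct : ∀ C₀ k → k ≡ suc size * p * C₀ → C ∣ C₀ → 2 ∣ C₀ → size ! ∣ C₀ → 1 ≤ C₀ →
        ∃₂ λ H c → 1 ≤ H × 1 ≤ c × p ∣ H × CellShift CM u b p l w H c
      construct C₀ k k-eq C∣ 2∣ !∣ 1≤C₀
        with x , R , R₀-eq , p∤R , 1≤R ← p-part p pp (b ^ k * C₀) (*-mono-≤ (1≤b^ k 1≤b) 1≤C₀)
        = shift-size k C₀ x R 1≤k R₀-eq p∤R 1≤x C∣ 2∣ !∣ 1≤R small ,
          shift-bound k C₀ x R 1≤k R₀-eq p∤R 1≤x C∣ 2∣ !∣ 1≤R small ,
          *-mono-≤ (*-mono-≤ (1≤b^ k 1≤b) 1≤C₀) (*-mono-≤ (1≤n! size) (*-mono-≤ 1≤p 1≤R)) ,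
          ≤-trans (*-mono-≤ (s≤s (z≤n {b ^ k * C₀})) (1≤b^ k 1≤b)) (m≤m+n _ _) ,
          ∣n⇒∣m*n (b ^ k * C₀) (∣n⇒∣m*n (size !) (m∣m*n R)) ,
          shift-in-cell-at k C₀ x R 1≤k R₀-eq p∤R 1≤x C∣ 2∣ !∣ 1≤R small
        where
        1≤k : 1 ≤ k
        1≤k = subst (1 ≤_) (sym k-eq) (*-mono-≤ (*-mono-≤ {1} {suc size} (s≤s z≤n) 1≤p) 1≤C₀)
        k≤x : k ≤ x
        k≤x = prime-power-∣ pp p∤R (subst (p ^ k ∣_) R₀-eq (∣-trans (p^∣b^ k) (m∣m*n C₀)))
        1≤x : 1 ≤ x
        1≤x = ≤-trans 1≤k k≤x
        small : suc size * (p * R) ≤ b ^ k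
        small = *-cancelʳ-≤ (suc size * (p * R)) (b ^ k) C₀ {{>-nonZero 1≤C₀}} (begin
          suc size * (p * R) * C₀  ≡⟨ lem (suc size) p R C₀ ⟩
          suc size * p * C₀ * R    ≡⟨ cong (_* R) (sym k-eq) ⟩
          k * R                    ≤⟨ *-monoˡ-≤ R (<⇒≤ (n<b^n k (prime≥2 pp))) ⟩
          p ^ k * R                ≤⟨ *-monoˡ-≤ R (^-monoʳ-≤ p {{>-nonZero 1≤p}} k≤x) ⟩
          p ^ x * R                ≡⟨ sym R₀-eq ⟩
          b ^ k * C₀               ∎)
          where
          open ≤-Reasoning
          lem : ∀ s p R C → s * (p * R) * C ≡ s * p * C * R
          lem = solve-∀

-- The idempotent v

module Values {a ℓ} (CM : CommutativeMonoid a ℓ)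
  {b : ℕ} {u : ℕ → CommutativeMonoid.Carrier CM} (2≤b : 2 ≤ b) (machine : Machine (CommutativeMonoid._≈_ CM) b u)
  (mult : CoprimeMultiplicative CM u)
  {p : ℕ} (pp : Prime p) (p∣b : p ∣ b)
  {l w H c : ℕ} (1≤w : 1 ≤ w) (w<b^l : w < b ^ l) (1≤H : 1 ≤ H) (1≤c : 1 ≤ c) (p∣H : p ∣ H)
  (shift : CellShift CM u b p l w H c)
  where

  open CommutativeMonoid CM renaming (refl to ≈-refl; sym to ≈-sym; trans to ≈-trans; reflexive to ≈-reflexive)
  open Digits isEquivalence 2≤b machine
  open Machine machine

  p∣b^ : ∀ {m} → 1 ≤ m → p ∣ b ^ m
  p∣b^ {suc m} _ = ∣m⇒∣m*n (b ^ m) p∣b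

  cell-shift : ∀ m n g Λ → c ≤ Λ → Λ + H * g < b ^ m → ¬ p ∣ Λ →
    u (Λ + b ^ m * (w + b ^ l * n)) ≈ u (Λ + H * g + b ^ m * (w + b ^ l * n))
  cell-shift m n zero    Λ c≤Λ fits p∤Λ =
    ≈-reflexive (cong (λ z → u (z + b ^ m * (w + b ^ l * n))) (sym (trans (cong (Λ +_) (*-zeroʳ H)) (+-identityʳ Λ))))
  cell-shift m n (suc g) Λ c≤Λ fits p∤Λ = ≈-trans (shift m Λ n c≤Λ (≤-trans (s≤s Λ+H≤) fits) p∤Λ)
    (≈-trans (cell-shift m n g (Λ + H) (≤-trans c≤Λ (m≤m+n Λ H)) (subst (_< b ^ m) (lem Λ H g) fits) p∤)
      (≈-reflexive (cong (λ z → u (z + b ^ m * (w + b ^ l * n))) (sym (lem Λ H g)))))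
    where
    lem : ∀ Λ H g → Λ + H * suc g ≡ Λ + H + H * g
    lem = solve-∀
    Λ+H≤ : Λ + H ≤ Λ + H * suc g
    Λ+H≤ = subst (Λ + H ≤_) (sym (lem Λ H g)) (m≤m+n (Λ + H) (H * g))
    p∤ : ¬ p ∣ Λ + H
    p∤ d = p∤Λ (∣m+n∣m⇒∣n (subst (p ∣_) (+-comm Λ H) d) p∣H)

  record InCell (B m N : ℕ) : Set where
    constructor in-cell
    field
      above : B + c ≤ N
      below : N < B + b ^ m

  private
    cell-≤ : ∀ m n {N N′} → InCell (b ^ m * (w + b ^ l * n)) m N → InCell (b ^ m * (w + b ^ l * n)) m N′ →
      N ≤ N′ → N′ ≡ N [mod H ] → ¬ p ∣ N → u N ≈ u N′
    cell-≤ m n {N} {N′} (in-cell lo hi) (in-cell lo′ hi′) N≤N′ cg p∤N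
      with z , refl ← m≤n⇒∃[o]m+o≡n lo with g , refl ← cg-split cg N≤N′
      = ≈-trans (≈-reflexive (cong u (lem B c z))) (≈-trans (cell-shift m n g (c + z) (m≤m+n c z) fits p∤Λ)
          (≈-reflexive (cong u (lem₂ B c z (H * g)))))
      where
      B : ℕ
      B = b ^ m * (w + b ^ l * n)
      lem : ∀ B c z → B + c + z ≡ c + z + B
      lem = solve-∀
      lem₂ : ∀ B c z y → c + z + y + B ≡ B + c + z + y
      lem₂ = solve-∀
      lem₃ : ∀ B c z y → B + c + z + y ≡ B + (c + z + y)
      lem₃ = solve-∀
      fits : c + z + H * g < b ^ m
      fits = +-cancelˡ-< B _ _ (subst (_< B + b ^ m) (lem₃ B c z (H * g)) hi′)
      1≤m : ∀ {m} → c + z + H * g < b ^ m → 1 ≤ m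
      1≤m {zero}  lt = ⊥-elim (<-irrefl refl (≤-trans lt (≤-trans 1≤c (≤-trans (m≤m+n c z) (m≤m+n (c + z) (H * g))))))
      1≤m {suc m} _  = s≤s z≤n
      p∤Λ : ¬ p ∣ c + z
      p∤Λ d = p∤N (subst (p ∣_) (sym (lem B c z)) (∣m∣n⇒∣m+n d (∣m⇒∣m*n (w + b ^ l * n) (p∣b^ {m} (1≤m {m} fits)))))

  cell : ∀ m n {B N N′} → B ≡ b ^ m * (w + b ^ l * n) → InCell B m N → InCell B m N′ → N ≡ N′ [mod H ] → ¬ p ∣ N → u N ≈ u N′
  cell m n {N = N} {N′} refl in₁ in₂ cg p∤N with ≤-total N N′
  ... | inj₁ N≤N′ = cell-≤ m n in₁ in₂ N≤N′ (cg-sym cg) p∤N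
  ... | inj₂ N′≤N = ≈-sym (cell-≤ m n in₂ in₁ N′≤N cg (λ d → p∤N (cg-∣ p∣H (cg-sym cg) d)))

  tail-zero : ∀ m → b ^ m * w ≡ b ^ m * (w + b ^ l * 0)
  tail-zero m = cong (b ^ m *_) (sym (trans (cong (w +_) (*-zeroʳ (b ^ l))) (+-identityʳ w)))

  ≡1⇒p∤ : ∀ {n} → n ≡ 1 [mod H ] → ¬ p ∣ n
  ≡1⇒p∤ cg d = prime∤1 pp (cg-∣ p∣H cg d)

  Anchor : Carrier → ℕ → ℕ → Set ℓ
  Anchor v m₀ P = ∀ j ρ → InCell (b ^ (m₀ + P * j) * w) (m₀ + P * j) ρ → ρ ≡ 1 [mod H ] → u ρ ≈ v

  opaque
    -- P combines the period of the powers of b modulo H with `size !`: along it the sample point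
    -- stays ≡ 1 modulo H and its zeros can be pumped, so its value v is the same in all these
    -- cells.
    anchor : Σ Carrier λ v → ∃₂ λ m₀ P → 1 ≤ P × c + H ≤ m₀ × Anchor v m₀ P
    anchor with mH , PH , 1≤PH , per ← powers-periodic b H 1≤H
      with x , x<H , x-eq ← linear-congruence 1 H 1≤H (Cop.sym (Cop.1-coprimeTo H)) (c + b ^ (c + H + (size + mH)) * w) 1
      = u (c + x + b ^ m₀ * w) , m₀ , size ! * PH , *-mono-≤ (1≤n! size) 1≤PH , m≤m+n (c + H) (size + mH) , anchored
      where
      m₀ : ℕ
      -- `c + H` digits hold `c + x`, `size` zeros allow pumping, and `mH` puts the exponent into
      -- the periodic range of the powers of b.
      m₀ = c + H + (size + mH)
      powers : ∀ t → b ^ (m₀ + PH * t) ≡ b ^ m₀ [mod H ]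
      powers zero    = cg-≡ (cong (b ^_) (trans (cong (m₀ +_) (*-zeroʳ PH)) (+-identityʳ m₀)))
      powers (suc t) = cg-trans (cg-≡ (cong (b ^_) (lem m₀ PH t)))
        (cg-trans (per (m₀ + PH * t) (≤-trans (≤-trans (m≤n+m mH size) (m≤n+m (size + mH) (c + H))) (m≤m+n m₀ (PH * t)))) (powers t))
        where
        lem : ∀ m P t → m + P * suc t ≡ m + P * t + P
        lem = solve-∀
      lem₁ : ∀ s P j → s * P * j ≡ P * (s * j)
      lem₁ = solve-∀
      lem₂ : ∀ c x z → c + x + z ≡ c + z + 1 * x
      lem₂ = solve-∀
      lem₃ : ∀ L k s P j → L + k + s * P * j ≡ L + (k + s * (P * j))
      lem₃ = solve-∀
      anchored : Anchor (u (c + x + b ^ m₀ * w)) m₀ (size ! * PH)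
      anchored j ρ in₁ ρ≡1 = ≈-trans (cell m 0 (tail-zero m) in₁ in₂ (cg-trans ρ≡1 (cg-sym one)) (≡1⇒p∤ ρ≡1)) pumped
        where
        m : ℕ
        m = m₀ + size ! * PH * j
        Λ<m : c + x < b ^ m
        Λ<m = ≤-trans (≤-trans (+-monoʳ-< c x<H) (≤-trans (m≤m+n (c + H) (size + mH)) (m≤m+n m₀ _))) (<⇒≤ (n<b^n m 2≤b))
        in₂ : InCell (b ^ m * w) m (c + x + b ^ m * w)
        in₂ = in-cell (subst (_≤ c + x + b ^ m * w) (+-comm c (b ^ m * w)) (+-monoˡ-≤ (b ^ m * w) (m≤m+n c x)))
                (subst (c + x + b ^ m * w <_) (+-comm (b ^ m) (b ^ m * w)) (+-monoˡ-< (b ^ m * w) Λ<m))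
        one : c + x + b ^ m * w ≡ 1 [mod H ]
        one = cg-trans (cg-+ cg-refl (cg-* (cg-trans (cg-≡ (cong (λ z → b ^ (m₀ + z)) (lem₁ (size !) PH j))) (powers (size ! * j))) cg-refl))
                (cg-trans (cg-≡ (lem₂ c x (b ^ m₀ * w))) x-eq)
        fits : c + x < b ^ (c + H)
        fits = <-trans (+-monoʳ-< c x<H) (n<b^n (c + H) 2≤b)
        q : Fin size
        q = read start (c + H) (c + x)
        pumped : u (c + x + b ^ m * w) ≈ u (c + x + b ^ m₀ * w)
        pumped = ≈-trans (≈-reflexive (cong (λ z → u (c + x + z)) (trans (cong (λ z → b ^ z * w) (lem₃ (c + H) (size + mH) (size !) PH j)) (^-+-* (c + H) _ w))))
          (≈-trans (start-correct (c + H) (c + x) fits _)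
          (≈-trans (zeros-pump q (size + mH) (PH * j) w (m≤m+n size mH))
          (≈-trans (≈-sym (start-correct (c + H) (c + x) fits _))
            (≈-reflexive (cong (λ z → u (c + x + z)) (sym (^-+-* (c + H) (size + mH) w)))))))

  module _ {v : Carrier} {m₀ P : ℕ} (1≤P : 1 ≤ P) (c+H≤m₀ : c + H ≤ m₀) (anchored : Anchor v m₀ P) where

    y≤B : ∀ y m′ → y ≤ b ^ m′ * (w + b ^ l * (y * w + 1))
    y≤B y m′ = begin
      y                                     ≡⟨ sym (*-identityʳ y) ⟩
      y * 1                                 ≤⟨ *-monoʳ-≤ y 1≤w ⟩
      y * w                                 ≤⟨ m≤m+n (y * w) 1 ⟩
      y * w + 1                             ≡⟨ sym (+-identityʳ _) ⟩
      1 * (y * w + 1)                       ≤⟨ *-monoˡ-≤ (y * w + 1) (1≤b^ l 1≤b) ⟩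
      b ^ l * (y * w + 1)                   ≤⟨ m≤n+m _ w ⟩
      w + b ^ l * (y * w + 1)               ≡⟨ sym (+-identityʳ _) ⟩
      1 * (w + b ^ l * (y * w + 1))         ≤⟨ *-monoˡ-≤ _ (1≤b^ m′ 1≤b) ⟩
      b ^ m′ * (w + b ^ l * (y * w + 1))    ∎
      where open ≤-Reasoning

    -- For t between x and y = x + H, the anchor cell contains ρ ≡ 1 with t ρ in the cell
    -- with index n = y w + 1; so u(t) v is the common value of u on the latter.
    companion : ∀ j m′ y t → m₀ + P * j ≡ l + m′ → 1 ≤ t → t ≤ y → y * w + 2 ≤ t * w + t →
      y * c ≤ m′ → c + H * (y * y) < m′ →
      ∃ λ ρ → u (t * ρ) ≈ u t ∙ v × t * ρ ≡ t [mod H ] × InCell (b ^ m′ * (w + b ^ l * (y * w + 1))) m′ (t * ρ)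
    companion j m′ y t m-eq 1≤t t≤y wide yc≤ room
      -- The terms of this progression are t times `1 + H * (t * g)`, a number prime to t and ≡ 1
      -- modulo H.
      with g , lo , hi ← arithmetic-progression-hits t (H * (t * t)) (b ^ m′ * (w + b ^ l * (y * w + 1)) + c)
        (*-mono-≤ 1≤H (*-mono-≤ 1≤t 1≤t)) (≤-trans (≤-trans t≤y (y≤B y m′)) (m≤m+n _ c))
      = 1 + H * (t * g) , value , cg-trans (cg-≡ (lem₁ t H g)) (cg-+multiple t _) ,
        in-cell (subst (B + c ≤_) (sym (lem t H g)) lo) (subst (_< B + b ^ m′) (sym (lem t H g)) hi′)
      where
      m B ρ : ℕ
      m = m₀ + P * j
      B = b ^ m′ * (w + b ^ l * (y * w + 1))
      ρ = 1 + H * (t * g)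
      lem : ∀ t H g → t * (1 + H * (t * g)) ≡ t + H * (t * t) * g
      lem = solve-∀
      lem₁ : ∀ t H g → t * (1 + H * (t * g)) ≡ t + H * (t * t * g)
      lem₁ = solve-∀
      b^m : b ^ m ≡ b ^ m′ * b ^ l
      b^m = trans (cong (b ^_) m-eq) (trans (^-distribˡ-+-* b l m′) (*-comm (b ^ l) (b ^ m′)))
      m′<b^m′ : m′ < b ^ m′
      m′<b^m′ = n<b^n m′ 2≤b
      hi′ : t + H * (t * t) * g < B + b ^ m′
      hi′ = begin-strict
        t + H * (t * t) * g        ≤⟨ hi ⟩
        B + c + H * (t * t)        ≤⟨ +-monoʳ-≤ (B + c) (*-monoʳ-≤ H (*-mono-≤ t≤y t≤y)) ⟩
        B + c + H * (y * y)        ≡⟨ +-assoc B c _ ⟩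
        B + (c + H * (y * y))      <⟨ +-monoʳ-< B (<-trans room m′<b^m′) ⟩
        B + b ^ m′                 ∎
        where open ≤-Reasoning
      ρ-lo : b ^ m * w + c ≤ ρ
      ρ-lo = *-cancelˡ-≤ t {{>-nonZero 1≤t}} (begin
        t * (b ^ m * w + c)               ≤⟨ *-monoˡ-≤ (b ^ m * w + c) t≤y ⟩
        y * (b ^ m * w + c)               ≡⟨ lem₂ y (b ^ m) w c ⟩
        b ^ m * (y * w) + y * c           ≤⟨ +-monoʳ-≤ (b ^ m * (y * w)) (≤-trans yc≤ (≤-trans (<⇒≤ m′<b^m′) (≤-trans (m≤m*n (b ^ m′) (b ^ l) {{>-nonZero (1≤b^ l 1≤b)}}) (≤-reflexive (sym b^m))))) ⟩
        b ^ m * (y * w) + b ^ m           ≡⟨ lem₃ (b ^ m) y w ⟩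
        b ^ m * (y * w + 1)               ≡⟨ cong (_* (y * w + 1)) b^m ⟩
        b ^ m′ * b ^ l * (y * w + 1)      ≡⟨ *-assoc (b ^ m′) (b ^ l) _ ⟩
        b ^ m′ * (b ^ l * (y * w + 1))    ≤⟨ *-monoʳ-≤ (b ^ m′) (m≤n+m _ w) ⟩
        B                                 ≤⟨ m≤m+n B c ⟩
        B + c                             ≤⟨ lo ⟩
        t + H * (t * t) * g               ≡⟨ sym (lem t H g) ⟩
        t * ρ                             ∎)
        where
        open ≤-Reasoning
        lem₂ : ∀ y B w c → y * (B * w + c) ≡ B * (y * w) + y * c
        lem₂ = solve-∀
        lem₃ : ∀ B y w → B * (y * w) + B ≡ B * (y * w + 1)
        lem₃ = solve-∀
      ρ-hi : ρ < b ^ m * w + b ^ m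
      ρ-hi = *-cancelˡ-< t _ _ (begin-strict
        t * ρ                                       ≡⟨ lem t H g ⟩
        t + H * (t * t) * g                         <⟨ hi′ ⟩
        B + b ^ m′                                  ≡⟨ lem₂ (b ^ m′) w (b ^ l) (y * w + 1) ⟩
        b ^ m′ * suc w + b ^ m′ * b ^ l * (y * w + 1) ≤⟨ +-monoˡ-≤ _ (*-monoʳ-≤ (b ^ m′) w<b^l) ⟩
        b ^ m′ * b ^ l + b ^ m′ * b ^ l * (y * w + 1) ≡⟨ lem₃ (b ^ m′ * b ^ l) (y * w) ⟩
        b ^ m′ * b ^ l * (y * w + 2)                ≤⟨ *-monoʳ-≤ (b ^ m′ * b ^ l) wide ⟩
        b ^ m′ * b ^ l * (t * w + t)                ≡⟨ cong (_* (t * w + t)) (sym b^m) ⟩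
        b ^ m * (t * w + t)                         ≡⟨ lem₄ (b ^ m) t w ⟩
        t * (b ^ m * w + b ^ m)                     ∎)
        where
        open ≤-Reasoning
        lem₂ : ∀ B w L z → B * (w + L * z) + B ≡ B * suc w + B * L * z
        lem₂ = solve-∀
        lem₃ : ∀ B z → B + B * (z + 1) ≡ B * (z + 2)
        lem₃ = solve-∀
        lem₄ : ∀ B t w → B * (t * w + t) ≡ t * (B * w + B)
        lem₄ = solve-∀
      ρ⊥t : Coprime t ρ
      ρ⊥t = cg-1⇒coprime (cg-trans (cg-≡ (lem₅ H t g)) (cg-+multiple 1 _))
        where
        lem₅ : ∀ H t g → 1 + H * (t * g) ≡ 1 + t * (H * g)
        lem₅ = solve-∀
      value : u (t * ρ) ≈ u t ∙ v
      value = ≈-trans (mult t ρ 1≤t (s≤s z≤n) ρ⊥t) (∙-congˡ (anchored j ρ (in-cell ρ-lo ρ-hi) (cg-+multiple 1 (t * g))))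

    1≤∤ : ∀ {x} → ¬ p ∣ x → 1 ≤ x
    1≤∤ p∤x = n≢0⇒n>0 (λ e → p∤x (subst (p ∣_) (sym e) (p ∣0)))

    j≤m : ∀ j → j ≤ m₀ + P * j
    j≤m j = ≤-trans (m≤n*m j P {{>-nonZero 1≤P}}) (m≤n+m (P * j) m₀)

    -- The bound on x amounts to `(x + H) * w + 2 ≤ x * w + x`. It lets one cell hold multiples of
    -- both x and x + H whose cofactors lie in an anchor cell.
    value-shift : ∀ x → H * w + 2 ≤ x → ¬ p ∣ x → u x ∙ v ≈ u (x + H) ∙ v
    value-shift x large p∤x = meet (m≤n⇒∃[o]m+o≡n (≤-trans (m≤m+n l E) (j≤m (l + E))))
      where
      y E : ℕ
      y = x + H
      E = suc (c + H * (y * y)) + y * c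
      lem : ∀ x H w → (x + H) * w + 2 ≡ x * w + (H * w + 2)
      lem = solve-∀
      wide-x : y * w + 2 ≤ x * w + x
      wide-x = subst (_≤ x * w + x) (sym (lem x H w)) (+-monoʳ-≤ (x * w) large)
      wide-y : y * w + 2 ≤ y * w + y
      wide-y = +-monoʳ-≤ (y * w) (≤-trans (≤-trans (m≤n+m 2 (H * w)) large) (m≤m+n x H))
      meet : (∃ λ m′ → l + m′ ≡ m₀ + P * (l + E)) → u x ∙ v ≈ u (x + H) ∙ v
      meet (m′ , e) = join
        (companion (l + E) m′ y x (sym e) (1≤∤ p∤x) (m≤m+n x H) wide-x yc≤ room)
        (companion (l + E) m′ y y (sym e) (≤-trans (1≤∤ p∤x) (m≤m+n x H)) ≤-refl wide-y yc≤ room)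
        where
        E≤m′ : E ≤ m′
        E≤m′ = +-cancelˡ-≤ l E m′ (subst (l + E ≤_) (sym e) (j≤m (l + E)))
        yc≤ : y * c ≤ m′
        yc≤ = ≤-trans (m≤n+m (y * c) _) E≤m′
        room : c + H * (y * y) < m′
        room = ≤-trans (m≤m+n _ (y * c)) E≤m′
        join : (∃ λ ρ → u (x * ρ) ≈ u x ∙ v × x * ρ ≡ x [mod H ] × InCell (b ^ m′ * (w + b ^ l * (y * w + 1))) m′ (x * ρ)) →
               (∃ λ ρ → u (y * ρ) ≈ u y ∙ v × y * ρ ≡ y [mod H ] × InCell (b ^ m′ * (w + b ^ l * (y * w + 1))) m′ (y * ρ)) →
               u x ∙ v ≈ u (x + H) ∙ v
        join (ρ , val , cg , in₁) (ρ′ , val′ , cg′ , in₂) = ≈-trans (≈-sym val)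
          (≈-trans (cell m′ (y * w + 1) refl in₁ in₂ (cg-trans cg (cg-sym (cg-trans cg′ y≡x))) (λ d → p∤x (cg-∣ p∣H cg d))) val′)
          where
          y≡x : y ≡ x [mod H ]
          y≡x = cg-trans (cg-≡ (cong (x +_) (sym (*-identityʳ H)))) (cg-+multiple x 1)

    value-shifts : ∀ x g → H * w + 2 ≤ x → ¬ p ∣ x → u x ∙ v ≈ u (x + H * g) ∙ v
    value-shifts x zero    large p∤x = ∙-congʳ (≈-reflexive (cong u (sym (trans (cong (x +_) (*-zeroʳ H)) (+-identityʳ x)))))
    value-shifts x (suc g) large p∤x = ≈-trans (value-shift x large p∤x) (≈-trans
      (value-shifts (x + H) g (≤-trans large (m≤m+n x H)) (λ d → p∤x (∣m+n∣m⇒∣n (subst (p ∣_) (+-comm x H) d) p∣H)))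
      (∙-congʳ (≈-reflexive (cong u (lem x H g)))))
      where
      lem : ∀ x H g → x + H + H * g ≡ x + H * suc g
      lem = solve-∀

    in-every-cell : ∀ m a → c + H < b ^ m → a ≤ b ^ m * w + c → ∃ λ g → InCell (b ^ m * w) m (a + H * g)
    in-every-cell m a room a≤ with g , lo , hi ← arithmetic-progression-hits a H (b ^ m * w + c) 1≤H a≤
      = g , in-cell lo (≤-trans (s≤s hi) (subst (_< b ^ m * w + b ^ m) (sym (+-assoc (b ^ m * w) c H)) (+-monoʳ-< (b ^ m * w) room)))

    room-at : ∀ j → c + H < b ^ (m₀ + P * j)
    room-at j = ≤-trans (s≤s (≤-trans c+H≤m₀ (m≤m+n m₀ (P * j)))) (n<b^n (m₀ + P * j) 2≤b)

    private
      -- Q is compared with a product `Q′ * ρ₀` in its own cell and residue class modulo H, where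
      -- `Q′ ≡ 1` modulo ρ₀; the factor ρ₀ contributes v.
      factor-with : ∀ ρ₀ → ρ₀ ≡ 1 [mod H ] → 1 ≤ ρ₀ → u ρ₀ ≈ v → ∀ m Q → ρ₀ * (1 + ρ₀ * H) + (c + H * (ρ₀ * ρ₀)) + ρ₀ * (H * w + 2) ≤ m →
        InCell (b ^ m * w) m Q → ¬ p ∣ Q → ∃ λ Q′ → u Q ≈ u Q′ ∙ v × Q′ ≡ Q [mod H ] × H * w + 2 ≤ Q′
      factor-with ρ₀ ρ₀≡1 1≤ρ₀ uρ₀ m Q big inQ p∤Q
        with r , r<H , r-eq ← linear-congruence 1 H 1≤H (Cop.sym (Cop.1-coprimeTo H)) 1 Q
        with g , lo , hi ← arithmetic-progression-hits (ρ₀ * (1 + ρ₀ * r)) (H * (ρ₀ * ρ₀)) (b ^ m * w + c)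
          (*-mono-≤ 1≤H (*-mono-≤ 1≤ρ₀ 1≤ρ₀))
          (≤-trans (*-monoʳ-≤ ρ₀ (s≤s (*-monoʳ-≤ ρ₀ (<⇒≤ r<H)))) (≤-trans (m≤m+n _ _) (≤-trans (m≤m+n _ _) (≤-trans big
            (≤-trans (<⇒≤ (n<b^n m 2≤b)) (≤-trans (m≤m*n (b ^ m) w {{>-nonZero 1≤w}}) (m≤m+n _ c)))))))
        = Q′ , ≈-trans (cell m 0 (tail-zero m) inQ in′ (cg-sym Q′ρ₀≡Q) p∤Q)
                 (≈-trans (mult Q′ ρ₀ (s≤s z≤n) 1≤ρ₀ (Cop.sym (cg-1⇒coprime Q′≡1))) (∙-congˡ uρ₀)) ,
          Q′≡Q , *-cancelˡ-≤ ρ₀ {{>-nonZero 1≤ρ₀}} (≤-trans (m≤n+m _ _) (≤-trans big (≤-trans (<⇒≤ (n<b^n m 2≤b))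
            (≤-trans (m≤m*n (b ^ m) w {{>-nonZero 1≤w}}) (≤-trans (m≤m+n _ c) (≤-trans lo (≤-reflexive (trans (sym eq) (*-comm Q′ ρ₀)))))))))
        where
        Q′ : ℕ
        Q′ = 1 + ρ₀ * r + H * (ρ₀ * g)
        lem : ∀ ρ r H g → (1 + ρ * r + H * (ρ * g)) * ρ ≡ ρ * (1 + ρ * r) + H * (ρ * ρ) * g
        lem = solve-∀
        eq : Q′ * ρ₀ ≡ ρ₀ * (1 + ρ₀ * r) + H * (ρ₀ * ρ₀) * g
        eq = lem ρ₀ r H g
        hi′ : ρ₀ * (1 + ρ₀ * r) + H * (ρ₀ * ρ₀) * g < b ^ m * w + b ^ m
        hi′ = ≤-trans (s≤s (≤-trans hi (≤-reflexive (+-assoc (b ^ m * w) c _))))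
          (+-monoʳ-< (b ^ m * w) (≤-trans (s≤s (≤-trans (m≤n+m _ (ρ₀ * (1 + ρ₀ * H))) (≤-trans (m≤m+n _ (ρ₀ * (H * w + 2))) big))) (n<b^n m 2≤b)))
        in′ : InCell (b ^ m * w) m (Q′ * ρ₀)
        in′ = in-cell (subst (b ^ m * w + c ≤_) (sym eq) lo) (subst (_< b ^ m * w + b ^ m) (sym eq) hi′)
        Q′≡Q : Q′ ≡ Q [mod H ]
        Q′≡Q = cg-trans (cg-+multiple (1 + ρ₀ * r) (ρ₀ * g)) (cg-trans (cg-+ cg-refl (cg-* ρ₀≡1 cg-refl)) r-eq)
        Q′ρ₀≡Q : Q′ * ρ₀ ≡ Q [mod H ]
        Q′ρ₀≡Q = cg-trans (cg-* Q′≡Q ρ₀≡1) (cg-≡ (*-identityʳ Q))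
        lem₂ : ∀ ρ r H g → 1 + ρ * r + H * (ρ * g) ≡ 1 + ρ * (r + H * g)
        lem₂ = solve-∀
        Q′≡1 : Q′ ≡ 1 [mod ρ₀ ]
        Q′≡1 = cg-trans (cg-≡ (lem₂ ρ₀ r H g)) (cg-+multiple 1 _)

    opaque
      cell-factor : ∃ λ M₀ → ∀ m Q → M₀ ≤ m → InCell (b ^ m * w) m Q → ¬ p ∣ Q →
        ∃ λ Q′ → u Q ≈ u Q′ ∙ v × Q′ ≡ Q [mod H ] × H * w + 2 ≤ Q′
      cell-factor with g , inρ ← in-every-cell (m₀ + P * 0) 1 (room-at 0) (≤-trans 1≤c (m≤n+m c _)) =
        _ , λ m Q → factor-with (1 + H * g) (cg-+multiple 1 g) (s≤s z≤n) (anchored 0 _ inρ (cg-+multiple 1 g)) m Q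

    opaque
      -- In a far anchor cell v = u(ρ) = u(Q) v with Q ≡ 1 modulo H. Moving Q by a multiple of H
      -- into another anchor cell replaces u(Q) by v.
      idempotent : v ≈ v ∙ v
      idempotent with M₀ , factor ← cell-factor
        with g , inρ ← in-every-cell (m₀ + P * M₀) 1 (room-at M₀) (≤-trans 1≤c (m≤n+m c _))
        with Q , val , Q≡ , large ← factor (m₀ + P * M₀) _ (j≤m M₀) inρ (≡1⇒p∤ (cg-+multiple 1 g))
        with g′ , inQ ← in-every-cell (m₀ + P * Q) Q (room-at Q)
          (≤-trans (≤-trans (<⇒≤ (n<b^n Q 2≤b)) (≤-trans (^-monoʳ-≤ b {{>-nonZero 1≤b}} (j≤m Q)) (m≤m*n _ w {{>-nonZero 1≤w}}))) (m≤m+n _ c))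
        = ≈-trans (≈-sym (anchored M₀ _ inρ (cg-+multiple 1 g))) (≈-trans val
            (≈-trans (value-shifts Q g′ large (≡1⇒p∤ Q≡1)) (∙-congʳ (anchored Q _ inQ (cg-trans (cg-+multiple Q g′) Q≡1)))))
        where
        Q≡1 : Q ≡ 1 [mod H ]
        Q≡1 = cg-trans Q≡ (cg-+multiple 1 g)

-- Pumping sums of blocks

stationary-or-large : ∀ (f : ℕ → ℕ) → (∀ j → f j ≤ f (suc j)) → 1 ≤ f 0 →
  ∀ n → (∃ λ j → j < n × f j ≡ f (suc j)) ⊎ n < f n
stationary-or-large f mono pos zero = inj₂ pos
stationary-or-large f mono pos (suc n) with stationary-or-large f mono pos n
... | inj₁ (j , j<n , e) = inj₁ (j , m≤n⇒m≤1+n j<n , e)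
... | inj₂ n<fn with f n ≟ f (suc n)
...   | yes e = inj₁ (n , n<1+n n , e)
...   | no ne = inj₂ (≤-trans (s≤s n<fn) (≤∧≢⇒< (mono n) ne))

stationary : ∀ (f : ℕ → ℕ) n → (∀ j → f j ≤ f (suc j)) → 1 ≤ f 0 → f n ≤ n → ∃ λ j → j < n × f j ≡ f (suc j)
stationary f n mono pos bounded with stationary-or-large f mono pos n
... | inj₁ found = found
... | inj₂ n<fn  = ⊥-elim (<-irrefl refl (≤-trans n<fn bounded))

gcd-positive : ∀ {z} n → 1 ≤ z → 1 ≤ gcd z n
gcd-positive {z} n 1≤z = n≢0⇒n>0 (λ z≡0 → <-irrefl (sym (0∣⇒≡0 (subst (_∣ z) z≡0 (gcd[m,n]∣m z n)))) 1≤z)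

gcd-power-mono : ∀ {z} b j → 1 ≤ z → gcd z (b ^ j) ≤ gcd z (b ^ suc j)
gcd-power-mono {z} b j 1≤z = ∣⇒≤ {{>-nonZero (gcd-positive (b ^ suc j) 1≤z)}}
  (gcd-greatest (gcd[m,n]∣m z (b ^ j)) (∣n⇒∣m*n b (gcd[m,n]∣n z (b ^ j))))

opaque
  -- The numbers `gcd z (b ^ j)` do not decrease and are at most G at `j = suc G`, so two
  -- consecutive ones coincide; the cofactor in z then shares no divisor with b.
  coprime-part : ∀ z b G → 1 ≤ z → (∀ g → g ∣ z → g ∣ b ^ suc G → g ≤ G) →
    ∃₂ λ g y → ∃ λ g′ → z ≡ g * y × Coprime y b × b ^ G ≡ g * g′
  coprime-part z b G 1≤z bounded
    with j , j<G , e ← stationary (λ j → gcd z (b ^ j)) (suc G) (λ j → gcd-power-mono b j 1≤z) (gcd-positive 1 1≤z)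
      (m≤n⇒m≤1+n (bounded _ (gcd[m,n]∣m z _) (gcd[m,n]∣n z (b ^ suc G))))
    with divides y z-eq ← gcd[m,n]∣m z (b ^ j)
    with divides g″ b-eq ← gcd[m,n]∣n z (b ^ j)
    with x , G-eq ← m≤n⇒∃[o]m+o≡n (s≤s⁻¹ j<G)
    = g , y , g″ * b ^ x , trans z-eq (*-comm y g) , y⊥b ,
      trans (cong (b ^_) (sym G-eq)) (trans (^-distribˡ-+-* b j x) (trans (cong (_* b ^ x) b-eq) (lem g″ g (b ^ x))))
    where
    g : ℕ
    g = gcd z (b ^ j)
    lem : ∀ a g x → a * g * x ≡ g * (a * x)
    lem = solve-∀
    1≤g : 1 ≤ g
    1≤g = gcd-positive (b ^ j) 1≤z
    y⊥b : Coprime y b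
    y⊥b {d} (d∣y , d∣b) = ∣1⇒≡1 (*-cancelʳ-∣ g {{>-nonZero 1≤g}} (subst (d * g ∣_) (sym (*-identityˡ g))
      (subst (d * g ∣_) (sym e) (gcd-greatest (subst (d * g ∣_) (sym z-eq) (*-monoˡ-∣ g d∣y)) (*-pres-∣ d∣b (gcd[m,n]∣n z (b ^ j)))))))

module Support {a ℓ} (CM : CommutativeMonoid a ℓ)
  {b : ℕ} {u : ℕ → CommutativeMonoid.Carrier CM} (2≤b : 2 ≤ b) (machine : Machine (CommutativeMonoid._≈_ CM) b u) where

  open CommutativeMonoid CM renaming (refl to ≈-refl; sym to ≈-sym; trans to ≈-trans; reflexive to ≈-reflexive)
  open Digits isEquivalence 2≤b machine
  open Machine machine

  private instance
    b≢0 : NonZero b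
    b≢0 = >-nonZero 1≤b

  -- Pumping a run of zeros multiplies the digits above it by a power of t.
  t : ℕ
  t = b ^ (size !)

  2≤t : 2 ≤ t
  2≤t = ≤-trans 2≤b (≤-trans (≤-reflexive (sym (^-identityʳ b))) (^-monoʳ-≤ b (1≤n! size)))

  1≤t : 1 ≤ t
  1≤t = 1≤b^ (size !) 1≤b

  t^ : ∀ i → t ^ i ≡ b ^ (size ! * i)
  t^ i = ^-*-assoc b (size !) i

  -- Quantified over all states, so that it persists when digits are put in front.
  Equiv : ℕ → ℕ → Set ℓ
  Equiv Y Y′ = ∀ q → G q Y ≈ G q Y′

  -- The digits of x are followed by `size` zeros, enough to insert `t ^ i` from whatever state x
  -- leads to.
  pump-block : ∀ x e i {Y Y′} → x < b ^ e → Equiv Y Y′ → Equiv (x + b ^ (e + size) * Y) (x + b ^ (e + size) * (t ^ i * Y′))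
  pump-block x e i {Y} {Y′} x< eqv q = ≈-trans (≈-reflexive (cong (λ z → G q (x + z)) (^-+-* e size Y)))
    (≈-trans (read-correct q e x x< _) (≈-trans (read-correct q′ size 0 (1≤b^ size 1≤b) Y) (≈-trans (eqv _)
    (≈-trans (≈-sym (read-correct q′ size 0 (1≤b^ size 1≤b) Y′)) (≈-trans (≈-sym (zeros-pump q′ size i Y′ ≤-refl))
    (≈-trans (≈-sym (read-correct q e x x< _)) (≈-reflexive (cong (λ z → G q (x + z)) eq))))))))
    where
    q′ : Fin size
    q′ = read q e x
    eq : b ^ e * (b ^ (size + size ! * i) * Y′) ≡ b ^ (e + size) * (t ^ i * Y′)
    eq = trans (cong (b ^ e *_) (trans (^-+-* size (size ! * i) Y′) (cong (λ z → b ^ size * (z * Y′)) (sym (t^ i)))))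
           (sym (^-+-* e size _))

  -- Horner form of Σ e ωʲ D τʲ + τⁿ Y.
  blocks : (τ ω D e n Y : ℕ) → ℕ
  blocks τ ω D e zero    Y = Y
  blocks τ ω D e (suc n) Y = e * D + τ * blocks τ ω D (e * ω) n Y

  blocks-+ : ∀ τ ω D e m n Y → blocks τ ω D e (m + n) Y ≡ blocks τ ω D e m (blocks τ ω D (e * ω ^ m) n Y)
  blocks-+ τ ω D e zero    n Y = cong (λ z → blocks τ ω D z n Y) (sym (*-identityʳ e))
  blocks-+ τ ω D e (suc m) n Y = cong (λ z → e * D + τ * z) (trans (blocks-+ τ ω D (e * ω) m n Y)
    (cong (λ z → blocks τ ω D (e * ω) m (blocks τ ω D z n Y)) (*-assoc e ω (ω ^ m))))

  -- With V = 2 + D one has V D + 1 = (1 + D)², so the blocks form a geometric sum of ratio (1 + D)².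
  blocks-sum : ∀ τ ω D e n Y → τ * ω ≡ suc D * suc D →
    (2 + D) * blocks τ ω D e n Y + e ≡ e * (τ * ω) ^ n + τ ^ n * ((2 + D) * Y)
  blocks-sum τ ω D e zero Y eq = lem e ((2 + D) * Y)
    where
    lem : ∀ e z → z + e ≡ e * 1 + (z + 0)
    lem = solve-∀
  blocks-sum τ ω D e (suc n) Y eq = begin
    (2 + D) * (e * D + τ * B) + e                                 ≡⟨ lem₁ D e τ B ⟩
    e * (suc D * suc D) + τ * ((2 + D) * B)                       ≡⟨ cong (λ z → e * z + τ * ((2 + D) * B)) (sym eq) ⟩
    e * (τ * ω) + τ * ((2 + D) * B)                               ≡⟨ lem₂ e τ ω ((2 + D) * B) ⟩
    τ * ((2 + D) * B + e * ω)                                     ≡⟨ cong (τ *_) (blocks-sum τ ω D (e * ω) n Y eq) ⟩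
    τ * (e * ω * (τ * ω) ^ n + τ ^ n * ((2 + D) * Y))             ≡⟨ lem₃ τ e ω ((τ * ω) ^ n) (τ ^ n) ((2 + D) * Y) ⟩
    e * (τ * ω * (τ * ω) ^ n) + τ * τ ^ n * ((2 + D) * Y)         ∎
    where
    open ≡-Reasoning
    B : ℕ
    B = blocks τ ω D (e * ω) n Y
    lem₁ : ∀ D e τ B → (2 + D) * (e * D + τ * B) + e ≡ e * (suc D * suc D) + τ * ((2 + D) * B)
    lem₁ = solve-∀
    lem₂ : ∀ e τ ω B → e * (τ * ω) + τ * B ≡ τ * (B + e * ω)
    lem₂ = solve-∀
    lem₃ : ∀ τ e ω A C Z → τ * (e * ω * A + C * Z) ≡ e * (τ * ω * A) + τ * C * Z
    lem₃ = solve-∀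

  module Residues (τ ω D ε E M o g t₋ e₀ : ℕ) (τ-eq : τ ≡ b ^ (ε + size)) (1≤ω : 1 ≤ ω) (E-fits : E * D < b ^ ε)
    (τ≡1 : τ ≡ 1 [mod M ]) (t-order : t ^ suc o ≡ 1 [mod M ]) (t-eq : t ≡ suc t₋) (ω-order : ω ^ (2 + g) ≡ 1 [mod M ]) where

    private
      blk : ℕ → ℕ → ℕ → ℕ
      blk = blocks τ ω D

      ≤-weight : ∀ e n {E} → e * ω ^ n ≤ E → e ≤ E
      ≤-weight e n h = ≤-trans (m≤m*n e (ω ^ n) {{>-nonZero (1≤b^ n 1≤ω)}}) h

      next-weight : ∀ e n {E} → e * ω ^ suc n ≤ E → e * ω * ω ^ n ≤ E
      next-weight e n {E} = subst (_≤ E) (sym (*-assoc e ω (ω ^ n)))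

      block-fits : ∀ e n → e * ω ^ n ≤ E → e * D < b ^ ε
      block-fits e n h = ≤-trans (s≤s (*-monoˡ-≤ D (≤-weight e n h))) E-fits

      pump : ∀ i e n {Y Y′} → e * ω ^ n ≤ E → Equiv Y Y′ → Equiv (e * D + τ * Y) (e * D + τ * (t ^ i * Y′))
      pump i e n {Y} {Y′} h eqv = subst (λ z → Equiv (e * D + z * Y) (e * D + z * (t ^ i * Y′))) (sym τ-eq)
        (pump-block (e * D) ε i (block-fits e n h) eqv)

      drop-τ : ∀ {y z} → y ≡ z [mod M ] → τ * y ≡ z [mod M ]
      drop-τ {z = z} c = cg-trans (cg-* τ≡1 c) (cg-≡ (*-identityˡ z))

    blocks-equiv : ∀ e n {Y Y′} → e * ω ^ n ≤ E → Equiv Y Y′ → Equiv (blk e n Y) (blk e n Y′)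
    blocks-equiv e zero    h eqv = eqv
    blocks-equiv e (suc n) {Y} {Y′} h eqv q = ≈-trans (pump 0 e (suc n) h (blocks-equiv (e * ω) n (next-weight e n h) eqv) q)
      (≈-reflexive (cong (λ z → G q (e * D + τ * z)) (*-identityˡ _)))

    -- As `τ ≡ 1`, a change of the tail arrives at the front unscaled.
    blocks-cg : ∀ e n {Y Y′ d} → Y′ ≡ Y + d [mod M ] → blk e n Y′ ≡ blk e n Y + d [mod M ]
    blocks-cg e zero    c = c
    blocks-cg e (suc n) {Y} {Y′} {d} c = cg-trans (cg-+ˡ (e * D) (drop-τ (blocks-cg (e * ω) n c)))
      (cg-trans (cg-≡ (lem (e * D) (blk (e * ω) n Y) d)) (cg-+ʳ d (cg-+ˡ (e * D) (cg-sym (drop-τ cg-refl)))))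
      where
      lem : ∀ x B d → x + (B + d) ≡ x + B + d
      lem = solve-∀

    -- Inserting t before the second block and t^o after it changes the second block only.
    bump : ∀ e {Y Y′ d} → e * ω ^ 2 ≤ E → Equiv Y Y′ → Y′ ≡ Y + d [mod M ] →
      ∃ λ Z → Equiv (blk e 2 Y) Z × Z ≡ blk e 2 Y + (d + t₋ * (e * ω * D)) [mod M ]
    bump e {Y} {Y′} {d} h eqv c = _ ,
      pump 1 e 2 h (pump o (e * ω) 1 (next-weight e 1 h) eqv) ,
      cg-trans (cg-+ˡ (e * D) (drop-τ (cg-* (cg-≡ (trans (*-identityʳ t) t-eq)) (cg-+ˡ x (drop-τ (cg-refl {t ^ o * Y′}))))))
      (cg-trans (cg-≡ (lem₁ (e * D) t₋ x (t ^ o * Y′)))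
      (cg-trans (cg-+ˡ (e * D + suc t₋ * x) (cg-trans (cg-≡ (trans (cong (_* (t ^ o * Y′)) (sym t-eq)) (sym (*-assoc t (t ^ o) Y′))))
        (cg-trans (cg-* t-order cg-refl) (cg-trans (cg-≡ (*-identityˡ Y′)) c))))
      (cg-trans (cg-≡ (lem₂ (e * D) t₋ x Y d))
        (cg-+ʳ (d + t₋ * x) (cg-+ˡ (e * D) (cg-sym (drop-τ (cg-+ˡ x (drop-τ (cg-refl {Y}))))))))))
      where
      x : ℕ
      x = e * ω * D
      lem₁ : ∀ a t x z → a + suc t * (x + z) ≡ a + suc t * x + suc t * z
      lem₁ = solve-∀
      lem₂ : ∀ a t x y d → a + suc t * x + (y + d) ≡ a + (x + y) + (d + t * x)
      lem₂ = solve-∀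

    -- The weights repeat modulo M after `2 + g` blocks, so each group of that length can be bumped
    -- by the same amount; X of the i groups are.
    reach : ∀ i X e Y → X ≤ i → e * ω ^ (i * (2 + g)) ≤ E → e ≡ e₀ [mod M ] →
      ∃ λ Z → Equiv (blk e (i * (2 + g)) Y) Z × Z ≡ blk e (i * (2 + g)) Y + X * (t₋ * (e₀ * ω * D)) [mod M ]
    reach i zero e Y _ h _ = _ , (λ q → ≈-refl) , cg-≡ (sym (+-identityʳ _))
    reach (suc i) (suc X) e Y (s≤s X≤i) h e≡ = extend (reach i X (e * ω ^ (2 + g)) Y X≤i
        (subst (_≤ E) (trans (cong (e *_) (^-distribˡ-+-* ω (2 + g) (i * (2 + g)))) (sym (*-assoc e (ω ^ (2 + g)) _))) h)
        (cg-trans (cg-* e≡ ω-order) (cg-≡ (*-identityʳ e₀))))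
      where
      h₁ : e * ω ^ (2 + g) ≤ E
      h₁ = ≤-trans (*-monoʳ-≤ e (^-monoʳ-≤ ω {{>-nonZero 1≤ω}} (m≤m+n (2 + g) (i * (2 + g))))) h
      h₂ : e * ω ^ 2 ≤ E
      h₂ = ≤-trans (*-monoʳ-≤ e (^-monoʳ-≤ ω {{>-nonZero 1≤ω}} (m≤m+n 2 g))) h₁
      h₃ : e * ω ^ 2 * ω ^ g ≤ E
      h₃ = subst (_≤ E) (trans (cong (e *_) (^-distribˡ-+-* ω 2 g)) (sym (*-assoc e (ω ^ 2) (ω ^ g)))) h₁
      κ : ℕ
      κ = t₋ * (e₀ * ω * D)
      inner : ℕ
      inner = blk (e * ω ^ 2) g (blk (e * ω ^ (2 + g)) (i * (2 + g)) Y)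
      unfold : blk e (suc i * (2 + g)) Y ≡ blk e 2 inner
      unfold = trans (blocks-+ τ ω D e 2 (g + i * (2 + g)) Y) (cong (blk e 2) (trans (blocks-+ τ ω D (e * ω ^ 2) g (i * (2 + g)) Y)
        (cong (λ z → blk (e * ω ^ 2) g (blk z (i * (2 + g)) Y)) (trans (*-assoc e (ω ^ 2) (ω ^ g)) (cong (e *_) (sym (^-distribˡ-+-* ω 2 g)))))))
      finish : (∃ λ Z → Equiv (blk e 2 inner) Z × Z ≡ blk e 2 inner + (X * κ + t₋ * (e * ω * D)) [mod M ]) →
        ∃ λ Z → Equiv (blk e (suc i * (2 + g)) Y) Z × Z ≡ blk e (suc i * (2 + g)) Y + suc X * κ [mod M ]
      finish (Z , eqv , c) = Z , subst (λ z → Equiv z Z) (sym unfold) eqv ,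
        cg-trans c (cg-+ (cg-≡ (sym unfold)) (cg-trans (cg-+ cg-refl (cg-*ˡ t₋ (cg-* (cg-* e≡ cg-refl) cg-refl))) (cg-≡ (+-comm (X * κ) κ))))
      extend : (∃ λ Z → Equiv (blk (e * ω ^ (2 + g)) (i * (2 + g)) Y) Z × Z ≡ blk (e * ω ^ (2 + g)) (i * (2 + g)) Y + X * κ [mod M ]) →
        ∃ λ Z → Equiv (blk e (suc i * (2 + g)) Y) Z × Z ≡ blk e (suc i * (2 + g)) Y + suc X * κ [mod M ]
      extend (Z , eqv , c) = finish (bump e h₂ (blocks-equiv (e * ω ^ 2) g h₃ eqv) (blocks-cg (e * ω ^ 2) g c))

-- Absorption of large values by v

^-distribʳ-* : ∀ n x y → (x * y) ^ n ≡ x ^ n * y ^ n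
^-distribʳ-* zero    x y = refl
^-distribʳ-* (suc n) x y = trans (cong (x * y *_) (^-distribʳ-* n x y)) (lem x y (x ^ n) (y ^ n))
  where
  lem : ∀ x y a b → x * y * (a * b) ≡ x * a * (y * b)
  lem = solve-∀

-- The sum of the blocks is divisible by V = 1 + T W up to a correction by T τⁿ (Y′ W); it
-- equals the cofactor of V in 1 + T K W as soon as V² divides K - 1 and K is large.
module _ {T W D X n Y′ : ℕ} (TW : T * W ≡ suc D) (blk : ℕ → ℕ)
  (blk-sum : ∀ Y → (2 + D) * blk Y + W ≡ W * (T * T * (W * W)) ^ n + (T * T) ^ n * ((2 + D) * Y))
  (K-eq : 1 + (2 + D) * (2 + D) * X ≡ (T * T) ^ n * ((W * W) ^ n + Y′)) where

  private
    V A : ℕ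
    V = 2 + D
    A = (T * T) ^ n

    W^-eq : (T * T * (W * W)) ^ n ≡ A * (W * W) ^ n
    W^-eq = ^-distribʳ-* n (T * T) (W * W)

    V-eq : V ≡ 1 + T * W
    V-eq = cong suc (sym TW)

    lhs : ∀ Y → V * (1 + T * blk Y) ≡ 1 + T * W * (A * (W * W) ^ n) + T * A * (V * Y)
    lhs Y = begin
      V * (1 + T * blk Y)                              ≡⟨ lem₁ V T (blk Y) ⟩
      V + T * (V * blk Y)                              ≡⟨ cong (_+ T * (V * blk Y)) V-eq ⟩
      1 + T * W + T * (V * blk Y)                      ≡⟨ lem₂ T W (V * blk Y) ⟩
      1 + T * (V * blk Y + W)                          ≡⟨ cong (λ z → 1 + T * z) (trans (blk-sum Y) (cong (λ z → W * z + A * (V * Y)) W^-eq)) ⟩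
      1 + T * (W * (A * (W * W) ^ n) + A * (V * Y))    ≡⟨ lem₃ T W (A * (W * W) ^ n) A (V * Y) ⟩
      1 + T * W * (A * (W * W) ^ n) + T * A * (V * Y)  ∎
      where
      open ≡-Reasoning
      lem₁ : ∀ V T B → V * (1 + T * B) ≡ V + T * (V * B)
      lem₁ = solve-∀
      lem₂ : ∀ T W B → 1 + T * W + T * B ≡ 1 + T * (B + W)
      lem₂ = solve-∀
      lem₃ : ∀ T W z A y → 1 + T * (W * z + A * y) ≡ 1 + T * W * z + T * A * y
      lem₃ = solve-∀

    rhs : V * (1 + T * W * (V * X)) ≡ 1 + T * W * (A * (W * W) ^ n) + T * A * (Y′ * W)
    rhs = begin
      V * (1 + T * W * (V * X))                      ≡⟨ lem₁ V (T * W) X ⟩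
      V + T * W * (V * V * X)                        ≡⟨ cong (_+ T * W * (V * V * X)) V-eq ⟩
      1 + T * W + T * W * (V * V * X)                ≡⟨ lem₂ (T * W) (V * V * X) ⟩
      1 + T * W * (1 + V * V * X)                    ≡⟨ cong (λ z → 1 + T * W * z) K-eq ⟩
      1 + T * W * (A * ((W * W) ^ n + Y′))           ≡⟨ lem₃ T W A ((W * W) ^ n) Y′ ⟩
      1 + T * W * (A * (W * W) ^ n) + T * A * (Y′ * W) ∎
      where
      open ≡-Reasoning
      lem₁ : ∀ V z X → V * (1 + z * (V * X)) ≡ V + z * (V * V * X)
      lem₁ = solve-∀
      lem₂ : ∀ z y → 1 + z + z * y ≡ 1 + z * (1 + y)
      lem₂ = solve-∀
      lem₃ : ∀ T W A z y → 1 + T * W * (A * (z + y)) ≡ 1 + T * W * (A * z) + T * A * (y * W)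
      lem₃ = solve-∀

    V⊥T : Coprime V T
    V⊥T = Cop.sym (cg-1⇒coprime (cg-trans (cg-≡ V-eq) (cg-+multiple 1 W)))

    V⊥TA : Coprime V (T * A)
    V⊥TA = coprime-*ʳ V⊥T (coprime-^ʳ n (coprime-*ʳ V⊥T V⊥T))

    -- With `Y = 0`, `lhs` exhibits V as a divisor of the terms it shares with `rhs`; what remains
    -- is `T * A * (Y′ * W)`, and `T * A` is prime to V.
    V∣Y′W : V ∣ Y′ * W
    V∣Y′W = coprime-divisor V⊥TA (∣m+n∣m⇒∣n {m = 1 + T * W * (A * (W * W) ^ n)} (subst (V ∣_) rhs (m∣m*n (1 + T * W * (V * X)))) (subst (V ∣_) eq₀ (m∣m*n (1 + T * blk 0))))
      where
      eq₀ : V * (1 + T * blk 0) ≡ 1 + T * W * (A * (W * W) ^ n)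
      eq₀ = trans (lhs 0) (trans (cong (λ z → 1 + T * W * (A * (W * W) ^ n) + T * A * z) (*-zeroʳ V)) (trans (cong (1 + T * W * (A * (W * W) ^ n) +_) (*-zeroʳ (T * A))) (+-identityʳ _)))

  blocks-cofactor : ∃ λ ρ → 1 + T * blk ρ ≡ 1 + T * W * (V * X)
  blocks-cofactor = quotient V∣Y′W , *-cancelˡ-≡ _ _ V (trans (lhs _)
    (trans (cong (λ z → 1 + T * W * (A * (W * W) ^ n) + T * A * z) (sym (m∣n⇒n≡m*quotient V∣Y′W))) (sym rhs)))

-- The cofactor is ≡ 1 modulo Q; this is what working modulo `Q * Q` buys.
exact-divisor : ∀ Q N → 1 ≤ Q → N ≡ Q [mod Q * Q ] → ∃ λ μ → N ≡ Q * μ × Coprime Q μ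
exact-divisor Q N 1≤Q c = from (cg-∣ (m∣m*n Q) (cg-sym c) ∣-refl)
  where
  from : Q ∣ N → ∃ λ μ → N ≡ Q * μ × Coprime Q μ
  from (divides μ e) = μ , trans e (*-comm μ Q) ,
    cg-1⇒coprime (cg-*-cancel-modulus Q 1≤Q (cg-trans (cg-≡ (trans (*-comm Q μ) (sym e))) (cg-trans c (cg-≡ (sym (*-identityʳ Q))))))

module Absorption {c ℓ} (CM : CommutativeMonoid c ℓ)
  {b : ℕ} {u : ℕ → CommutativeMonoid.Carrier CM} (2≤b : 2 ≤ b) (machine : Machine (CommutativeMonoid._≈_ CM) b u)
  (mult : CoprimeMultiplicative CM u)
  {v : CommutativeMonoid.Carrier CM} (generic : GenericAbsorbed CM u b v)
  where

  open CommutativeMonoid CM renaming (refl to ≈-refl; sym to ≈-sym; trans to ≈-trans; reflexive to ≈-reflexive)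
  open Digits isEquivalence 2≤b machine
  open Machine machine
  open Support CM 2≤b machine

  private instance
    b≢0 : NonZero b
    b≢0 = >-nonZero 1≤b

  private
    Absorbed : ℕ → Set (c ⊔ ℓ)
    Absorbed = AbsorbedBy CM u v

  -- The digit 1 is followed by `size ! * i - 1` zeros, which are at least `size` once i exceeds
  -- `size`.
  pump-after-one : ∀ W i → suc size ≤ i → u (1 + t ^ i * W) ≈ u (1 + t ^ suc size * W)
  pump-after-one W i s<i = go (m≤n⇒∃[o]m+o≡n s<i) (m≤n⇒∃[o]m+o≡n {1 + size} {size ! * suc size} (m≤n*m (suc size) (size !) {{>-nonZero (1≤n! size)}}))
    where
    go : (∃ λ j → suc size + j ≡ i) → (∃ λ k → suc size + k ≡ size ! * suc size) → u (1 + t ^ i * W) ≈ u (1 + t ^ suc size * W)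
    go (j , refl) (k , k-eq) = ≈-trans (≈-reflexive (cong (λ z → u (1 + z)) eq₁))
      (≈-trans (start-correct 1 1 (subst (1 <_) (sym (*-identityʳ b)) 2≤b) _)
      (≈-trans (zeros-pump (read start 1 1) (size + k) j W (m≤m+n size k))
      (≈-trans (≈-sym (start-correct 1 1 (subst (1 <_) (sym (*-identityʳ b)) 2≤b) _)) (≈-reflexive (cong (λ z → u (1 + z)) (sym eq₂))))))
      where
      eq₂ : t ^ suc size * W ≡ b ^ 1 * (b ^ (size + k) * W)
      eq₂ = trans (cong (_* W) (trans (t^ (suc size)) (cong (b ^_) (sym k-eq)))) (^-+-* 1 (size + k) W)
      eq₁ : t ^ (suc size + j) * W ≡ b ^ 1 * (b ^ (size + k + size ! * j) * W)
      eq₁ = trans (cong (_* W) (trans (t^ (suc size + j)) (cong (b ^_) (trans (*-distribˡ-+ (size !) (suc size) j) (cong (_+ size ! * j) (sym k-eq)))))) (^-+-* 1 (size + k + size ! * j) W)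

  -- The number is pumped to be ≡ Q modulo Q², so that Q becomes an exact divisor of it.
  blocks-absorbed : ∀ Q W₋ t₋ o g a T D ε ρ n E → 1 ≤ Q → Absorbed Q → t ≡ suc t₋ → t ^ suc o ≡ 1 [mod Q * Q ] →
    T ≡ t ^ a → 1 ≤ a → T ≡ 1 [mod Q * Q ] → T * suc W₋ ≡ suc D → T * T ≡ b ^ (ε + size) →
    n ≡ Q * Q * (2 + g) → E ≡ suc W₋ * (suc W₋ * suc W₋) ^ n → E * D < b ^ ε →
    (suc W₋ * suc W₋) ^ (2 + g) ≡ 1 [mod Q * Q ] →
    Coprime Q (suc W₋) → Coprime Q W₋ → Coprime Q t₋ →
    Absorbed (1 + T * blocks (T * T) (suc W₋ * suc W₋) D (suc W₋) n ρ)
  blocks-absorbed Q W₋ t₋ o g a T D ε ρ n E 1≤Q (κ , Q-abs) t-eq t-order T-eq 1≤a T≡1 TW ττ refl refl E-fits ω-order Q⊥W Q⊥W₋ Q⊥t₋ =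
    pick (linear-congruence κ₀ M (*-mono-≤ 1≤Q 1≤Q) (Cop.sym (coprime-*ʳ (Cop.sym Q⊥κ₀) (Cop.sym Q⊥κ₀))) (1 + Y) Q)
    where
    W ω M κ₀ Y : ℕ
    W = suc W₋
    ω = W * W
    M = Q * Q
    κ₀ = t₋ * (W * ω * D)
    Y = blocks (T * T) ω D W n ρ
    open Residues (T * T) ω D ε E M o g t₋ W ττ (s≤s z≤n) E-fits (cg-trans (cg-* T≡1 T≡1) cg-refl) t-order t-eq ω-order
    -- The increment κ₀ has to be invertible and contains `D = T * W - 1 ≡ W - 1`; hence the demand
    -- that Q be prime to `W₋`.
    D≡ : D ≡ W₋ [mod Q ]
    D≡ = cg-+-cancelˡ 1 (cg-trans (cg-≡ (sym TW)) (cg-trans (cg-* (cg-weaken (m∣m*n Q) T≡1) cg-refl) (cg-≡ (*-identityˡ W))))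
    Q⊥D : Coprime Q D
    Q⊥D = cg-coprime (cg-sym D≡) Q⊥W₋
    Q⊥κ₀ : Coprime Q κ₀
    Q⊥κ₀ = coprime-*ʳ Q⊥t₋ (coprime-*ʳ (coprime-*ʳ Q⊥W (coprime-*ʳ Q⊥W Q⊥W)) Q⊥D)
    b^a : T ≡ b ^ (size ! * a)
    b^a = trans T-eq (t^ a)
    1<b^a : 1 < b ^ (size ! * a)
    1<b^a = ≤-trans 2≤b (≤-trans (≤-reflexive (sym (^-identityʳ b))) (^-monoʳ-≤ b (*-mono-≤ (1≤n! size) 1≤a)))
    use : ∀ X → 1 + Y + κ₀ * X ≡ Q [mod M ] → (∃ λ Z → Equiv Y Z × Z ≡ Y + X * κ₀ [mod M ]) → Absorbed (1 + T * Y)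
    use X solved (Z , eqv , c) = split (exact-divisor Q (1 + T * Z) 1≤Q hit)
      where
      lem : ∀ Y X κ → 1 + (Y + X * κ) ≡ 1 + Y + κ * X
      lem = solve-∀
      hit : 1 + T * Z ≡ Q [mod M ]
      hit = cg-trans (cg-+ˡ 1 (cg-trans (cg-* T≡1 c) (cg-≡ (*-identityˡ _)))) (cg-trans (cg-≡ (lem Y X κ₀)) solved)
      change : u (1 + T * Y) ≈ u (1 + T * Z)
      change = ≈-trans (≈-reflexive (cong (λ z → u (1 + z * Y)) b^a)) (≈-trans (start-correct (size ! * a) 1 1<b^a Y)
        (≈-trans (eqv _) (≈-trans (≈-sym (start-correct (size ! * a) 1 1<b^a Z)) (≈-reflexive (cong (λ z → u (1 + z * Z)) (sym b^a))))))
      split : (∃ λ μ → 1 + T * Z ≡ Q * μ × Coprime Q μ) → Absorbed (1 + T * Y)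
      split (zero , e , _) with () ← trans e (*-zeroʳ Q)
      split (μ@(suc _) , e , Q⊥μ) = u μ ∙ κ , ≈-trans change (≈-trans (≈-reflexive (cong u e)) (≈-trans (mult Q μ 1≤Q (s≤s z≤n) Q⊥μ)
        (≈-trans (∙-congʳ Q-abs) (≈-trans (comm (κ ∙ v) (u μ)) (≈-sym (assoc (u μ) κ v))))))
    pick : (∃ λ X → X < M × 1 + Y + κ₀ * X ≡ Q [mod M ]) → Absorbed (1 + T * Y)
    pick (X , X<M , solved) = use X solved (reach M X W ρ (<⇒≤ X<M) ≤-refl cg-refl)

  private
    powers-large : ∀ {x} i → 2 ≤ x → i ≤ x ^ i
    powers-large i 2≤x = <⇒≤ (n<b^n i 2≤x)

  -- V = 1 + T W divides 1 + T tᵏ W exactly, with cofactor 1 + T Y for a sum of blocks Y.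
  one-plus-absorbed : ∀ Q W₋ t₋ o φ → 1 ≤ Q → Absorbed Q → t ≡ suc t₋ → t ^ suc o ≡ 1 [mod Q * Q ] →
    (suc W₋) ^ suc φ ≡ 1 [mod Q * Q ] → Coprime Q (suc W₋) → Coprime Q W₋ → Coprime Q t₋ →
    Absorbed (1 + t ^ suc size * suc W₋)
  one-plus-absorbed Q W₋ t₋ o φ 1≤Q Q-abs t-eq t-order W-order Q⊥W Q⊥W₋ Q⊥t₋ =
    build refl refl refl (m≤n⇒∃[o]m+o≡n size≤) (m≤n⇒∃[o]m+o≡n 1≤TW)
    where
    W ω M g : ℕ
    W = suc W₋
    ω = W * W
    M = Q * Q
    g = φ * 2
    ω-order : ω ^ (2 + g) ≡ 1 [mod M ]
    ω-order = cg-trans (cg-≡ (sym (^-*-assoc ω (suc φ) 2)))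
      (cg-1^ 2 (cg-trans (cg-≡ (^-distribʳ-* (suc φ) W W)) (cg-* W-order W-order)))
    n E a : ℕ
    -- M groups of blocks realise every multiple X < M of the increment; E is the weight reached
    -- after all n blocks.
    n = M * (2 + g)
    E = W * ω ^ n
    -- The factor `suc o` makes `T ≡ 1`, and the other one makes `t ^ a` at least
    -- `E * W * b ^ size`, so that even the heaviest block leaves `size` zeros before the next.
    a = suc o * (suc size + E * W * b ^ size)
    size<a : suc size ≤ a
    size<a = ≤-trans (m≤m+n (suc size) _) (m≤n*m _ (suc o))
    E≤a : E * W * b ^ size ≤ a
    E≤a = ≤-trans (m≤n+m _ (suc size)) (m≤n*m _ (suc o))
    size≤ : size ≤ size ! * a + size ! * a
    size≤ = ≤-trans (≤-trans (n≤1+n size) size<a) (≤-trans (m≤n*m a (size !) {{>-nonZero (1≤n! size)}}) (m≤m+n _ _))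
    1≤TW : 1 ≤ t ^ a * W
    1≤TW = *-mono-≤ (1≤b^ a 1≤t) (s≤s (z≤n {W₋}))
    build : ∀ {E′ a′ T} → E′ ≡ E → a′ ≡ a → T ≡ t ^ a′ → (∃ λ ε → size + ε ≡ size ! * a + size ! * a) → (∃ λ D → 1 + D ≡ t ^ a * W) →
      Absorbed (1 + t ^ suc size * W)
    build {E′} {a′} {T} E-eq a-eq T-eq (ε , ε-eq) (D , D-eq) =
      with-order (order t (V * V) (s≤s z≤n) (Cop.sym (coprime-*ʳ t⊥V t⊥V)))
      where
      V : ℕ
      V = 2 + D
      T-eq′ : T ≡ t ^ a
      T-eq′ = trans T-eq (cong (t ^_) a-eq)
      TW : T * W ≡ suc D
      TW = trans (cong (_* W) T-eq′) (sym D-eq)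
      T≡1 : T ≡ 1 [mod M ]
      T≡1 = cg-trans (cg-≡ (trans T-eq′ (sym (^-*-assoc t (suc o) (suc size + E * W * b ^ size))))) (cg-1^ (suc size + E * W * b ^ size) t-order)
      ττ : T * T ≡ b ^ (ε + size)
      ττ = trans (cong₂ _*_ T-eq′ T-eq′) (trans (cong₂ _*_ (t^ a) (t^ a)) (trans (sym (^-distribˡ-+-* b (size ! * a) (size ! * a)))
             (cong (b ^_) (trans (sym ε-eq) (+-comm size ε)))))
      1≤a′ : 1 ≤ a′
      1≤a′ = subst (1 ≤_) (sym a-eq) (≤-trans (s≤s z≤n) size<a)
      t⊥V : Coprime t V
      t⊥V = coprime-∣ˡ (subst (t ∣_) (sym T-eq) (base∣power t 1≤a′)) (cg-1⇒coprime (cg-trans (cg-≡ (cong suc (sym TW))) (cg-+multiple 1 W)))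
      lem-fit : ∀ E W B T → E * (T * W) * B ≡ E * W * B * T
      lem-fit = solve-∀
      E-fits : E′ * D < b ^ ε
      E-fits = *-cancelʳ-< (b ^ size) (E′ * D) (b ^ ε) (begin-strict
        E′ * D * b ^ size            ≡⟨ cong (λ z → z * D * b ^ size) E-eq ⟩
        E * D * b ^ size             <⟨ *-monoˡ-< (b ^ size) {{>-nonZero (1≤b^ size 1≤b)}} (*-monoʳ-< E {{>-nonZero 1≤E}} (n<1+n D)) ⟩
        E * suc D * b ^ size         ≡⟨ cong (λ z → E * z * b ^ size) (sym TW) ⟩
        E * (T * W) * b ^ size       ≡⟨ lem-fit E W (b ^ size) T ⟩
        E * W * b ^ size * T         ≤⟨ *-monoˡ-≤ T (≤-trans E≤a (≤-trans (powers-large a 2≤t) (≤-reflexive (sym T-eq′)))) ⟩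
        T * T                        ≡⟨ ττ ⟩
        b ^ (ε + size)               ≡⟨ ^-distribˡ-+-* b ε size ⟩
        b ^ ε * b ^ size             ∎)
        where
        open ≤-Reasoning
        1≤E : 1 ≤ E
        1≤E = *-mono-≤ (s≤s (z≤n {W₋})) (1≤b^ n (s≤s z≤n))
      with-order : (∃ λ N → 1 ≤ N × t ^ N ≡ 1 [mod V * V ]) → Absorbed (1 + t ^ suc size * W)
      with-order (N , 1≤N , ord) = with-factor (cg-split K≡1 (1≤b^ k 1≤t)) (m≤n⇒∃[o]m+o≡n ω≤)
        where
        r k : ℕ
        -- k is a multiple of N, so `t ^ k` is 1 modulo `V * V`. Splitting off `(T * T) ^ n` leaves
        -- `t ^ r`, which must be at least `ω ^ n` for Y′ to exist.
        r = (N * ((a + a) * n + ω ^ n)) ∸ (a + a) * n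
        k = N * ((a + a) * n + ω ^ n)
        long : (a + a) * n + ω ^ n ≤ k
        long = m≤n*m _ N {{>-nonZero 1≤N}}
        k-eq : (a + a) * n + r ≡ k
        k-eq = m+[n∸m]≡n (≤-trans (m≤m+n _ (ω ^ n)) long)
        ω≤ : ω ^ n ≤ t ^ r
        ω≤ = ≤-trans (+-cancelˡ-≤ ((a + a) * n) (ω ^ n) r (subst ((a + a) * n + ω ^ n ≤_) (sym k-eq) long)) (powers-large r 2≤t)
        K≡1 : t ^ k ≡ 1 [mod V * V ]
        K≡1 = cg-trans (cg-≡ (sym (^-*-assoc t N _))) (cg-1^ ((a + a) * n + ω ^ n) ord)
        K-split : t ^ k ≡ (T * T) ^ n * t ^ r
        K-split = trans (cong (t ^_) (sym k-eq)) (trans (^-distribˡ-+-* t ((a + a) * n) r) (cong (_* t ^ r)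
          (trans (sym (^-*-assoc t (a + a) n)) (cong (_^ n) (trans (^-distribˡ-+-* t a a) (cong₂ _*_ (sym T-eq′) (sym T-eq′)))))))
        with-factor : (∃ λ X → t ^ k ≡ 1 + V * V * X) → (∃ λ Y′ → ω ^ n + Y′ ≡ t ^ r) → Absorbed (1 + t ^ suc size * W)
        with-factor (X , X-eq) (Y′ , Y′-eq) = conclude (blocks-cofactor {T} {W} {D} {X} {n} {Y′} TW (blocks (T * T) ω D W n)
            (λ Y → blocks-sum (T * T) ω D W n Y ττω)
            (trans (sym X-eq) (trans K-split (cong ((T * T) ^ n *_) (sym Y′-eq)))))
          where
          lem-τω : ∀ T W → T * T * (W * W) ≡ (T * W) * (T * W)
          lem-τω = solve-∀
          ττω : T * T * ω ≡ suc D * suc D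
          ττω = trans (lem-τω T W) (cong₂ _*_ TW TW)
          m′ : ℕ
          m′ = 1 + T * W * (V * X)
          lem-V : ∀ V z X → (1 + z) * (1 + z * (V * X)) ≡ 1 + z * (1 + V * (1 + z) * X)
          lem-V = solve-∀
          V-product : V * m′ ≡ 1 + t ^ (a + k) * W
          V-product = begin
            V * m′                                              ≡⟨ cong (_* m′) (cong suc (sym TW)) ⟩
            (1 + T * W) * (1 + T * W * (V * X))                 ≡⟨ lem-V V (T * W) X ⟩
            1 + T * W * (1 + V * (1 + T * W) * X)               ≡⟨ cong (λ z → 1 + T * W * (1 + V * z * X)) (cong suc TW) ⟩
            1 + T * W * (1 + V * V * X)                         ≡⟨ cong (λ z → 1 + T * W * z) (sym X-eq) ⟩
            1 + T * W * t ^ k                                   ≡⟨ cong suc (lem₂ T W (t ^ k)) ⟩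
            1 + T * t ^ k * W                                   ≡⟨ cong (λ z → 1 + z * t ^ k * W) T-eq′ ⟩
            1 + t ^ a * t ^ k * W                               ≡⟨ cong (λ z → 1 + z * W) (sym (^-distribˡ-+-* t a k)) ⟩
            1 + t ^ (a + k) * W                                 ∎
            where
            open ≡-Reasoning
            lem₂ : ∀ T W K → T * W * K ≡ T * K * W
            lem₂ = solve-∀
          V⊥m′ : Coprime V m′
          V⊥m′ = cg-1⇒coprime (cg-trans (cg-≡ (lem₃ (T * W) V X)) (cg-+multiple 1 (T * W * X)))
            where
            lem₃ : ∀ z V X → 1 + z * (V * X) ≡ 1 + V * (z * X)
            lem₃ = solve-∀
          factored : u (1 + t ^ suc size * W) ≈ u V ∙ u m′
          factored = ≈-trans (≈-sym (pump-after-one W (a + k) (≤-trans size<a (m≤m+n a k))))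
            (≈-trans (≈-reflexive (cong u (sym V-product))) (mult V m′ (s≤s z≤n) (s≤s z≤n) V⊥m′))
          conclude : (∃ λ ρ → 1 + T * blocks (T * T) ω D W n ρ ≡ m′) → Absorbed (1 + t ^ suc size * W)
          conclude (ρ , ρ-eq) = collect (blocks-absorbed Q W₋ t₋ o g a′ T D ε ρ n E′ 1≤Q Q-abs t-eq t-order T-eq 1≤a′ T≡1 TW ττ refl E-eq E-fits
              ω-order Q⊥W Q⊥W₋ Q⊥t₋)
            where
            collect : Absorbed (1 + T * blocks (T * T) ω D W n ρ) → Absorbed (1 + t ^ suc size * W)
            collect (κ , abs) = u V ∙ κ , ≈-trans factored (≈-trans (∙-congˡ (≈-trans (≈-reflexive (cong u (sym ρ-eq))) abs)) (≈-sym (assoc (u V) κ v)))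

  opaque
    -- R makes Q prime to b, W, W - 1 and t - 1: the orders then exist and the increment is
    -- invertible. `2 ≤ W` keeps R positive.
    absorbed-after-zeros : ∀ W → 2 ≤ W → Absorbed (1 + t ^ suc size * W)
    absorbed-after-zeros (suc zero) (s≤s ())
    absorbed-after-zeros (suc (suc W₋₋)) _ with t₋₋ , t-eq ← m≤n⇒∃[o]m+o≡n 2≤t = choose (generic R (*-mono-≤ 1≤b (s≤s z≤n)) (m∣m*n _))
      where
      W₋ t₋ R : ℕ
      W₋ = suc W₋₋
      t₋ = suc t₋₋
      R = b * (suc W₋ * (W₋ * t₋))
      choose : (∃ λ Q → 1 ≤ Q × Q ≡ 1 [mod R ] × Absorbed Q) → Absorbed (1 + t ^ suc size * suc W₋)
      choose (Q , 1≤Q , Q≡1 , Q-abs) = orders (order t M 1≤M (coprime-^ʳ (size !) (M⊥ (⊥-of (m∣m*n _)))))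
          (order (suc W₋) M 1≤M (M⊥ Q⊥W))
        where
        M : ℕ
        M = Q * Q
        1≤M : 1 ≤ M
        1≤M = *-mono-≤ 1≤Q 1≤Q
        ⊥-of : ∀ {d} → d ∣ R → Coprime Q d
        ⊥-of d∣R = coprime-∣ʳ d∣R (Cop.sym (cg-1⇒coprime Q≡1))
        M⊥ : ∀ {d} → Coprime Q d → Coprime M d
        M⊥ c = Cop.sym (coprime-*ʳ (Cop.sym c) (Cop.sym c))
        Q⊥W : Coprime Q (suc W₋)
        Q⊥W = ⊥-of (∣n⇒∣m*n b (m∣m*n (W₋ * t₋)))
        orders : (∃ λ N → 1 ≤ N × t ^ N ≡ 1 [mod M ]) → (∃ λ N → 1 ≤ N × suc W₋ ^ N ≡ 1 [mod M ]) → Absorbed (1 + t ^ suc size * suc W₋)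
        orders (suc o , _ , t-ord) (suc φ , _ , W-ord) = one-plus-absorbed Q W₋ t₋ o φ 1≤Q Q-abs (sym t-eq) t-ord W-ord
          Q⊥W (⊥-of (∣n⇒∣m*n b (∣n⇒∣m*n (suc W₋) (m∣m*n t₋)))) (⊥-of (∣n⇒∣m*n b (∣n⇒∣m*n (suc W₋) (n∣m*n W₋))))

  -- The numbers z i arise by pumping a loop with value mid and length l; here bˡ = 1 + E.
  module Loop (k l low mid high E : ℕ) (β-eq : b ^ l ≡ suc E) where

    tail : ℕ → ℕ
    tail zero    = high
    tail (suc i) = mid + b ^ l * tail i

    z : ℕ → ℕ
    z i = low + b ^ k * tail i

    Δ : ℕ
    Δ = mid + E * high

    -- The geometric sum of the repeated digits, multiplied by `E = b ^ l - 1` to avoid division.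
    tail-closed : ∀ i → E * tail i + mid ≡ (b ^ l) ^ i * Δ
    tail-closed zero = lem mid E high
      where
      lem : ∀ mid E high → E * high + mid ≡ 1 * (mid + E * high)
      lem = solve-∀
    tail-closed (suc i) = begin
      E * (mid + b ^ l * tail i) + mid       ≡⟨ cong (λ x → E * (mid + x * tail i) + mid) β-eq ⟩
      E * (mid + suc E * tail i) + mid       ≡⟨ lem E mid (tail i) ⟩
      suc E * (E * tail i + mid)             ≡⟨ cong₂ _*_ (sym β-eq) (tail-closed i) ⟩
      b ^ l * ((b ^ l) ^ i * Δ)           ≡⟨ sym (*-assoc (b ^ l) ((b ^ l) ^ i) Δ) ⟩
      b ^ l * (b ^ l) ^ i * Δ             ∎
      where
      open ≡-Reasoning
      lem : ∀ E mid tail → E * (mid + suc E * tail) + mid ≡ suc E * (E * tail + mid)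
      lem = solve-∀

    z-shift : ∀ i j x → 1 ≤ E → (b ^ l) ^ j ≡ 1 + E * x → z (i + j) ≡ z i + b ^ k * (b ^ l) ^ i * Δ * x
    z-shift i j x 1≤E e = trans (cong (λ y → low + b ^ k * y) tail-shift) (lem₂ low (b ^ k) (tail i) ((b ^ l) ^ i) Δ x)
      where
      open ≡-Reasoning
      lem₁ : ∀ c D E x → c * (1 + E * x) * D ≡ c * D + E * (c * D * x)
      lem₁ = solve-∀
      lem₂ : ∀ low B tail c D x → low + B * (tail + c * D * x) ≡ low + B * tail + B * c * D * x
      lem₂ = solve-∀
      lem₃ : ∀ E tail mid y → E * tail + mid + E * y ≡ E * (tail + y) + mid
      lem₃ = solve-∀
      tail-shift : tail (i + j) ≡ tail i + (b ^ l) ^ i * Δ * x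
      tail-shift = *-cancelˡ-≡ _ _ E {{>-nonZero 1≤E}} (+-cancelʳ-≡ mid _ _ (begin
        E * tail (i + j) + mid                                    ≡⟨ tail-closed (i + j) ⟩
        (b ^ l) ^ (i + j) * Δ                                  ≡⟨ cong (_* Δ) (^-distribˡ-+-* (b ^ l) i j) ⟩
        (b ^ l) ^ i * (b ^ l) ^ j * Δ                          ≡⟨ cong (λ y → (b ^ l) ^ i * y * Δ) e ⟩
        (b ^ l) ^ i * (1 + E * x) * Δ                          ≡⟨ lem₁ ((b ^ l) ^ i) Δ E x ⟩
        (b ^ l) ^ i * Δ + E * ((b ^ l) ^ i * Δ * x)            ≡⟨ cong (_+ E * ((b ^ l) ^ i * Δ * x)) (sym (tail-closed i)) ⟩
        E * tail i + mid + E * ((b ^ l) ^ i * Δ * x)              ≡⟨ lem₃ E (tail i) mid ((b ^ l) ^ i * Δ * x) ⟩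
        E * (tail i + (b ^ l) ^ i * Δ * x) + mid                  ∎))

    -- `E * z i + b ^ k * mid` equals `E * low + b ^ k * (b ^ l) ^ i * Δ`, so a common divisor g
    -- satisfies a congruence free of i. Where its two sides differ, this bounds g uniformly in i.
    b-part-bounded : ∀ i g → g ∣ z i → g ∣ b ^ k * (b ^ l) ^ i → b ^ k * mid ≡ E * low [mod g ]
    b-part-bounded i g g∣z g∣b = cg-trans (cg-trans (cg-+ (cg-sym (∣⇒cg-0 (∣n⇒∣m*n E g∣z))) (cg-refl {b ^ k * mid}))
      (cg-≡ (trans (lem₁ E low (b ^ k) (tail i) mid) (cong (λ y → E * low + b ^ k * y) (tail-closed i)))))
      (cg-trans (cg-+ˡ (E * low) (∣⇒cg-0 (subst (g ∣_) (*-assoc (b ^ k) ((b ^ l) ^ i) Δ) (∣m⇒∣m*n Δ g∣b)))) (cg-≡ (+-identityʳ _)))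
      where
      lem₁ : ∀ E low B tail mid → E * (low + B * tail) + B * mid ≡ E * low + B * (E * tail + mid)
      lem₁ = solve-∀

    module _ (loop : ∀ n → u (low + b ^ k * (mid + b ^ l * n)) ≈ u (low + b ^ k * n)) (1≤high : 1 ≤ high) (1≤k : 1 ≤ k) (1≤l : 1 ≤ l)
      (1≤E : 1 ≤ E) {F : ℕ} (1≤F : 1 ≤ F) (F-multiple : ∀ g → b ^ k * mid ≡ E * low [mod g ] → g ∣ F) where

      u-z : ∀ i → u (z i) ≈ u (z 0)
      u-z zero    = ≈-refl
      u-z (suc i) = ≈-trans (loop (tail i)) (u-z i)

      1≤tail : ∀ i → 1 ≤ tail i
      1≤tail zero    = 1≤high
      1≤tail (suc i) = ≤-trans (*-mono-≤ (1≤b^ l 1≤b) (1≤tail i)) (m≤n+m _ mid)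

      2≤z : ∀ i → 2 ≤ z i
      2≤z i = ≤-trans (*-mono-≤ 2≤b^k (1≤tail i)) (m≤n+m _ low)
        where
        2≤b^k : 2 ≤ b ^ k
        2≤b^k = ≤-trans 2≤b (≤-trans (≤-reflexive (sym (^-identityʳ b))) (^-monoʳ-≤ b 1≤k))

      private
        K₀ i₀ : ℕ
        -- Powers of b set aside in `i₀`: 2 F for the square of g, as g divides `b ^ F`, and `K₀`
        -- for the factor `t ^ suc size`.
        K₀ = size ! * suc size
        i₀ = F + F + suc K₀

        exponent : b ^ k * (b ^ l) ^ i₀ ≡ b ^ (k + l * i₀)
        exponent = trans (cong (b ^ k *_) (^-*-assoc b l i₀)) (sym (^-distribˡ-+-* b k (l * i₀)))

        i₀≤ : i₀ ≤ k + l * i₀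
        i₀≤ = ≤-trans (m≤n*m i₀ l {{>-nonZero 1≤l}}) (m≤n+m _ k)

        bounded : ∀ g → g ∣ z i₀ → g ∣ b ^ suc F → g ≤ F
        bounded g g∣z g∣b = ∣⇒≤ {{>-nonZero 1≤F}} (F-multiple g (b-part-bounded i₀ g g∣z
          (∣-trans g∣b (subst (b ^ suc F ∣_) (sym exponent) (power∣power b (≤-trans sucF≤ i₀≤))))))
          where
          power∣power : ∀ c {m n} → m ≤ n → c ^ m ∣ c ^ n
          power∣power c {m} m≤n with x , refl ← m≤n⇒∃[o]m+o≡n m≤n = subst (c ^ m ∣_) (sym (^-distribˡ-+-* c m x)) (m∣m*n (c ^ x))
          sucF≤ : suc F ≤ i₀
          sucF≤ = ≤-trans (s≤s (m≤m+n F (F + K₀))) (≤-reflexive (lem F K₀))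
            where
            lem : ∀ F K → suc (F + (F + K)) ≡ F + F + suc K
            lem = solve-∀

        -- `z (i₀ + j)` and `z i₀` differ by a multiple of the square of `z i₀ = g * y`: the choice
        -- of j supplies y², the power of b supplies g². So the quotient is 1 plus a multiple of
        -- `z i₀`, hence prime to it.
        factor : (∃₂ λ g y → ∃ λ g′ → z i₀ ≡ g * y × Coprime y b × b ^ F ≡ g * g′) → ∃ λ W → 2 ≤ W × u (z 0) ≈ u (z 0) ∙ u (1 + t ^ suc size * W)
        factor (g , y , g′ , z-eq , y⊥b , F-eq) = with-order (order (b ^ l) (E * (y * y)) (*-mono-≤ 1≤E (*-mono-≤ 1≤y 1≤y))
            (coprime-^ʳ l (Cop.sym (coprime-*ʳ b⊥E (coprime-*ʳ (Cop.sym y⊥b) (Cop.sym y⊥b))))))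
          where
          positive : ∀ m n {x} → 1 ≤ x → x ≡ m * n → 1 ≤ m × 1 ≤ n
          positive zero    n       1≤x refl = ⊥-elim (<-irrefl refl 1≤x)
          positive (suc m) zero    1≤x e    = ⊥-elim (<-irrefl (sym (trans e (*-zeroʳ (suc m)))) 1≤x)
          positive (suc m) (suc n) _   _    = s≤s z≤n , s≤s z≤n
          1≤y : 1 ≤ y
          1≤y = proj₂ (positive g y (≤-trans (s≤s z≤n) (2≤z i₀)) z-eq)
          1≤g′ : 1 ≤ g′
          1≤g′ = proj₂ (positive g g′ (1≤b^ F 1≤b) F-eq)
          b⊥E : Coprime b E
          b⊥E (d∣b , d∣E) = ∣1⇒≡1 (∣m+n∣m⇒∣n (subst (_ ∣_) (trans β-eq (+-comm 1 E)) (∣-trans d∣b (base∣power b 1≤l))) d∣E)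
          with-order : (∃ λ j → 1 ≤ j × (b ^ l) ^ j ≡ 1 [mod E * (y * y) ]) → ∃ λ W → 2 ≤ W × u (z 0) ≈ u (z 0) ∙ u (1 + t ^ suc size * W)
          with-order (j , 1≤j , ord) = finish (cg-split ord (1≤b^ j (1≤b^ l 1≤b))) (m≤n⇒∃[o]m+o≡n exp≤)
            where
            exp≤ : F + F + K₀ ≤ k + l * i₀
            exp≤ = ≤-trans (+-monoʳ-≤ (F + F) (n≤1+n K₀)) i₀≤
            finish : (∃ λ x → (b ^ l) ^ j ≡ 1 + E * (y * y) * x) → (∃ λ K₁ → F + F + K₀ + K₁ ≡ k + l * i₀) →
              ∃ λ W → 2 ≤ W × u (z 0) ≈ u (z 0) ∙ u (1 + t ^ suc size * W)
            finish (zero , x-eq) _ = ⊥-elim (<-irrefl (sym (trans x-eq (cong suc (*-zeroʳ (E * (y * y)))))) 2≤β^j)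
              where
              2≤β^j : 2 ≤ (b ^ l) ^ j
              2≤β^j = ≤-trans (subst (2 ≤_) (sym β-eq) (s≤s 1≤E)) (≤-trans (≤-reflexive (sym (^-identityʳ (b ^ l)))) (^-monoʳ-≤ (b ^ l) {{>-nonZero (1≤b^ l 1≤b)}} 1≤j))
            finish (x@(suc _) , x-eq) (K₁ , K₁-eq) = W , 2≤W ,
              ≈-trans (≈-sym (u-z (i₀ + j))) (≈-trans (≈-reflexive (cong u z-product))
              (≈-trans (mult (z i₀) (1 + t ^ suc size * W) (≤-trans (s≤s z≤n) (2≤z i₀)) (s≤s z≤n) z⊥) (∙-congʳ (u-z i₀))))
              where
              c′ W : ℕ
              c′ = g′ * g′ * b ^ K₁ * Δ * x
              W = z i₀ * c′
              1≤Δ : 1 ≤ Δ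
              1≤Δ = ≤-trans (*-mono-≤ 1≤E 1≤high) (m≤n+m (E * high) mid)
              1≤c′ : 1 ≤ c′
              1≤c′ = *-mono-≤ (*-mono-≤ (*-mono-≤ (*-mono-≤ 1≤g′ 1≤g′) (1≤b^ K₁ 1≤b)) 1≤Δ) (s≤s z≤n)
              2≤W : 2 ≤ W
              2≤W = *-mono-≤ (2≤z i₀) 1≤c′
              z⊥ : Coprime (z i₀) (1 + t ^ suc size * W)
              z⊥ = cg-1⇒coprime (cg-trans (cg-≡ (lem (t ^ suc size) (z i₀) c′)) (cg-+multiple 1 (t ^ suc size * c′)))
                where
                lem : ∀ T z c → 1 + T * (z * c) ≡ 1 + z * (T * c)
                lem = solve-∀
              power-eq : b ^ k * (b ^ l) ^ i₀ ≡ g * g′ * (g * g′) * t ^ suc size * b ^ K₁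
              power-eq = begin
                b ^ k * (b ^ l) ^ i₀                           ≡⟨ exponent ⟩
                b ^ (k + l * i₀)                               ≡⟨ cong (b ^_) (sym K₁-eq) ⟩
                b ^ (F + F + K₀ + K₁)                          ≡⟨ ^-distribˡ-+-* b (F + F + K₀) K₁ ⟩
                b ^ (F + F + K₀) * b ^ K₁                      ≡⟨ cong (_* b ^ K₁) (^-distribˡ-+-* b (F + F) K₀) ⟩
                b ^ (F + F) * b ^ K₀ * b ^ K₁                  ≡⟨ cong₂ (λ p q → p * q * b ^ K₁) (^-distribˡ-+-* b F F) (sym (t^ (suc size))) ⟩
                b ^ F * b ^ F * t ^ suc size * b ^ K₁          ≡⟨ cong (λ p → p * p * t ^ suc size * b ^ K₁) F-eq ⟩
                g * g′ * (g * g′) * t ^ suc size * b ^ K₁      ∎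
                where open ≡-Reasoning
              z-product : z (i₀ + j) ≡ z i₀ * (1 + t ^ suc size * W)
              z-product = begin
                z (i₀ + j)                                                         ≡⟨ z-shift i₀ j (y * y * x) 1≤E (trans x-eq (cong suc (*-assoc E (y * y) x))) ⟩
                z i₀ + b ^ k * (b ^ l) ^ i₀ * Δ * (y * y * x)                      ≡⟨ cong (λ p → z i₀ + p * Δ * (y * y * x)) power-eq ⟩
                z i₀ + g * g′ * (g * g′) * t ^ suc size * b ^ K₁ * Δ * (y * y * x) ≡⟨ lem (z i₀) g g′ (t ^ suc size) (b ^ K₁) Δ y x ⟩
                z i₀ + (g * y) * ((g * y) * (t ^ suc size * c′))                   ≡⟨ cong (λ p → z i₀ + p * (p * (t ^ suc size * c′))) (sym z-eq) ⟩
                z i₀ + z i₀ * (z i₀ * (t ^ suc size * c′))                         ≡⟨ lem₂ (z i₀) (t ^ suc size) c′ ⟩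
                z i₀ * (1 + t ^ suc size * W)                                      ∎
                where
                open ≡-Reasoning
                lem : ∀ z g g′ T B D y x → z + g * g′ * (g * g′) * T * B * D * (y * y * x) ≡ z + (g * y) * ((g * y) * (T * (g′ * g′ * B * D * x)))
                lem = solve-∀
                lem₂ : ∀ z T c → z + z * (z * (T * c)) ≡ z * (1 + T * (z * c))
                lem₂ = solve-∀

      loop-absorbed : Absorbed (z 0)
      loop-absorbed = collect (factor (coprime-part (z i₀) b F (≤-trans (s≤s z≤n) (2≤z i₀)) bounded))
        where
        collect : (∃ λ W → 2 ≤ W × u (z 0) ≈ u (z 0) ∙ u (1 + t ^ suc size * W)) → Absorbed (z 0)
        collect (W , 2≤W , e) with κ , abs ← absorbed-after-zeros W 2≤W =
          u (z 0) ∙ κ , ≈-trans e (≈-trans (∙-congˡ abs) (≈-sym (assoc (u (z 0)) κ v)))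

-- Periodicity off a prime divisor of b

cg⇒∣distance : ∀ {a b g} → a ≡ b [mod g ] → g ∣ ∣ a - b ∣
cg⇒∣distance {a} {b} c with ≤-total a b
... | inj₁ a≤b = subst (_ ∣_) (sym (m≤n⇒∣m-n∣≡n∸m a≤b)) (cg⇒∣∸ c a≤b)
... | inj₂ b≤a = subst (_ ∣_) (sym (m≤n⇒∣n-m∣≡n∸m b≤a)) (cg⇒∣∸ (cg-sym c) b≤a)

module PeriodicOffPrime {c ℓ} (CM : CommutativeMonoid c ℓ)
  {b : ℕ} {u : ℕ → CommutativeMonoid.Carrier CM} (2≤b : 2 ≤ b) (machine : Machine (CommutativeMonoid._≈_ CM) b u)
  (mult : CoprimeMultiplicative CM u)
  {p : ℕ} (pp : Prime p) (p∣b : p ∣ b) where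

  open CommutativeMonoid CM renaming (refl to ≈-refl; sym to ≈-sym; trans to ≈-trans; reflexive to ≈-reflexive)
  open Digits isEquivalence 2≤b machine
  open Machine machine

  module _ {v : Carrier} (generic : GenericAbsorbed CM u b v) where

    open Absorption CM 2≤b machine mult generic

    -- Two blocks of low digits of z, of lengths between 1 and `suc size`, lead to the same state,
    -- which gives the loop. Length at least 1 makes p divide `b ^ k`; as p divides neither E nor
    -- `low`, F is not 0.
    absorbed-large : ∀ z → b ^ suc size ≤ z → ¬ p ∣ z → AbsorbedBy CM u v z
    absorbed-large z large p∤z with i , j , i<j , j≤s , same ← pigeonhole-ℕ (n<1+n size) (λ i → read start (suc i) (_%_ z (b ^ suc i) {{>-nonZero (1≤b^ (suc i) 1≤b)}}))
      with d , refl ← m≤n⇒∃[o]m+o≡n i<j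
      with E , E-eq ← m≤n⇒∃[o]m+o≡n (1≤b^ (suc d) 1≤b)
      = transfer (loop-absorbed loop 1≤high (s≤s z≤n) (s≤s z≤n) 1≤E 1≤F (λ g → cg⇒∣distance))
      where
      k l : ℕ
      k = suc i
      l = suc d
      instance
        b^k≢0 : NonZero (b ^ k)
        b^k≢0 = >-nonZero (1≤b^ k 1≤b)
        b^k+l≢0 : NonZero (b ^ (k + l))
        b^k+l≢0 = >-nonZero (1≤b^ (k + l) 1≤b)
      low lowⱼ mid high F : ℕ
      low = z % b ^ k
      lowⱼ = z % b ^ (k + l)
      mid = lowⱼ / b ^ k
      high = z / b ^ (k + l)
      F = ∣ b ^ k * mid - E * low ∣
      k+l : suc (suc i + d) ≡ k + l
      k+l = sym (+-suc (suc i) d)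
      low-eq : lowⱼ % b ^ k ≡ low
      low-eq = m∣n⇒o%n%m≡o%m (b ^ k) (b ^ (k + l)) z (subst (b ^ k ∣_) (sym (^-distribˡ-+-* b k l)) (m∣m*n (b ^ l)))
      lowⱼ-eq : lowⱼ ≡ low + b ^ k * mid
      lowⱼ-eq = trans (m≡m%n+[m/n]*n lowⱼ (b ^ k)) (cong₂ _+_ low-eq (*-comm mid (b ^ k)))
      lem : ∀ low B mid L n → low + B * mid + B * L * n ≡ low + B * (mid + L * n)
      lem = solve-∀
      join : ∀ n → lowⱼ + b ^ (k + l) * n ≡ low + b ^ k * (mid + b ^ l * n)
      join n = trans (cong₂ (λ x y → x + y * n) lowⱼ-eq (^-distribˡ-+-* b k l)) (lem low (b ^ k) mid (b ^ l) n)
      same′ : read start k low ≡ read start (k + l) lowⱼ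
      same′ = trans same (cong (λ m → read start m (_%_ z (b ^ m) {{>-nonZero (1≤b^ m 1≤b)}})) k+l)
      loop : ∀ n → u (low + b ^ k * (mid + b ^ l * n)) ≈ u (low + b ^ k * n)
      loop n = ≈-trans (≈-reflexive (cong u (sym (join n)))) (≈-trans (start-correct (k + l) lowⱼ (m%n<n z (b ^ (k + l))) n)
        (≈-trans (≈-reflexive (cong (λ q → G q n) (sym same′))) (≈-sym (start-correct k low (m%n<n z (b ^ k)) n))))
      1≤high : 1 ≤ high
      1≤high = m≥n⇒m/n>0 (≤-trans (^-monoʳ-≤ b {{>-nonZero 1≤b}} (subst (_≤ suc size) k+l j≤s)) large)
      1≤E : 1 ≤ E
      1≤E = s≤s⁻¹ (subst (2 ≤_) (sym E-eq) (≤-trans 2≤b (≤-trans (≤-reflexive (sym (*-identityʳ b))) (*-monoʳ-≤ b (1≤b^ d 1≤b)))))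
      p∤low : ¬ p ∣ low
      p∤low p∣low = p∤z (cg-∣ (∣m⇒∣m*n (b ^ i) p∣b) (cg-sym (cg-% z (b ^ k))) p∣low)
      p∤E : ¬ p ∣ E
      p∤E p∣E = prime∤1 pp (∣m+n∣m⇒∣n (subst (p ∣_) (trans (sym E-eq) (+-comm 1 E)) (∣m⇒∣m*n (b ^ d) p∣b)) p∣E)
      1≤F : 1 ≤ F
      1≤F = n≢0⇒n>0 (λ F≡0 → prime∤* pp p∤E p∤low (subst (p ∣_) (∣m-n∣≡0⇒m≡n F≡0) (∣m⇒∣m*n mid (∣m⇒∣m*n (b ^ i) p∣b))))
      open Loop k l low mid high E (sym E-eq) using (loop-absorbed)
      z-eq : z ≡ low + b ^ k * (mid + b ^ l * high)
      z-eq = trans (m≡m%n+[m/n]*n z (b ^ (k + l))) (trans (cong (lowⱼ +_) (*-comm high (b ^ (k + l)))) (join high))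
      transfer : AbsorbedBy CM u v (low + b ^ k * high) → AbsorbedBy CM u v z
      transfer (κ , abs) = κ , ≈-trans (≈-reflexive (cong u z-eq)) (≈-trans (loop high) abs)

  -- H is a multiple of p, so that shifting by H preserves being prime to p.
  Period : Set ℓ
  Period = ∃₂ λ N H → 1 ≤ H × p ∣ H × (∀ z → N ≤ z → ¬ p ∣ z → u (z + H) ≈ u z)

  private
    module _ {l w C : ℕ} (1≤w : 1 ≤ w) (w<b^l : w < b ^ l) (1≤C : 1 ≤ C) (pass : ∀ x → Passes x l w C) where

      open Cells CM 2≤b machine mult 1≤C pass pp p∣b using (shift-in-cell)

      module _ {H e : ℕ} (1≤H : 1 ≤ H) (1≤e : 1 ≤ e) (p∣H : p ∣ H) (shift : CellShift CM u b p l w H e) where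

        open Values CM 2≤b machine mult pp p∣b {l} {w} {H} {e} 1≤w w<b^l 1≤H 1≤e p∣H shift

        with-anchor : (Σ Carrier λ v → ∃₂ λ m₀ P → 1 ≤ P × e + H ≤ m₀ × Anchor v m₀ P) → Period
        with-anchor (v , m₀ , P , 1≤P , room , anchored) = from-factor (cell-factor 1≤P room anchored)
          where
          from-factor : (∃ λ M₀ → ∀ m Q → M₀ ≤ m → InCell (b ^ m * w) m Q → ¬ p ∣ Q → ∃ λ Q′ → u Q ≈ u Q′ ∙ v × Q′ ≡ Q [mod H ] × H * w + 2 ≤ Q′) → Period
          from-factor (M₀ , factor) = (b ^ suc size + (H * w + 2)) , H , 1≤H , p∣H , periodic
            where
            -- p divides b and b divides R, so `1 + R * g` is prime to p; in a large enough cell it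
            -- therefore has v as a factor of its value.
            generic : GenericAbsorbed CM u b v
            generic R 1≤R b∣R with g , lo , hi ← arithmetic-progression-hits 1 R (b ^ (M₀ + (e + R)) * w + e) 1≤R (≤-trans 1≤e (m≤n+m e _)) =
              1 + R * g , s≤s z≤n , cg-+multiple 1 g , absorb (factor (M₀ + (e + R)) (1 + R * g) (m≤m+n M₀ (e + R)) inQ p∤Q)
              where
              m : ℕ
              m = M₀ + (e + R)
              inQ : InCell (b ^ m * w) m (1 + R * g)
              inQ = in-cell lo (≤-trans (s≤s hi) (subst (_< b ^ m * w + b ^ m) (sym (+-assoc (b ^ m * w) e R))
                (+-monoʳ-< (b ^ m * w) (≤-trans (s≤s (m≤n+m (e + R) M₀)) (n<b^n m 2≤b)))))
              p∤Q : ¬ p ∣ 1 + R * g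
              p∤Q d = prime∤1 pp (cg-∣ (∣-trans p∣b b∣R) (cg-+multiple 1 g) d)
              absorb : (∃ λ Q′ → u (1 + R * g) ≈ u Q′ ∙ v × Q′ ≡ 1 + R * g [mod H ] × H * w + 2 ≤ Q′) → AbsorbedBy CM u v (1 + R * g)
              absorb (Q′ , val , _) = u Q′ , val
            fixed : ∀ z → b ^ suc size ≤ z → ¬ p ∣ z → u z ∙ v ≈ u z
            fixed z large p∤z = from (absorbed-large generic z large p∤z)
              where
              from : AbsorbedBy CM u v z → u z ∙ v ≈ u z
              from (κ , abs) = ≈-trans (∙-congʳ abs) (≈-trans (assoc κ v v) (≈-trans (∙-congˡ (≈-sym (idempotent 1≤P room anchored))) (≈-sym abs)))
            periodic : ∀ z → b ^ suc size + (H * w + 2) ≤ z → ¬ p ∣ z → u (z + H) ≈ u z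
            periodic z large p∤z = ≈-trans (≈-sym (fixed (z + H) (≤-trans large₁ (m≤m+n z H)) p∤z+H))
              (≈-trans (≈-sym (value-shift 1≤P room anchored z (≤-trans (m≤n+m _ (b ^ suc size)) large) p∤z)) (fixed z large₁ p∤z))
              where
              large₁ : b ^ suc size ≤ z
              large₁ = ≤-trans (m≤m+n _ _) large
              p∤z+H : ¬ p ∣ z + H
              p∤z+H d = p∤z (∣m+n∣m⇒∣n (subst (p ∣_) (+-comm z H) d) p∣H)

        period-from-shift : Period
        period-from-shift = with-anchor anchor

      period-from-word : (∃₂ λ H e → 1 ≤ H × 1 ≤ e × p ∣ H × CellShift CM u b p l w H e) → Period
      period-from-word (H , e , 1≤H , 1≤e , p∣H , shift) = period-from-shift 1≤H 1≤e p∣H shift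

      period-from-pass : Period
      period-from-pass = period-from-word shift-in-cell

  opaque
    period : Period
    period with l , w , C , 1≤w , w< , 1≤C , pass ← universal-word = period-from-pass 1≤w w< 1≤C pass

-- The decomposition

prime-divisor : ∀ n → 2 ≤ n → ∃ λ p → Prime p × p ∣ n
prime-divisor n 2≤n with factorise n {{>-nonZero (≤-trans (s≤s z≤n) 2≤n)}}
... | record { factors = [] ; isFactorisation = e } = ⊥-elim (<-irrefl (sym e) 2≤n)
... | record { factors = p ∷ ps ; isFactorisation = e ; factorsPrime = pp ∷ _ } = p , pp , subst (p ∣_) (sym e) (m∣m*n (product ps))

Aux-spec : ∀ q f k m n → n ≡ (2 + q) ^ k * m → ¬ (2 + q) ∣ m → 1 ≤ m → n ≤ f →
  νAux f (2 + q) n ≡ k × freeAux f (2 + q) n ≡ m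
Aux-spec q zero k m n e p∤m 1≤m n≤f = ⊥-elim (<-irrefl refl (≤-trans (≤-trans (*-mono-≤ (1≤b^ k (s≤s (z≤n {suc q}))) 1≤m) (≤-reflexive (sym e))) n≤f))
Aux-spec q (suc f) zero m n e p∤m 1≤m n≤f with n % (2 + q) ≟ 0
... | yes d = ⊥-elim (p∤m (subst (2 + q ∣_) (trans e (+-identityʳ m)) (m%n≡0⇒n∣m n (2 + q) d)))
... | no _  = refl , trans e (+-identityʳ m)
Aux-spec q (suc f) (suc k) m n e p∤m 1≤m n≤f with n % (2 + q) ≟ 0
... | no ¬d = ⊥-elim (¬d (n∣m⇒m%n≡0 n (2 + q) (subst (2 + q ∣_) (sym e) (∣m⇒∣m*n m (m∣m*n ((2 + q) ^ k))))))
... | yes _ = let i₁ , i₂ = Aux-spec q f k m (n / (2 + q)) quot p∤m 1≤m small in cong suc i₁ , i₂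
  where
  lem : ∀ p a m → p * a * m ≡ a * m * p
  lem = solve-∀
  quot : n / (2 + q) ≡ (2 + q) ^ k * m
  quot = trans (/-congˡ (trans e (lem (2 + q) ((2 + q) ^ k) m))) (m*n/n≡m ((2 + q) ^ k * m) (2 + q))
  small : n / (2 + q) ≤ f
  small = s≤s⁻¹ (≤-trans (subst (_< n) (sym quot) (subst ((2 + q) ^ k * m <_) (sym (trans e (lem (2 + q) ((2 + q) ^ k) m)))
    (m<m*n ((2 + q) ^ k * m) (2 + q) {{>-nonZero (*-mono-≤ (1≤b^ k (s≤s (z≤n {suc q}))) 1≤m)}} (s≤s (s≤s z≤n))))) n≤f)

ν-pFree : ∀ {p} → Prime p → ∀ k m → ¬ p ∣ m → 1 ≤ m → ν p (p ^ k * m) ≡ k × pFree p (p ^ k * m) ≡ m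
ν-pFree {zero} pp with () ← prime≥2 pp
ν-pFree {suc zero} pp with (s≤s ()) ← prime≥2 pp
ν-pFree {suc (suc q)} pp k m p∤m 1≤m = Aux-spec q (suc (suc q) ^ k * m) k m _ refl p∤m 1≤m ≤-refl

reduce : (N P x : ℕ) .{{_ : NonZero P}} → ℕ
reduce N P x with x <? N
... | yes _ = x
... | no _  = N + (x ∸ N) % P

reduce< : ∀ N P x .{{_ : NonZero P}} → reduce N P x < N + P
reduce< N P x with x <? N
... | yes x<N = ≤-trans x<N (m≤m+n N P)
... | no _    = +-monoʳ-< N (m%n<n (x ∸ N) P)

prime∤⇒∤power : ∀ {p m} k → Prime p → ¬ p ∣ m → ¬ p ∣ m ^ k
prime∤⇒∤power zero    pp p∤m d = prime∤1 pp d
prime∤⇒∤power (suc k) pp p∤m d = prime∤* pp p∤m (prime∤⇒∤power k pp p∤m) d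

module _ {c ℓ} (F : CharZeroField c ℓ) where
  open CharZeroField F using (Carrier; _≈_; zeroˡ; zeroʳ; 1#; 0#; *-commutativeMonoid; isEquivalence; inverse)
    renaming (refl to ≈-refl; sym to ≈-sym; trans to ≈-trans; reflexive to ≈-reflexive; _*_ to _·_;
      *-comm to ·-comm; *-assoc to ·-assoc; *-identityˡ to ·-identityˡ; *-cong to ·-cong; *-congˡ to ·-congˡ; *-congʳ to ·-congʳ)


  module _ {f : ℕ → Carrier} {N P : ℕ} .{{_ : NonZero P}} (periodic : ∀ n → N ≤ n → f (n + P) ≈ f n) where

    periods : ∀ n g → N ≤ n → f (n + g * P) ≈ f n
    periods n zero    N≤n = ≈-reflexive (cong f (+-identityʳ n))
    periods n (suc g) N≤n = ≈-trans (≈-reflexive (cong f (lem n P (g * P)))) (≈-trans (periodic _ (≤-trans N≤n (m≤m+n n _))) (periods n g N≤n))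
      where
      lem : ∀ n P z → n + (P + z) ≡ n + z + P
      lem = solve-∀

    f-reduce : ∀ j x → f (j + x) ≈ f (j + reduce N P x)
    f-reduce j x with x <? N
    ... | yes _   = ≈-refl
    ... | no x≮N = ≈-trans (≈-reflexive (cong f eq)) (periods (j + (N + (x ∸ N) % P)) ((x ∸ N) / P) (≤-trans (m≤m+n N _) (m≤n+m _ j)))
      where
      lem : ∀ j N r z → j + (N + (r + z)) ≡ j + (N + r) + z
      lem = solve-∀
      eq : j + x ≡ j + (N + (x ∸ N) % P) + (x ∸ N) / P * P
      eq = trans (cong (j +_) (trans (sym (m+[n∸m]≡n (≮⇒≥ x≮N))) (cong (N +_) (m≡m%n+[m/n]*n (x ∸ N) P)))) (lem j N ((x ∸ N) % P) _)

    -- x is added n times, and the occurrences are reduced one by one.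
    f-reduce-multiple : ∀ n x B → f (n * x + B) ≈ f (n * reduce N P x + B)
    f-reduce-multiple zero    x B = ≈-refl
    f-reduce-multiple (suc n) x B = ≈-trans (≈-reflexive (cong f (lem x (n * x) B))) (≈-trans (f-reduce (n * x + B) x)
      (≈-trans (≈-reflexive (cong f (+-assoc (n * x) B (reduce N P x)))) (≈-trans (f-reduce-multiple n x (B + reduce N P x))
        (≈-reflexive (cong f (lem₂ (reduce N P x) (n * reduce N P x) B))))))
      where
      lem : ∀ x y B → x + y + B ≡ y + B + x
      lem = solve-∀
      lem₂ : ∀ x y B → y + (B + x) ≡ x + y + B
      lem₂ = solve-∀

  -- Sequences given by the formula

  module _ {p : ℕ} (pp : Prime p) {f₁ f₂ : ℕ → Carrier} where

    formula-at : ∀ k m → ¬ p ∣ m → 1 ≤ m → formula F p f₁ f₂ (p ^ k * m) ≡ f₁ k · f₂ m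
    formula-at k m p∤m 1≤m with e₁ , e₂ ← ν-pFree pp k m p∤m 1≤m = cong₂ (λ x y → f₁ x · f₂ y) e₁ e₂

    formula-multiplicative : Admissible F p f₁ f₂ → Multiplicative F (formula F p f₁ f₂)
    formula-multiplicative (f₁0 , _ , mult₂ , _ , _) m n 1≤m 1≤n m⊥n
      with x , m′ , refl , p∤m′ , 1≤m′ ← p-part p pp m 1≤m
      with y , n′ , refl , p∤n′ , 1≤n′ ← p-part p pp n 1≤n
      = ≈-trans (≈-reflexive (trans (cong (formula F p f₁ f₂) eq) (formula-at (x + y) (m′ * n′) (prime∤* pp p∤m′ p∤n′) (*-mono-≤ 1≤m′ 1≤n′))))
        (≈-trans (·-congˡ (mult₂ m′ n′ 1≤m′ 1≤n′ (coprime-∣ˡ (n∣m*n (p ^ x)) (coprime-∣ʳ (n∣m*n (p ^ y)) m⊥n))))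
        (≈-trans (separate x y m⊥n) (≈-reflexive (sym (cong₂ _·_ (formula-at x m′ p∤m′ 1≤m′) (formula-at y n′ p∤n′ 1≤n′))))))
      where
      lem : ∀ a m b n → a * m * (b * n) ≡ a * b * (m * n)
      lem = solve-∀
      eq : p ^ x * m′ * (p ^ y * n′) ≡ p ^ (x + y) * (m′ * n′)
      eq = trans (lem (p ^ x) m′ (p ^ y) n′) (cong (_* (m′ * n′)) (sym (^-distribˡ-+-* p x y)))
      -- At most one of two coprime numbers is divisible by p, so x or y is 0, and `f₁ 0 ≈ 1#`
      -- supplies the other factor.
      separate : ∀ x y → Coprime (p ^ x * m′) (p ^ y * n′) → f₁ (x + y) · (f₂ m′ · f₂ n′) ≈ (f₁ x · f₂ m′) · (f₁ y · f₂ n′)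
      separate zero y _ = ≈-trans (≈-sym (·-assoc _ _ _)) (≈-trans (·-congʳ (·-comm _ _)) (≈-trans (·-assoc _ _ _)
        (·-congʳ (≈-trans (≈-sym (·-identityˡ _)) (·-congʳ (≈-sym f₁0))))))
      separate (suc x) zero _ = ≈-trans (≈-sym (·-assoc _ _ _)) (·-cong (·-congʳ (≈-reflexive (cong f₁ (+-identityʳ (suc x)))))
        (≈-trans (≈-sym (·-identityˡ _)) (·-congʳ (≈-sym f₁0))))
      separate (suc x) (suc y) c = ⊥-elim (prime∤1 pp (subst (p ∣_) (c (∣m⇒∣m*n m′ (m∣m*n (p ^ x)) , ∣m⇒∣m*n n′ (m∣m*n (p ^ y)))) ∣-refl))

    -- For `r = p ^ j * r′` with j < k, the p-free part of `n * p ^ k + r` is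
    -- `n * p ^ (k - j) + r′`; so only j, the coefficient of n and r′ matter, each up to eventual
    -- periodicity. For r = 0 only k matters, in the same sense.
    decomposition⇒automatic : ∀ {u} → Decomposition F p u f₁ f₂ → Automatic[_] F p u
    decomposition⇒automatic {u} ((_ , (N₁ , P₁@(suc _) , _ , per₁) , _ , (N₂ , P₂@(suc _) , _ , per₂) , _) , u≈) =
      prime≥2 pp , map zeroSeq (upTo (N₁ + P₁)) ++ map tailSeq triples , kernel
      where
      zeroSeq : ℕ → ℕ → Carrier
      -- The formula says nothing about `u 0`, which is the value at n = 0 of every kernel sequence
      -- with r = 0.
      zeroSeq k zero      = u 0
      zeroSeq k n@(suc _) = f₁ (ν p n + k) · f₂ (pFree p n)
      tailSeq : ℕ × ℕ × ℕ → ℕ → Carrier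
      tailSeq (j , A , B) n = f₁ j · f₂ (n * A + B)
      triples : List (ℕ × ℕ × ℕ)
      triples = cartesianProduct (upTo (N₁ + P₁)) (cartesianProduct (upTo (N₂ + P₂)) (upTo (N₂ + P₂)))
      1≤p : 1 ≤ p
      1≤p = ≤-trans (s≤s z≤n) (prime≥2 pp)
      u-at : ∀ k m → ¬ p ∣ m → 1 ≤ m → u (p ^ k * m) ≈ f₁ k · f₂ m
      u-at k m p∤m 1≤m = ≈-trans (u≈ (p ^ k * m) (*-mono-≤ (1≤b^ k 1≤p) 1≤m)) (≈-reflexive (formula-at k m p∤m 1≤m))
      zero-kernel : ∀ k n → u (n * p ^ k + 0) ≈ zeroSeq (reduce N₁ P₁ k) n
      zero-kernel k zero = ≈-refl
      zero-kernel k n@(suc _) with x , n′ , e , p∤n′ , 1≤n′ ← p-part p pp n (s≤s z≤n)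
        with e₁ , e₂ ← ν-pFree pp x n′ p∤n′ 1≤n′ =
        ≈-trans (≈-reflexive (cong u eq)) (≈-trans (u-at (x + k) n′ p∤n′ 1≤n′) (·-cong
          (≈-trans (f-reduce {f₁} {N₁} {P₁} per₁ x k) (≈-reflexive (cong (λ z → f₁ (z + reduce N₁ P₁ k)) (sym (trans (cong (ν p) e) e₁)))))
          (≈-reflexive (cong f₂ (sym (trans (cong (pFree p) e) e₂))))))
        where
        lem : ∀ a n b → a * n * b + 0 ≡ a * b * n
        lem = solve-∀
        eq : n * p ^ k + 0 ≡ p ^ (x + k) * n′
        eq = trans (cong (λ z → z * p ^ k + 0) e) (trans (lem (p ^ x) n′ (p ^ k)) (cong (_* n′) (sym (^-distribˡ-+-* p x k))))
      tail-kernel : ∀ k r → 1 ≤ r → r < p ^ k → ∃ λ j → ∃₂ λ A B → j < N₁ + P₁ × A < N₂ + P₂ × B < N₂ + P₂ ×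
        (∀ n → u (n * p ^ k + r) ≈ tailSeq (j , A , B) n)
      tail-kernel k r 1≤r r<p^k with j , r′ , refl , p∤r′ , 1≤r′ ← p-part p pp r 1≤r
        with i , refl ← m≤n⇒∃[o]m+o≡n (^-cancelʳ-< {p} {j} {k} 1≤p (≤-trans (s≤s (m≤m*n (p ^ j) r′ {{>-nonZero 1≤r′}})) r<p^k))
        = reduce N₁ P₁ j , reduce N₂ P₂ (p ^ suc i) , reduce N₂ P₂ r′ , reduce< N₁ P₁ j , reduce< N₂ P₂ (p ^ suc i) , reduce< N₂ P₂ r′ , values
        where
        lem : ∀ n a b r → n * (a * b) + a * r ≡ a * (n * b + r)
        lem = solve-∀
        eq : ∀ n → n * p ^ (suc j + i) + p ^ j * r′ ≡ p ^ j * (n * p ^ suc i + r′)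
        eq n = trans (cong (λ z → n * z + p ^ j * r′) (trans (cong (p ^_) (sym (+-suc j i))) (^-distribˡ-+-* p j (suc i)))) (lem n (p ^ j) (p ^ suc i) r′)
        values : ∀ n → u (n * p ^ (suc j + i) + p ^ j * r′) ≈ f₁ (reduce N₁ P₁ j) · f₂ (n * reduce N₂ P₂ (p ^ suc i) + reduce N₂ P₂ r′)
        values n = ≈-trans (≈-reflexive (cong u (eq n))) (≈-trans
          (u-at j (n * p ^ suc i + r′) (λ d → p∤r′ (∣m+n∣m⇒∣n d (∣n⇒∣m*n n (m∣m*n (p ^ i))))) (≤-trans 1≤r′ (m≤n+m r′ _)))
          (·-cong (f-reduce {f₁} {N₁} {P₁} per₁ 0 j) (≈-trans (f-reduce {f₂} {N₂} {P₂} per₂ (n * p ^ suc i) r′) (f-reduce-multiple {f₂} {N₂} {P₂} per₂ n (p ^ suc i) _))))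
      kernel : ∀ k r → r < p ^ k → Any (λ g → ∀ n → u (n * p ^ k + r) ≈ g n) (map zeroSeq (upTo (N₁ + P₁)) ++ map tailSeq triples)
      kernel k zero _ = ++⁺ˡ (map⁺ (lose (∈-upTo⁺ (reduce< N₁ P₁ k)) (zero-kernel k)))
      kernel k r@(suc _) r< with j , A , B , j< , A< , B< , h ← tail-kernel k r (s≤s z≤n) r< =
        ++⁺ʳ (map zeroSeq (upTo (N₁ + P₁))) (map⁺ (lose (∈-cartesianProduct⁺ (∈-upTo⁺ j<) (∈-cartesianProduct⁺ (∈-upTo⁺ A<) (∈-upTo⁺ B<))) h))

  -- Off p, `f₂` is u. The value `f₂ 1` is idempotent; were it 0, u would vanish on positive numbers
  -- and be eventually periodic. So it is 1, and `f₁ k` is the value of u at `p ^ k`.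
  decomposition-unique : ∀ {p} → Prime p → ∀ {u} → ¬ EventuallyPeriodic F u → ∀ {f₁ f₂ g₁ g₂} →
    Decomposition F p u f₁ f₂ → Decomposition F p u g₁ g₂ → (∀ n → f₁ n ≈ g₁ n) × (∀ n → 1 ≤ n → f₂ n ≈ g₂ n)
  decomposition-unique {p} pp {u} aperiodic {f₁} {f₂} {g₁} {g₂} ((f₁0 , _ , mult-f , _ , f-van) , u≈f) ((g₁0 , _ , mult-g , _ , g-van) , u≈g) = same₁ , same₂
    where
    1≤p : 1 ≤ p
    1≤p = ≤-trans (s≤s z≤n) (prime≥2 pp)
    off : ∀ {h₁ h₂} → h₁ 0 ≈ 1# → (∀ n → 1 ≤ n → u n ≈ formula F p h₁ h₂ n) → ∀ n → ¬ p ∣ n → 1 ≤ n → u n ≈ h₂ n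
    off {h₁} {h₂} h₁0 u≈h n p∤n 1≤n = ≈-trans (u≈h n 1≤n) (≈-trans (≈-reflexive (trans (cong (formula F p h₁ h₂) (sym (+-identityʳ n)))
      (formula-at pp {h₁} {h₂} 0 n p∤n 1≤n))) (≈-trans (·-congʳ h₁0) (·-identityˡ _)))
    same₂ : ∀ n → 1 ≤ n → f₂ n ≈ g₂ n
    same₂ n 1≤n with p ∣? n
    ... | yes p∣n = ≈-trans (f-van n 1≤n p∣n) (≈-sym (g-van n 1≤n p∣n))
    ... | no p∤n = ≈-trans (≈-sym (off {f₁} {f₂} f₁0 u≈f n p∤n 1≤n)) (off {g₁} {g₂} g₁0 u≈g n p∤n 1≤n)
    f₂1-idem : f₂ 1 ≈ f₂ 1 · f₂ 1
    f₂1-idem = mult-f 1 1 (s≤s z≤n) (s≤s z≤n) (Cop.1-coprimeTo 1)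
    u≈0 : f₂ 1 ≈ 0# → ∀ n → 1 ≤ n → u n ≈ 0#
    u≈0 f₂1≈0 n 1≤n = ≈-trans (u≈f n 1≤n) (≈-trans (·-congˡ vanishes) (zeroʳ _))
      where
      1≤free : ∀ n → 1 ≤ n → 1 ≤ pFree p n
      1≤free n 1≤n with x , n′ , refl , p∤n′ , 1≤n′ ← p-part p pp n 1≤n = subst (1 ≤_) (sym (proj₂ (ν-pFree pp x n′ p∤n′ 1≤n′))) 1≤n′
      vanishes : f₂ (pFree p n) ≈ 0#
      vanishes = ≈-trans (≈-reflexive (cong f₂ (sym (+-identityʳ (pFree p n))))) (≈-trans
        (mult-f 1 (pFree p n) (s≤s z≤n) (1≤free n 1≤n) (Cop.1-coprimeTo _)) (≈-trans (·-congʳ f₂1≈0) (zeroˡ _)))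
    f₂1≉0 : ¬ f₂ 1 ≈ 0#
    f₂1≉0 e = aperiodic (1 , 1 , s≤s z≤n , λ n 1≤n → ≈-trans (u≈0 e (n + 1) (m≤n+m 1 n)) (≈-sym (u≈0 e n 1≤n)))
    f₂1≈1 : f₂ 1 ≈ 1#
    f₂1≈1 with y , inv ← inverse (f₂ 1) f₂1≉0 = ≈-trans (≈-sym (≈-trans (·-comm _ _) (·-identityˡ _))) (≈-trans (·-congˡ (≈-sym inv))
      (≈-trans (≈-sym (·-assoc _ _ _)) (≈-trans (·-congʳ (≈-sym f₂1-idem)) inv)))
    recover : ∀ {h₁ h₂} → (∀ n → 1 ≤ n → u n ≈ formula F p h₁ h₂ n) → h₂ 1 ≈ 1# → ∀ k → u (p ^ k * 1) ≈ h₁ k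
    recover {h₁} {h₂} u≈h h₂1 k = ≈-trans (u≈h _ (*-mono-≤ (1≤b^ k 1≤p) ≤-refl)) (≈-trans (≈-reflexive (formula-at pp {h₁} {h₂} k 1 (prime∤1 pp) ≤-refl))
      (≈-trans (·-congˡ h₂1) (≈-trans (·-comm _ _) (·-identityˡ _))))
    same₁ : ∀ n → f₁ n ≈ g₁ n
    same₁ k = ≈-trans (≈-sym (recover {f₁} {f₂} u≈f f₂1≈1 k)) (recover {g₁} {g₂} u≈g (≈-trans (≈-sym (same₂ 1 ≤-refl)) f₂1≈1) k)

  -- Extracting the two factors from u

  module _ {u : ℕ → Carrier} (mult : Multiplicative F u) where

    -- `at-powers` is `1#` at 0 rather than `u 1`, which is 0 when u vanishes on positive numbers.
    at-powers at-units : ℕ → ℕ → Carrier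
    at-powers p zero      = 1#
    at-powers p k@(suc _) = u (p ^ k)
    at-units p n with p ∣? n
    ... | yes _ = 0#
    ... | no _  = u n

    at-units-∤ : ∀ {p n} → ¬ p ∣ n → at-units p n ≈ u n
    at-units-∤ {p} {n} p∤n with p ∣? n
    ... | yes p∣n = ⊥-elim (p∤n p∣n)
    ... | no _    = ≈-refl

    at-units-∣ : ∀ {p n} → p ∣ n → at-units p n ≈ 0#
    at-units-∣ {p} {n} p∣n with p ∣? n
    ... | yes _  = ≈-refl
    ... | no p∤n = ⊥-elim (p∤n p∣n)

    at-units-multiplicative : ∀ {p} → Prime p → Multiplicative F (at-units p)
    at-units-multiplicative {p} pp m n 1≤m 1≤n m⊥n with p ∣? m | p ∣? n
    ... | yes p∣m | _       = ≈-trans (at-units-∣ (∣m⇒∣m*n n p∣m)) (≈-sym (zeroˡ _))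
    ... | no p∤m  | yes p∣n = ≈-trans (at-units-∣ (∣n⇒∣m*n m p∣n)) (≈-sym (zeroʳ _))
    ... | no p∤m  | no p∤n  = ≈-trans (at-units-∤ (prime∤* pp p∤m p∤n)) (mult m n 1≤m 1≤n m⊥n)

    recombine : ∀ {p} → Prime p → ∀ n → 1 ≤ n → u n ≈ formula F p (at-powers p) (at-units p) n
    recombine {p} pp n 1≤n with x , n′ , refl , p∤n′ , 1≤n′ ← p-part p pp n 1≤n =
      ≈-trans (split x) (≈-reflexive (sym (formula-at pp {at-powers p} {at-units p} x n′ p∤n′ 1≤n′)))
      where
      split : ∀ x → u (p ^ x * n′) ≈ at-powers p x · at-units p n′
      split zero = ≈-trans (≈-reflexive (cong u (+-identityʳ n′))) (≈-trans (≈-sym (at-units-∤ p∤n′)) (≈-sym (·-identityˡ _)))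
      split (suc x) = ≈-trans (mult (p ^ suc x) n′ (1≤b^ (suc x) (≤-trans (s≤s z≤n) (prime≥2 pp))) 1≤n′
        (Cop.sym (coprime-^ʳ (suc x) (Cop.sym (prime∤⇒coprime pp p∤n′))))) (·-congˡ (≈-sym (at-units-∤ p∤n′)))

    module _ {b : ℕ} (2≤b : 2 ≤ b) (machine : Machine _≈_ b u) where

      open Digits isEquivalence 2≤b machine
      open Machine machine
      private module Off {p} (pp : Prime p) (p∣b : p ∣ b) = PeriodicOffPrime *-commutativeMonoid 2≤b machine mult pp p∣b

      at-units-periodic : ∀ {p} → Prime p → p ∣ b → EventuallyPeriodic F (at-units p)
      at-units-periodic {p} pp p∣b = from (Off.period pp p∣b)
        where
        from : Off.Period pp p∣b → EventuallyPeriodic F (at-units p)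
        from (N , H , 1≤H , p∣H , per) = N , H , 1≤H , periodic
          where
          periodic : ∀ n → N ≤ n → at-units p (n + H) ≈ at-units p n
          periodic n N≤n with p ∣? n
          ... | yes p∣n = at-units-∣ (∣m∣n⇒∣m+n p∣n p∣H)
          ... | no p∤n  = ≈-trans (at-units-∤ (λ d → p∤n (∣m+n∣m⇒∣n (subst (p ∣_) (+-comm n H) d) p∣H))) (per n N≤n p∤n)

      -- Multiplying by `b = p ^ a` appends a zero digit, so pumping zeros yields the period
      -- `a * size !`.
      powers-periodic-by-zeros : ∀ {p a} → 1 ≤ a → b ≡ p ^ a → EventuallyPeriodic F (at-powers p)
      powers-periodic-by-zeros {p} {a} 1≤a b-eq = suc (a * size) , a * size ! , *-mono-≤ 1≤a (1≤n! size) , periodic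
        where
        power : ∀ i x → p ^ (a * i + x) ≡ b ^ i * p ^ x
        power i x = trans (^-distribˡ-+-* p (a * i) x) (cong (_* p ^ x) (trans (sym (^-*-assoc p a i)) (cong (_^ i) (sym b-eq))))
        shift : ∀ x → u (p ^ (a * size + x + a * size !)) ≈ u (p ^ (a * size + x))
        shift x = ≈-trans (≈-reflexive (cong u (trans (cong (p ^_) (lem a size x (size !))) (power (size + size ! * 1) x))))
          (≈-trans (G-start _) (≈-trans (zeros-pump start size 1 (p ^ x) ≤-refl) (≈-trans (≈-sym (G-start _)) (≈-reflexive (cong u (sym (power size x)))))))
          where
          lem : ∀ a s x f → a * s + x + a * f ≡ a * (s + f * 1) + x
          lem = solve-∀
        periodic : ∀ n → suc (a * size) ≤ n → at-powers p (n + a * size !) ≈ at-powers p n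
        periodic (suc n) (s≤s h) with x , e ← m≤n⇒∃[o]m+o≡n {a * size} {suc n} (≤-trans h (n≤1+n n)) =
          ≈-trans (≈-reflexive (cong (λ z → u (p ^ (z + a * size !))) (sym e))) (≈-trans (shift x) (≈-reflexive (cong (λ z → u (p ^ z)) e)))

      -- The powers of p are prime to p′ and eventually periodic modulo the period that u has off
      -- p′.
      powers-periodic-by-prime : ∀ {p p′} → 2 ≤ p → Prime p′ → p′ ∣ b → ¬ p′ ∣ p → EventuallyPeriodic F (at-powers p)
      powers-periodic-by-prime {p} {p′} 2≤p pp′ p′∣b p′∤p = from (Off.period pp′ p′∣b)
        where
        from : Off.Period pp′ p′∣b → EventuallyPeriodic F (at-powers p)
        from (N , H , 1≤H , p′∣H , per) = with-powers (powers-periodic p H 1≤H)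
          where
          iterate : ∀ z g → N ≤ z → ¬ p′ ∣ z → u (z + H * g) ≈ u z
          iterate z zero    _   _    = ≈-reflexive (cong u (trans (cong (z +_) (*-zeroʳ H)) (+-identityʳ z)))
          iterate z (suc g) N≤z p′∤z = ≈-trans (≈-reflexive (cong u (lem z H g))) (≈-trans
            (per (z + H * g) (≤-trans N≤z (m≤m+n z _)) (λ d → p′∤z (∣m+n∣m⇒∣n (subst (p′ ∣_) (+-comm z (H * g)) d) (∣m⇒∣m*n g p′∣H)))) (iterate z g N≤z p′∤z))
            where
            lem : ∀ z H g → z + H * suc g ≡ z + H * g + H
            lem = solve-∀
          with-powers : (∃₂ λ i P → 1 ≤ P × (∀ m → i ≤ m → p ^ (m + P) ≡ p ^ m [mod H ])) → EventuallyPeriodic F (at-powers p)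
          with-powers (i , P , 1≤P , cg) = suc (i + N) , P , 1≤P , periodic
            where
            periodic : ∀ n → suc (i + N) ≤ n → at-powers p (n + P) ≈ at-powers p n
            periodic n@(suc _) h = advance (cg-split (cg n (≤-trans (m≤m+n i N) (≤-trans (n≤1+n _) h))) (^-monoʳ-≤ p {{>-nonZero (≤-trans (s≤s z≤n) 2≤p)}} (m≤m+n n P)))
              where
              advance : (∃ λ g → p ^ (n + P) ≡ p ^ n + H * g) → u (p ^ (n + P)) ≈ u (p ^ n)
              advance (g , e) = ≈-trans (≈-reflexive (cong u e)) (iterate (p ^ n) g
                (≤-trans (≤-trans (m≤n+m N i) (≤-trans (n≤1+n _) h)) (<⇒≤ (n<b^n n 2≤p))) (prime∤⇒∤power n pp′ p′∤p))

      at-powers-periodic : ∀ {p} → Prime p → p ∣ b → EventuallyPeriodic F (at-powers p)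
      at-powers-periodic {p} pp p∣b with p-part p pp b 1≤b
      ... | zero  , b′ , e , p∤b′ , _ = ⊥-elim (p∤b′ (subst (p ∣_) (trans e (+-identityʳ b′)) p∣b))
      ... | suc a , suc zero , e , _ , _ = powers-periodic-by-zeros (s≤s (z≤n {a})) (trans e (*-identityʳ _))
      ... | suc a , b′@(suc (suc _)) , e , p∤b′ , _ with p′ , pp′ , p′∣b′ ← prime-divisor b′ (s≤s (s≤s z≤n)) =
        powers-periodic-by-prime (prime≥2 pp) pp′ (subst (p′ ∣_) (sym e) (∣n⇒∣m*n (p ^ suc a) p′∣b′)) distinct
        where
        distinct : ¬ p′ ∣ p
        distinct d with prime⇒irreducible pp d
        ... | inj₁ refl = prime∤1 pp′ ∣-refl
        ... | inj₂ refl = p∤b′ p′∣b′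

    decompose : Automatic F u → Σ ℕ λ p → Prime p × Automatic[_] F p u ×
      Σ (ℕ → Carrier) λ f₁ → Σ (ℕ → Carrier) λ f₂ → Decomposition F p u f₁ f₂
    decompose (b , 2≤b , L , kernel) with p , pp , p∣b ← prime-divisor b 2≤b =
      p , pp , decomposition⇒automatic pp decomposition , at-powers p , at-units p , decomposition
      where
      machine : Machine _≈_ b u
      machine = kernel⇒machine isEquivalence L kernel
      decomposition : Decomposition F p u (at-powers p) (at-units p)
      decomposition = (≈-refl , at-powers-periodic 2≤b machine pp p∣b , at-units-multiplicative pp , at-units-periodic 2≤b machine pp p∣b ,
        λ n _ p∣n → at-units-∣ p∣n) , recombine pp

theorem1p1 : ∀ {c ℓ} (F : CharZeroField c ℓ) → let open CharZeroField F in
    ((u : ℕ → Carrier) → Multiplicative F u → Automatic F u →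
    Σ ℕ λ p → Prime p × Automatic[_] F p u ×
    Σ (ℕ → Carrier) λ f₁ → Σ (ℕ → Carrier) λ f₂ → Decomposition F p u f₁ f₂)
    × ((p : ℕ) → Prime p → (f₁ f₂ : ℕ → Carrier) → Admissible F p f₁ f₂ →
    Multiplicative F (formula F p f₁ f₂) × Automatic[_] F p (formula F p f₁ f₂))
    × ((p : ℕ) → Prime p → (u : ℕ → Carrier) → ¬ EventuallyPeriodic F u →
    (f₁ f₂ g₁ g₂ : ℕ → Carrier) →
    Decomposition F p u f₁ f₂ → Decomposition F p u g₁ g₂ →
    (∀ n → f₁ n ≈ g₁ n) × (∀ n → 1 ≤ n → f₂ n ≈ g₂ n))
theorem1p1 F = (λ u mult → decompose F mult) ,
  (λ p pp f₁ f₂ adm → formula-multiplicative F pp adm , decomposition⇒automatic F pp (adm , λ n _ → CharZeroField.refl F)) ,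
  (λ p pp u aperiodic f₁ f₂ g₁ g₂ d d′ → decomposition-unique F pp aperiodic {f₁} {f₂} {g₁} {g₂} d d′)
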